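{- Let $s\ge2$, $t\ge1$ and $k\ge1$ be integers, put $T=t\cdot\phi(s,t)$, and suppose $k\ge(t+T)(t-1)$. There exists $n_0=n_0(s,k)$ such that for all $n\ge n_0$ the following holds. Let $\mathcal F\subset\binom{[n]}{k}$ be an extremal family (i.e. of maximum possible cardinality) among all subfamilies of $\binom{[n]}{k}$ that do not contain a sunflower with $s$ petals and core of size exactly $t-1$. Then there exists a family $\mathcal S_*$ of subsets of $[n]$ such that (1) $\mathcal S_*$ does not contain a sunflower with $s$ petals and core of size at most $t-1$; (2) $\mathcal S_*\subset\bigcup_{q=t}^{T}\binom{\operatorname{supp}\mathcal S_*^{(t)}}{q}$; (3) the vector $\widetilde\phi(\mathcal S_*)=(\widetilde\phi_0(\mathcal S_*),\dots,\widetilde\phi_{T-t}(\mathcal S_*))$ is maximal in the lexicographical order among all families satisfying (1) and (2) (with that family in place of $\mathcal S_*$); and $$\mathcal F=\Big\{F\in\binom{[n]}{k} : F\cap\operatorname{supp}\mathcal S_*^{(t)}\in\mathcal S_*\Big\}.$$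
   Context: $[n]=\{1,\dots,n\}$, and $\binom{X}{q}$ is the family of all $q$-element subsets of $X$. A family of $s$ (distinct) sets $\{F_1,\dots,F_s\}$ is a sunflower with $s$ petals if $F_i\cap F_j=\bigcap_{u=1}^s F_u$ for all distinct $i,j\in[s]$; the set $\bigcap_{u=1}^sF_u$ is its core. $\phi(s,t)$ denotes the maximum size of a family of $t$-element sets (on an arbitrary ground set) that does not contain a sunflower with $s$ petals (with arbitrary core). For a family $\mathcal S$: $\operatorname{supp}\mathcal S=\bigcup_{S\in\mathcal S}S$ and $\mathcal S^{(h)}=\{S\in\mathcal S : |S|=h\}$. The components of $\widetilde\phi$ are $$\widetilde\phi_0(\mathcal S)=|\mathcal S^{(t)}|,\qquad \widetilde\phi_i(\mathcal S)=|\mathcal S^{(t+i)}|+\sum_{j=0}^{i-1}|\mathcal S^{(t+j)}|\binom{T-|\operatorname{supp}\mathcal S^{(t)}|}{i-j}\quad(1\le i\le T-t),$$ with the convention $\binom{m}{a}=0$ if $m<a$. -}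

module Defs where

open import Data.Fin.Base using (Fin; toℕ)
open import Data.Fin.Subset using (Subset; _∩_; _⊆_; ⋂; ⋃; ∣_∣)
import Data.List.Base as List
open import Data.List.Base using (List; length; filter; map; sum; upTo)
open import Data.List.Membership.Propositional using (_∈_)
open import Data.List.Relation.Unary.Unique.Propositional using (Unique)
open import Data.List.Relation.Unary.Unique.Propositional.Properties using (filter⁺)
open import Data.Nat.Base using (ℕ; suc; _+_; _*_; _∸_; _≤_; _<_)
open import Data.Nat.Combinatorics using (_C_)
open import Data.Nat.Properties using (_≟_)
open import Data.Product.Base using (_×_; ∃-syntax; Σ-syntax)
import Data.Vec.Base as Vec
open import Data.Vec.Base using (Vec)
open import Data.Vec.Relation.Binary.Lex.Strict using (Lex-≤)
open import Function.Definitions using (Injective)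
open import Level using (0ℓ)
open import Relation.Binary.PropositionalEquality.Core using (_≡_; _≢_)
open import Relation.Nullary.Negation.Core using (¬_)
open import Relation.Unary using (Pred; U)

-- [n] is modelled by Fin n.  A family is a duplicate-free list, so its
-- cardinality is the length; the order of the list is irrelevant, and
-- families are only ever compared through membership.
record Family (n : ℕ) : Set where
  constructor family
  field
    members : List (Subset n)
    unique  : Unique members

open Family public

infix 4 _∈ᶠ_

_∈ᶠ_ : ∀ {n} → Subset n → Family n → Set
A ∈ᶠ 𝓢 = A ∈ members 𝓢

size : ∀ {n} → Family n → ℕ
size 𝓢 = length (members 𝓢)

supp : ∀ {n} → Family n → Subset n
supp 𝓢 = ⋃ (members 𝓢)

infix 8 _⟨_⟩

-- 𝓢 ⟨ h ⟩ is 𝓢⁽ʰ⁾.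
_⟨_⟩ : ∀ {n} → Family n → ℕ → Family n
𝓢 ⟨ h ⟩ = family (filter (λ A → ∣ A ∣ ≟ h) (members 𝓢))
                 (filter⁺ (λ A → ∣ A ∣ ≟ h) (unique 𝓢))

Uniform : ∀ {n} → ℕ → Family n → Set
Uniform k 𝓢 = ∀ {A} → A ∈ᶠ 𝓢 → ∣ A ∣ ≡ k

core : ∀ {s n} → (Fin s → Subset n) → Subset n
core F = ⋂ (List.tabulate F)

-- Injectivity says that the s petals are distinct sets.
IsSunflower : ∀ {s n} → (Fin s → Subset n) → Set
IsSunflower F = Injective _≡_ _≡_ F × (∀ {i j} → i ≢ j → F i ∩ F j ≡ core F)

-- 𝓢 contains a sunflower with s petals whose core has size satisfying P.
ContainsSunflower : ∀ {n} → ℕ → Pred ℕ 0ℓ → Family n → Set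
ContainsSunflower {n} s P 𝓢 =
  Σ[ F ∈ (Fin s → Subset n) ]
    IsSunflower F × (∀ i → F i ∈ᶠ 𝓢) × P ∣ core F ∣

-- IsSunflowerNumber s t φ says that φ = φ(s, t).  Both clauses range over
-- all finite ground sets; this loses nothing, since finitely many t-element
-- sets have a finite union.
IsSunflowerNumber : ℕ → ℕ → ℕ → Set
IsSunflowerNumber s t φ =
  (∃[ N ] Σ[ 𝓐 ∈ Family N ] Admissible 𝓐 × size 𝓐 ≡ φ) ×
  (∀ {N} (𝓐 : Family N) → Admissible 𝓐 → size 𝓐 ≤ φ)
  where
  Admissible : ∀ {N} → Family N → Set
  Admissible 𝓐 = Uniform t 𝓐 × ¬ ContainsSunflower s U 𝓐

-- 𝓕 is a largest k-uniform family without a sunflower with s petals and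
-- core of size exactly c.
IsExtremal : ∀ {n} → (s c k : ℕ) → Family n → Set
IsExtremal {n} s c k 𝓕 =
  Admissible 𝓕 × (∀ (𝓖 : Family n) → Admissible 𝓖 → size 𝓖 ≤ size 𝓕)
  where
  Admissible : Family n → Set
  Admissible 𝓖 = Uniform k 𝓖 × ¬ ContainsSunflower s (_≡ c) 𝓖

-- For i = 0 the sum is empty, leaving |𝓢⁽ᵗ⁾|.  The truncated subtraction
-- T ∸ |supp 𝓢⁽ᵗ⁾| is exact on the families of interest: when
-- T = t · φ(s, t) and 𝓢⁽ᵗ⁾ contains no sunflower with s petals,
-- |supp 𝓢⁽ᵗ⁾| ≤ t · |𝓢⁽ᵗ⁾| ≤ T.
φ̃-component : ∀ {n} → (t T : ℕ) → Family n → ℕ → ℕ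
φ̃-component t T 𝓢 i =
  size (𝓢 ⟨ t + i ⟩) +
  sum (map (λ j → size (𝓢 ⟨ t + j ⟩) * ((T ∸ ∣ supp (𝓢 ⟨ t ⟩) ∣) C (i ∸ j)))
           (upTo i))

φ̃ : ∀ {n} → (t T : ℕ) → Family n → Vec ℕ (suc (T ∸ t))
φ̃ t T 𝓢 = Vec.tabulate (λ i → φ̃-component t T 𝓢 (toℕ i))

infix 4 _≤ₗₑₓ_

_≤ₗₑₓ_ : ∀ {m} → Vec ℕ m → Vec ℕ m → Set
_≤ₗₑₓ_ = Lex-≤ _≡_ _<_

NoSmallCoreSunflower : ∀ {n} → (s t : ℕ) → Family n → Set
NoSmallCoreSunflower s t 𝓢 = ¬ ContainsSunflower s (_≤ t ∸ 1) 𝓢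

SupportedOnBase : ∀ {n} → (t T : ℕ) → Family n → Set
SupportedOnBase t T 𝓢 =
  ∀ {A} → A ∈ᶠ 𝓢 → A ⊆ supp (𝓢 ⟨ t ⟩) × t ≤ ∣ A ∣ × ∣ A ∣ ≤ T

-- The lexicographic order is total, so a maximal vector is one that
-- dominates all others.
IsLexMaximal : ∀ {n} → (s t T : ℕ) → Family n → Set
IsLexMaximal {n} s t T 𝓢 =
  ∀ (𝓣 : Family n) → NoSmallCoreSunflower s t 𝓣 → SupportedOnBase t T 𝓣 →
  φ̃ t T 𝓣 ≤ₗₑₓ φ̃ t T 𝓢

{-# OPTIONS --safe #-}
module Submission where

-- Call a set extendable if, avoiding any given bounded set disjoint from it, it
-- can be extended to a member of 𝓕, and blocked otherwise.  Extendable sets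
-- E₁, …, E_s that pairwise meet in the same t - 1 elements extend to a forbidden
-- sunflower, while every blocked set E causes order n^(k-|E|) k-sets to be missing
-- from 𝓕.  A closure argument in the style of Frankl and Füredi yields, for all
-- but O(n^(k-t-1)) members F, a root: a t-subset G such that all sets between G
-- and F are extendable.  The roots G belonging to the same F ∖ G, and even those
-- belonging to two sets F ∖ G with t - 1 common elements, form a family without
-- sunflowers.  By extremality almost all F ∖ G have the maximal number of roots,
-- hence almost all have the same roots; these make up 𝒮⁽ᵗ⁾ and its support Y.
--
-- Then one proceeds by induction on the size a of the traces F ∩ Y.  As before,
-- up to O(n^(k-a-1)) exceptions the members of 𝓕 with traces of size a are those
-- with traces in one maximal collection.  Exchanging the atypical members for the
-- missing sets with typical traces would enlarge 𝓕 unless there is nothing to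
-- exchange, since each blocked d-set is responsible for order n^(k-a-d) missing
-- sets but only for order n^(k-a-d-1) atypical ones.  Finally,
-- |𝓕| = Σ φ̃ᵢ(𝒮) C(n-T, k-t-i), so the extremality of 𝓕 makes φ̃(𝒮)
-- lexicographically maximal.

open import Defs
open import Data.Bool.Base using (Bool)
import Data.Bool.Properties as Bool
open import Data.Empty using (⊥; ⊥-elim)
open import Data.Fin.Base as Fin using (Fin; zero; suc; toℕ; fromℕ<)
import Data.Fin.Properties as Fin
open import Data.Fin.Subset using (Subset; inside; outside; _∈_; _∉_; _⊆_; _∩_; _∪_; _─_; _-_; ∁; ⋃; ⋂; ⁅_⁆; ∣_∣; Nonempty) renaming (⊥ to ∅; ⊤ to full)
open import Data.Fin.Subset.Properties
open import Data.List.Base as List using (List; []; _∷_; [_]; _++_; map; length; filter; concatMap; upTo; cartesianProduct; cartesianProductWith)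
import Data.List.Properties as List
open import Data.List.Membership.Propositional using (find; lose) renaming (_∈_ to _∈ₗ_; _∉_ to _∉ₗ_)
open import Data.List.Membership.Propositional.Properties using (∈-++⁺ˡ; ∈-++⁺ʳ; ∈-++⁻; ∈-map⁺; ∈-map⁻; ∈-filter⁺; ∈-filter⁻; ∈-concat⁺′; ∈-concat⁻′; ∈-∃++; ∈-cartesianProductWith⁺; ∈-cartesianProduct⁺; ∈-upTo⁺; ∈-upTo⁻; ∈-tabulate⁺; ∈-tabulate⁻)
open import Data.List.Relation.Unary.All as All using (All; []; _∷_)
open import Data.List.Relation.Unary.AllPairs using ([]; _∷_)
open import Data.List.Relation.Unary.Any as Any using (Any; here; there)
open import Data.List.Relation.Unary.Unique.Propositional using (Unique)
import Data.List.Relation.Unary.Unique.Propositional.Properties as Unique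
open import Data.Nat.Base using (ℕ; zero; suc; _+_; _*_; _∸_; _^_; _!; _≤_; _<_; z≤n; s≤s; s≤s⁻¹; NonZero; >-nonZero; >-nonZero⁻¹)
open import Data.Nat.Combinatorics using (_C_; nCk+nC[k+1]≡[n+1]C[k+1]; k>n⇒nCk≡0)
open import Data.Nat.ListAction using (sum)
open import Data.Nat.Properties
open import Data.Nat.Solver using (module +-*-Solver)
open import Data.Product.Base using (_×_; _,_; proj₁; proj₂; ∃-syntax; Σ-syntax; uncurry)
open import Data.Sum.Base using (_⊎_; inj₁; inj₂; [_,_]′)
import Data.Vec.Base as Vec
open import Data.Vec.Base using (Vec; []; _∷_)
import Data.Vec.Properties as Vec
open import Data.Unit.Base using (tt)
open import Data.Vec.Relation.Binary.Lex.Strict using (base; this; next)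
open import Function.Base using (_∘_; id; const; case_of_; _$_)
open import Function.Bundles using (_⇔_; mk⇔)
open import Level using (0ℓ)
open import Relation.Binary.Definitions using (DecidableEquality; tri<; tri≈; tri>)
open import Relation.Binary.PropositionalEquality using (_≡_; _≢_; refl; sym; trans; cong; cong₂; subst; module ≡-Reasoning)
open import Relation.Nullary using (¬_; Dec; yes; no; does; contradiction)
open import Relation.Nullary.Decidable using (¬?; _×-dec_; _⊎-dec_; _→-dec_; decidable-stable; map′; dec-true)
open import Relation.Unary using (Pred; Decidable; U)
open +-*-Solver using (solve; _:=_; _:*_; _:+_; con)

-- For t ≥ 2 the hypothesis on k provides room outside a trace: for two disjoint (t-1)-sets, so that
-- one can pass from any `F ─ G` to any other through a third set meeting each of the two in t-1
-- elements; and for several disjoint blocked sets inside one atypical member, each of which saves a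
-- factor n. The closure argument wants k ≥ 3t-1, which follows from the hypothesis except for s = t
-- = 2, k = 4; there members that split into two extendable pairs have to be counted separately. For
-- t = 1 the hypothesis is void and T may exceed k, so the induction cannot climb to level T; but
-- then 𝓕 is already determined by the first level, as the family of all k-sets meeting the base.
--
-- A bound O(n^(e-1)) is always written `x * n ≤ κ * n ^ e`. This stays meaningful for e = 0, where
-- it forces x = 0 as soon as n > κ. All constants are explicit in s, k, t and T, and T is bounded
-- in terms of s and k, so one threshold serves all t.

private variable
  n : ℕ

-- Finite sets

infix 4 _≟ˢ_

_≟ˢ_ : DecidableEquality (Subset n)
_≟ˢ_ = Vec.≡-dec Bool._≟_

open import Data.List.Membership.DecPropositional using () renaming (_∈?_ to mem?)

infix 4 _∈ₗ?_

_∈ₗ?_ : (A : Subset n) (xs : List (Subset n)) → Dec (A ∈ₗ xs)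
_∈ₗ?_ = mem? _≟ˢ_

Disj : Subset n → Subset n → Set
Disj A B = ∀ x → x ∈ A → x ∈ B → ⊥

Disj? : (A B : Subset n) → Dec (Disj A B)
Disj? A B = map′ id id (Fin.all? λ x → (x ∈? A) →-dec ¬? (x ∈? B))

∩ˡ : ∀ (A B : Subset n) {x} → x ∈ A ∩ B → x ∈ A
∩ˡ A B = proj₁ ∘ x∈p∩q⁻ A B

∩ʳ : ∀ (A B : Subset n) {x} → x ∈ A ∩ B → x ∈ B
∩ʳ A B = proj₂ ∘ x∈p∩q⁻ A B

∩⁺ : ∀ {A B : Subset n} {x} → x ∈ A → x ∈ B → x ∈ A ∩ B
∩⁺ p q = x∈p∩q⁺ (p , q)

∪ˡ : ∀ {A B : Subset n} {x} → x ∈ A → x ∈ A ∪ B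
∪ˡ p = x∈p∪q⁺ (inj₁ p)

∪ʳ : ∀ {A B : Subset n} {x} → x ∈ B → x ∈ A ∪ B
∪ʳ p = x∈p∪q⁺ (inj₂ p)

∪-elim : ∀ (A B : Subset n) {x} {P : Set} → x ∈ A ∪ B → (x ∈ A → P) → (x ∈ B → P) → P
∪-elim A B p f g = [ f , g ]′ (x∈p∪q⁻ A B p)

─ˡ : ∀ (A B : Subset n) {x} → x ∈ A ─ B → x ∈ A
─ˡ A B = p─q⊆p A B

─ʳ : ∀ (A B : Subset n) {x} → x ∈ A ─ B → x ∉ B
─ʳ (a ∷ A) (inside ∷ B) {suc x} (Vec.there p) (Vec.there q) = ─ʳ A B p q
─ʳ (a ∷ A) (outside ∷ B) {suc x} (Vec.there p) (Vec.there q) = ─ʳ A B p q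

─⁺ : ∀ {A B : Subset n} {x} → x ∈ A → x ∉ B → x ∈ A ─ B
─⁺ = x∈p∧x∉q⇒x∈p─q

∣∅∣≤ : ∀ n {m} → ∣ ∅ {n} ∣ ≤ m
∣∅∣≤ n = ≤-trans (≤-reflexive (∣⊥∣≡0 n)) z≤n

∣⊆∣ : ∀ (A B : Subset n) → A ⊆ B → ∣ A ∣ ≤ ∣ B ∣
∣⊆∣ A B s = p⊆q⇒∣p∣≤∣q∣ s

∪-⊆ : ∀ {A B C : Subset n} → A ⊆ C → B ⊆ C → A ∪ B ⊆ C
∪-⊆ {A = A} {B} f g p = ∪-elim A B p f g

∣∪∣+∣∩∣ : ∀ (A B : Subset n) → ∣ A ∪ B ∣ + ∣ A ∩ B ∣ ≡ ∣ A ∣ + ∣ B ∣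
∣∪∣+∣∩∣ [] [] = refl
∣∪∣+∣∩∣ (outside ∷ A) (outside ∷ B) = ∣∪∣+∣∩∣ A B
∣∪∣+∣∩∣ (outside ∷ A) (inside ∷ B) = trans (cong suc (∣∪∣+∣∩∣ A B)) (sym (+-suc _ _))
∣∪∣+∣∩∣ (inside ∷ A) (outside ∷ B) = cong suc (∣∪∣+∣∩∣ A B)
∣∪∣+∣∩∣ (inside ∷ A) (inside ∷ B) =
  cong suc (trans (+-suc _ _) (trans (cong suc (∣∪∣+∣∩∣ A B)) (sym (+-suc _ _))))

∣∪∣≤ : ∀ (A B : Subset n) → ∣ A ∪ B ∣ ≤ ∣ A ∣ + ∣ B ∣
∣∪∣≤ A B = ≤-trans (m≤m+n _ _) (≤-reflexive (∣∪∣+∣∩∣ A B))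

Disj⇒∩≡∅ : ∀ {A B : Subset n} → Disj A B → A ∩ B ≡ ∅
Disj⇒∩≡∅ {A = A} {B} d = Empty-unique (λ (x , p) → d x (∩ˡ A B p) (∩ʳ A B p))

∣∪∣-disj : ∀ (A B : Subset n) → Disj A B → ∣ A ∪ B ∣ ≡ ∣ A ∣ + ∣ B ∣
∣∪∣-disj {n} A B d = trans (sym (+-identityʳ _))
  (trans (cong (∣ A ∪ B ∣ +_) (sym (trans (cong ∣_∣ (Disj⇒∩≡∅ {A = A} {B} d)) (∣⊥∣≡0 n)))) (∣∪∣+∣∩∣ A B))

∣∩∣+∣─∣ : ∀ (A B : Subset n) → ∣ A ∩ B ∣ + ∣ A ─ B ∣ ≡ ∣ A ∣
∣∩∣+∣─∣ [] [] = refl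
∣∩∣+∣─∣ (outside ∷ A) (outside ∷ B) = ∣∩∣+∣─∣ A B
∣∩∣+∣─∣ (outside ∷ A) (inside ∷ B) = ∣∩∣+∣─∣ A B
∣∩∣+∣─∣ (inside ∷ A) (outside ∷ B) = trans (+-suc _ _) (cong suc (∣∩∣+∣─∣ A B))
∣∩∣+∣─∣ (inside ∷ A) (inside ∷ B) = cong suc (∣∩∣+∣─∣ A B)

⊆⇒∩≡ : ∀ {A B : Subset n} → A ⊆ B → B ∩ A ≡ A
⊆⇒∩≡ {A = A} {B} s = ⊆-antisym (∩ʳ B A) (λ p → ∩⁺ (s p) p)

∣─∣-⊆ : ∀ (A B : Subset n) → B ⊆ A → ∣ B ∣ + ∣ A ─ B ∣ ≡ ∣ A ∣
∣─∣-⊆ A B s = trans (cong (λ C → ∣ C ∣ + ∣ A ─ B ∣) (sym (⊆⇒∩≡ s))) (∣∩∣+∣─∣ A B)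

∪─ : ∀ {A B : Subset n} → A ⊆ B → A ∪ (B ─ A) ≡ B
∪─ {A = A} {B} s = ⊆-antisym (∪-⊆ s (─ˡ B A)) λ {x} p → case x ∈? A of λ where
  (yes q) → ∪ˡ q
  (no q) → ∪ʳ (─⁺ p q)

⊆∧∣∣⇒≡ : ∀ {A B : Subset n} → A ⊆ B → ∣ B ∣ ≤ ∣ A ∣ → A ≡ B
⊆∧∣∣⇒≡ {A = []} {[]} s l = refl
⊆∧∣∣⇒≡ {A = outside ∷ A} {outside ∷ B} s l = cong (_ ∷_) (⊆∧∣∣⇒≡ (drop-∷-⊆ s) l)
⊆∧∣∣⇒≡ {A = outside ∷ A} {inside ∷ B} s l = contradiction (≤-trans l (p⊆q⇒∣p∣≤∣q∣ (drop-∷-⊆ s))) (<-irrefl refl)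
⊆∧∣∣⇒≡ {A = inside ∷ A} {outside ∷ B} s l with s Vec.here
... | ()
⊆∧∣∣⇒≡ {A = inside ∷ A} {inside ∷ B} s l = cong (_ ∷_) (⊆∧∣∣⇒≡ (drop-∷-⊆ s) (s≤s⁻¹ l))

between : ∀ (A B : Subset n) {m} → A ⊆ B → ∣ A ∣ ≤ m → m ≤ ∣ B ∣ →
          ∃[ D ] A ⊆ D × D ⊆ B × ∣ D ∣ ≡ m
between [] [] {zero} s l u = [] , id , id , refl
between (outside ∷ A) (outside ∷ B) s l u =
  let D , p , q , e = between A B (drop-∷-⊆ s) l u in outside ∷ D , s⊆s p , s⊆s q , e
between (outside ∷ A) (inside ∷ B) {m} s l u with m ≤? ∣ B ∣
... | yes m≤ = let D , p , q , e = between A B (drop-∷-⊆ s) l m≤ in outside ∷ D , s⊆s p , out⊆ q , e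
... | no m≰ = inside ∷ B , out⊆ (drop-∷-⊆ s) , id , ≤-antisym (≰⇒> m≰) u
between (inside ∷ A) (outside ∷ B) s l u with s Vec.here
... | ()
between (inside ∷ A) (inside ∷ B) {suc m} s l u =
  let D , p , q , e = between A B (drop-∷-⊆ s) (s≤s⁻¹ l) (s≤s⁻¹ u) in inside ∷ D , s⊆s p , s⊆s q , cong suc e

subsetOfSize : ∀ (B : Subset n) {m} → m ≤ ∣ B ∣ → ∃[ D ] D ⊆ B × ∣ D ∣ ≡ m
subsetOfSize {n} B l =
  let D , _ , q , e = between ∅ B (⊆-min B) (∣∅∣≤ n) l in D , q , e

⟪_⟫ : ∀ {P : Pred (Fin n) 0ℓ} → Decidable P → Subset n
⟪ P? ⟫ = Vec.tabulate (λ x → does (P? x))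

∈⟪⟫⁺ : ∀ {P : Pred (Fin n) 0ℓ} (P? : Decidable P) {x} → P x → x ∈ ⟪ P? ⟫
∈⟪⟫⁺ P? {x} p = Vec.lookup⇒[]= x _ (trans (Vec.lookup∘tabulate _ x) (dec-true (P? x) p))

∈⟪⟫⁻ : ∀ {P : Pred (Fin n) 0ℓ} (P? : Decidable P) {x} → x ∈ ⟪ P? ⟫ → P x
∈⟪⟫⁻ P? {x} p with P? x | trans (sym (Vec.lookup∘tabulate (λ x → does (P? x)) x)) (Vec.[]=⇒lookup p)
... | yes q | _ = q

∈⋃⁺ : ∀ {xs : List (Subset n)} {A x} → A ∈ₗ xs → x ∈ A → x ∈ ⋃ xs
∈⋃⁺ (here refl) p = ∪ˡ p
∈⋃⁺ (there i) p = ∪ʳ (∈⋃⁺ i p)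

∈⋃⁻ : ∀ (xs : List (Subset n)) {x} → x ∈ ⋃ xs → ∃[ A ] A ∈ₗ xs × x ∈ A
∈⋃⁻ [] p = ⊥-elim (∉⊥ p)
∈⋃⁻ (A ∷ xs) p = ∪-elim A (⋃ xs) p (λ q → A , here refl , q)
  (λ q → let B , i , r = ∈⋃⁻ xs q in B , there i , r)

∣⋃∣≤ : ∀ (xs : List (Subset n)) {m} → (∀ {A} → A ∈ₗ xs → ∣ A ∣ ≤ m) → ∣ ⋃ xs ∣ ≤ length xs * m
∣⋃∣≤ {n} [] f = ≤-reflexive (∣⊥∣≡0 n)
∣⋃∣≤ (A ∷ xs) f = ≤-trans (∣∪∣≤ A (⋃ xs)) (+-mono-≤ (f (here refl)) (∣⋃∣≤ xs (f ∘ there)))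

∈⋂⁻ : ∀ (xs : List (Subset n)) {A x} → x ∈ ⋂ xs → A ∈ₗ xs → x ∈ A
∈⋂⁻ (A ∷ xs) p (here refl) = ∩ˡ A (⋂ xs) p
∈⋂⁻ (A ∷ xs) p (there i) = ∈⋂⁻ xs (∩ʳ A (⋂ xs) p) i

∈⋂⁺ : ∀ (xs : List (Subset n)) {x} → (∀ {A} → A ∈ₗ xs → x ∈ A) → x ∈ ⋂ xs
∈⋂⁺ [] f = ∈⊤
∈⋂⁺ (A ∷ xs) f = ∩⁺ (f (here refl)) (∈⋂⁺ xs (f ∘ there))

∈core⁺ : ∀ {s} (F : Fin s → Subset n) {x} → (∀ i → x ∈ F i) → x ∈ core F
∈core⁺ F f = ∈⋂⁺ (List.tabulate F) λ i → case ∈-tabulate⁻ i of λ { (j , refl) → f j }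

∈core⁻ : ∀ {s} (F : Fin s → Subset n) {x} → x ∈ core F → ∀ i → x ∈ F i
∈core⁻ F p i = ∈⋂⁻ (List.tabulate F) p (∈-tabulate⁺ i)

-- Counting with lists

Unique-⊆⇒length≤ : ∀ {A : Set} {xs ys : List A} → Unique xs → (∀ {x} → x ∈ₗ xs → x ∈ₗ ys) →
                   length xs ≤ length ys
Unique-⊆⇒length≤ {xs = []} u s = z≤n
Unique-⊆⇒length≤ {xs = x ∷ xs} (x∉ ∷ u) s with ∈-∃++ (s (here refl))
... | ys , zs , refl = ≤-trans (s≤s (Unique-⊆⇒length≤ u t)) (≤-reflexive (sym (List.length-++-sucʳ ys x zs)))
  where
  t : ∀ {z} → z ∈ₗ xs → z ∈ₗ ys ++ zs
  t {z} i with ∈-++⁻ ys (s (there i))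
  ... | inj₁ j = ∈-++⁺ˡ j
  ... | inj₂ (here refl) = contradiction refl (All.lookup x∉ i)
  ... | inj₂ (there j) = ∈-++⁺ʳ ys j

length≤-code : ∀ {A B : Set} {xs : List A} (f : B → A) (ys : List B) → Unique xs →
               (∀ {x} → x ∈ₗ xs → ∃[ y ] y ∈ₗ ys × x ≡ f y) → length xs ≤ length ys
length≤-code f ys u c = ≤-trans
  (Unique-⊆⇒length≤ u λ i → let y , j , e = c i in subst (_∈ₗ map f ys) (sym e) (∈-map⁺ f j))
  (≤-reflexive (List.length-map f ys))

length-concatMap≤ : ∀ {A B : Set} (f : A → List B) (xs : List A) {m} →
                    (∀ {x} → x ∈ₗ xs → length (f x) ≤ m) → length (concatMap f xs) ≤ length xs * m
length-concatMap≤ f [] b = z≤n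
length-concatMap≤ f (x ∷ xs) b = ≤-trans (≤-reflexive (List.length-++ (f x)))
  (+-mono-≤ (b (here refl)) (length-concatMap≤ f xs (b ∘ there)))

∈-concatMap⁺ : ∀ {A B : Set} {f : A → List B} {xs : List A} {x y} → x ∈ₗ xs → y ∈ₗ f x → y ∈ₗ concatMap f xs
∈-concatMap⁺ {f = f} i j = ∈-concat⁺′ j (∈-map⁺ f i)

∈-concatMap⁻ : ∀ {A B : Set} {f : A → List B} (xs : List A) {y} → y ∈ₗ concatMap f xs → ∃[ x ] x ∈ₗ xs × y ∈ₗ f x
∈-concatMap⁻ {f = f} xs i with ∈-concat⁻′ (map f xs) i
... | ys , j , k with ∈-map⁻ f k
... | x , l , refl = x , l , j

∷-injectiveʳ : ∀ {b : Bool} {A B : Subset n} → _≡_ {A = Subset (suc n)} (b ∷ A) (b ∷ B) → A ≡ B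
∷-injectiveʳ refl = refl

subsets : Subset n → List (Subset n)
subsets [] = [ [] ]
subsets (outside ∷ A) = map (outside ∷_) (subsets A)
subsets (inside ∷ A) = map (outside ∷_) (subsets A) ++ map (inside ∷_) (subsets A)

∈-subsets⁺ : ∀ {A B : Subset n} → B ⊆ A → B ∈ₗ subsets A
∈-subsets⁺ {A = []} {[]} s = here refl
∈-subsets⁺ {A = outside ∷ A} {outside ∷ B} s = ∈-map⁺ _ (∈-subsets⁺ (drop-∷-⊆ s))
∈-subsets⁺ {A = outside ∷ A} {inside ∷ B} s with s Vec.here
... | ()
∈-subsets⁺ {A = inside ∷ A} {outside ∷ B} s = ∈-++⁺ˡ (∈-map⁺ _ (∈-subsets⁺ (drop-∷-⊆ s)))
∈-subsets⁺ {A = inside ∷ A} {inside ∷ B} s = ∈-++⁺ʳ _ (∈-map⁺ _ (∈-subsets⁺ (drop-∷-⊆ s)))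

∈-subsets⁻ : ∀ {A B : Subset n} → B ∈ₗ subsets A → B ⊆ A
∈-subsets⁻ {A = []} (here refl) = id
∈-subsets⁻ {A = outside ∷ A} i with ∈-map⁻ _ i
... | B , j , refl = s⊆s (∈-subsets⁻ j)
∈-subsets⁻ {A = inside ∷ A} i with ∈-++⁻ (map (outside ∷_) (subsets A)) i
... | inj₁ j with ∈-map⁻ _ j
... | B , k , refl = out⊆ (∈-subsets⁻ k)
∈-subsets⁻ {A = inside ∷ A} i | inj₂ j with ∈-map⁻ _ j
... | B , k , refl = s⊆s (∈-subsets⁻ k)

length-subsets : ∀ (A : Subset n) → length (subsets A) ≡ 2 ^ ∣ A ∣
length-subsets [] = refl
length-subsets (outside ∷ A) = trans (List.length-map _ (subsets A)) (length-subsets A)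
length-subsets (inside ∷ A) = trans (List.length-++ (map _ (subsets A)))
  (cong₂ _+_ (trans (List.length-map _ (subsets A)) (length-subsets A))
    (trans (List.length-map _ (subsets A)) (trans (length-subsets A) (sym (+-identityʳ _)))))

sides-disjoint : ∀ {xs ys : List (Subset n)} {A : Subset (suc n)} →
                 A ∈ₗ map (outside ∷_) xs × A ∈ₗ map (inside ∷_) ys → ⊥
sides-disjoint (i , j) with ∈-map⁻ _ i | ∈-map⁻ _ j
... | _ , _ , refl | _ , _ , ()

subsets-unique : ∀ (A : Subset n) → Unique (subsets A)
subsets-unique [] = [] ∷ []
subsets-unique (outside ∷ A) = Unique.map⁺ ∷-injectiveʳ (subsets-unique A)
subsets-unique (inside ∷ A) = Unique.++⁺ (Unique.map⁺ ∷-injectiveʳ (subsets-unique A))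
  (Unique.map⁺ ∷-injectiveʳ (subsets-unique A)) sides-disjoint

-- For `A ⊆ Y` these are the k-sets with trace `A` on `Y`. Outside `Y` the entries of `A` are
-- ignored, which is why `∈-slice⁻` asks for `A ⊆ Y`. An empty `Y` gives all k-sets, and base `∁ Y`
-- with empty trace gives the k-subsets of `Y`.
slice : Subset n → Subset n → ℕ → List (Subset n)
slice [] [] zero = [ [] ]
slice [] [] (suc k) = []
slice (inside ∷ Y) (inside ∷ A) zero = []
slice (inside ∷ Y) (inside ∷ A) (suc k) = map (inside ∷_) (slice Y A k)
slice (inside ∷ Y) (outside ∷ A) k = map (outside ∷_) (slice Y A k)
slice (outside ∷ Y) (_ ∷ A) zero = map (outside ∷_) (slice Y A zero)
slice (outside ∷ Y) (_ ∷ A) (suc k) = map (outside ∷_) (slice Y A (suc k)) ++ map (inside ∷_) (slice Y A k)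

∈-slice⁺ : ∀ (Y : Subset n) {X k} → ∣ X ∣ ≡ k → X ∈ₗ slice Y (X ∩ Y) k
∈-slice⁺ [] {[]} refl = here refl
∈-slice⁺ (inside ∷ Y) {inside ∷ X} refl = ∈-map⁺ _ (∈-slice⁺ Y {X} refl)
∈-slice⁺ (inside ∷ Y) {outside ∷ X} refl = ∈-map⁺ _ (∈-slice⁺ Y {X} refl)
∈-slice⁺ (outside ∷ Y) {inside ∷ X} refl = ∈-++⁺ʳ _ (∈-map⁺ _ (∈-slice⁺ Y {X} refl))
∈-slice⁺ (outside ∷ Y) {outside ∷ X} {zero} e = ∈-map⁺ _ (∈-slice⁺ Y {X} e)
∈-slice⁺ (outside ∷ Y) {outside ∷ X} {suc k} e = ∈-++⁺ˡ (∈-map⁺ _ (∈-slice⁺ Y {X} e))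

∈-slice⁻ : ∀ (Y A : Subset n) {X k} → A ⊆ Y → X ∈ₗ slice Y A k → ∣ X ∣ ≡ k × X ∩ Y ≡ A
∈-slice⁻ [] [] {k = zero} s (here refl) = refl , refl
∈-slice⁻ (inside ∷ Y) (inside ∷ A) {k = suc k} s i with ∈-map⁻ _ i
... | X , j , refl = let e , f = ∈-slice⁻ Y A (drop-∷-⊆ s) j in cong suc e , cong (_ ∷_) f
∈-slice⁻ (inside ∷ Y) (outside ∷ A) s i with ∈-map⁻ _ i
... | X , j , refl = let e , f = ∈-slice⁻ Y A (drop-∷-⊆ s) j in e , cong (_ ∷_) f
∈-slice⁻ (outside ∷ Y) (inside ∷ A) s i with s Vec.here
... | ()
∈-slice⁻ (outside ∷ Y) (outside ∷ A) {k = zero} s i with ∈-map⁻ _ i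
... | X , j , refl = let e , f = ∈-slice⁻ Y A (drop-∷-⊆ s) j in e , cong (_ ∷_) f
∈-slice⁻ (outside ∷ Y) (outside ∷ A) {k = suc k} s i with ∈-++⁻ (map (outside ∷_) (slice Y A (suc k))) i
... | inj₁ i′ with ∈-map⁻ _ i′
... | X , j , refl = let e , f = ∈-slice⁻ Y A (drop-∷-⊆ s) j in e , cong (_ ∷_) f
∈-slice⁻ (outside ∷ Y) (outside ∷ A) {k = suc k} s i | inj₂ i′ with ∈-map⁻ _ i′
... | X , j , refl = let e , f = ∈-slice⁻ Y A (drop-∷-⊆ s) j in cong suc e , cong (_ ∷_) f

slice-unique : ∀ (Y A : Subset n) k → Unique (slice Y A k)
slice-unique [] [] zero = [] ∷ []
slice-unique [] [] (suc k) = []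
slice-unique (inside ∷ Y) (inside ∷ A) zero = []
slice-unique (inside ∷ Y) (inside ∷ A) (suc k) = Unique.map⁺ ∷-injectiveʳ (slice-unique Y A k)
slice-unique (inside ∷ Y) (outside ∷ A) k = Unique.map⁺ ∷-injectiveʳ (slice-unique Y A k)
slice-unique (outside ∷ Y) (_ ∷ A) zero = Unique.map⁺ ∷-injectiveʳ (slice-unique Y A zero)
slice-unique (outside ∷ Y) (_ ∷ A) (suc k) = Unique.++⁺ (Unique.map⁺ ∷-injectiveʳ (slice-unique Y A (suc k)))
  (Unique.map⁺ ∷-injectiveʳ (slice-unique Y A k)) sides-disjoint

nC0≡1 : ∀ m → m C 0 ≡ 1
nC0≡1 zero = refl
nC0≡1 (suc m) = refl

length-slice : ∀ (Y A : Subset n) k → A ⊆ Y → ∣ A ∣ ≤ k → length (slice Y A k) ≡ ∣ ∁ Y ∣ C (k ∸ ∣ A ∣)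
length-slice [] [] zero s l = refl
length-slice [] [] (suc k) s l = refl
length-slice (inside ∷ Y) (inside ∷ A) (suc k) s l =
  trans (List.length-map _ (slice Y A k)) (length-slice Y A k (drop-∷-⊆ s) (s≤s⁻¹ l))
length-slice (inside ∷ Y) (outside ∷ A) k s l =
  trans (List.length-map _ (slice Y A k)) (length-slice Y A k (drop-∷-⊆ s) l)
length-slice (outside ∷ Y) (inside ∷ A) k s l with s Vec.here
... | ()
length-slice (outside ∷ Y) (outside ∷ A) zero s l =
  trans (List.length-map _ (slice Y A zero)) (trans (length-slice Y A zero (drop-∷-⊆ s) l)
    (trans (trans (cong (∣ ∁ Y ∣ C_) (0∸n≡0 ∣ A ∣)) (nC0≡1 ∣ ∁ Y ∣))
      (sym (trans (cong (suc ∣ ∁ Y ∣ C_) (0∸n≡0 ∣ A ∣)) (nC0≡1 (suc ∣ ∁ Y ∣))))))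
length-slice (outside ∷ Y) (outside ∷ A) (suc k) s l with ∣ A ∣ ≤? k
... | yes a≤k = trans (List.length-++ (map _ (slice Y A (suc k)))) (begin
    length (map (outside ∷_) (slice Y A (suc k))) + length (map (inside ∷_) (slice Y A k))
      ≡⟨ cong₂ _+_ (List.length-map _ (slice Y A (suc k))) (List.length-map _ (slice Y A k)) ⟩
    length (slice Y A (suc k)) + length (slice Y A k)
      ≡⟨ cong₂ _+_ (length-slice Y A (suc k) (drop-∷-⊆ s) l) (length-slice Y A k (drop-∷-⊆ s) a≤k) ⟩
    ∣ ∁ Y ∣ C (suc k ∸ ∣ A ∣) + ∣ ∁ Y ∣ C (k ∸ ∣ A ∣)
      ≡⟨ +-comm (∣ ∁ Y ∣ C (suc k ∸ ∣ A ∣)) _ ⟩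
    ∣ ∁ Y ∣ C (k ∸ ∣ A ∣) + ∣ ∁ Y ∣ C (suc k ∸ ∣ A ∣)
      ≡⟨ cong (λ z → ∣ ∁ Y ∣ C (k ∸ ∣ A ∣) + ∣ ∁ Y ∣ C z) (+-∸-assoc 1 a≤k) ⟩
    ∣ ∁ Y ∣ C (k ∸ ∣ A ∣) + ∣ ∁ Y ∣ C suc (k ∸ ∣ A ∣)
      ≡⟨ nCk+nC[k+1]≡[n+1]C[k+1] ∣ ∁ Y ∣ (k ∸ ∣ A ∣) ⟩
    suc ∣ ∁ Y ∣ C suc (k ∸ ∣ A ∣)
      ≡⟨ cong (suc ∣ ∁ Y ∣ C_) (+-∸-assoc 1 a≤k) ⟨
    suc ∣ ∁ Y ∣ C (suc k ∸ ∣ A ∣) ∎)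
  where open ≡-Reasoning
-- Here |A| = k + 1: sets through the new point would have too few other elements to contain `A`,
-- and both truncated differences are 0.
... | no a≰k = trans (List.length-++ (map _ (slice Y A (suc k)))) (begin
    length (map (outside ∷_) (slice Y A (suc k))) + length (map (inside ∷_) (slice Y A k))
      ≡⟨ cong₂ _+_ (List.length-map _ (slice Y A (suc k))) (List.length-map _ (slice Y A k)) ⟩
    length (slice Y A (suc k)) + length (slice Y A k)
      ≡⟨ cong₂ _+_ (length-slice Y A (suc k) (drop-∷-⊆ s) l) (cong length empty) ⟩
    ∣ ∁ Y ∣ C (suc k ∸ ∣ A ∣) + 0
      ≡⟨ +-identityʳ _ ⟩
    ∣ ∁ Y ∣ C (suc k ∸ ∣ A ∣)
      ≡⟨ cong (∣ ∁ Y ∣ C_) z ⟩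
    ∣ ∁ Y ∣ C 0
      ≡⟨ trans (nC0≡1 ∣ ∁ Y ∣) (sym (nC0≡1 (suc ∣ ∁ Y ∣))) ⟩
    suc ∣ ∁ Y ∣ C 0
      ≡⟨ cong (suc ∣ ∁ Y ∣ C_) z ⟨
    suc ∣ ∁ Y ∣ C (suc k ∸ ∣ A ∣) ∎)
  where
  open ≡-Reasoning
  z : suc k ∸ ∣ A ∣ ≡ 0
  z = m≤n⇒m∸n≡0 (≰⇒> a≰k)
  empty : slice Y A k ≡ []
  empty with slice Y A k in eq
  ... | [] = refl
  ... | X ∷ _ = let e , f = ∈-slice⁻ Y A {X} {k} (drop-∷-⊆ s) (subst (X ∈ₗ_) (sym eq) (here refl)) in
    contradiction (≤-trans (p⊆q⇒∣p∣≤∣q∣ (λ p → ∩ˡ X Y (subst (_ ∈_) (sym f) p))) (≤-reflexive e)) a≰k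

sized : ∀ n → ℕ → List (Subset n)
sized n r = slice ∅ ∅ r

∩∅ : ∀ (X : Subset n) → X ∩ ∅ ≡ ∅
∩∅ X = ⊆-antisym (∩ʳ X ∅) (⊆-min _)

∈-sized⁺ : ∀ {X : Subset n} {r} → ∣ X ∣ ≡ r → X ∈ₗ sized n r
∈-sized⁺ {n} {X} {r} e = subst (λ A → X ∈ₗ slice ∅ A r) (∩∅ X) (∈-slice⁺ ∅ e)

∈-sized⁻ : ∀ {X : Subset n} {r} → X ∈ₗ sized n r → ∣ X ∣ ≡ r
∈-sized⁻ i = proj₁ (∈-slice⁻ ∅ ∅ id i)

∣∁∅∣ : ∀ n → ∣ ∁ {n} ∅ ∣ ≡ n
∣∁∅∣ zero = refl
∣∁∅∣ (suc n) = cong suc (∣∁∅∣ n)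

length-sized : ∀ n r → length (sized n r) ≡ n C r
length-sized n r = trans (length-slice (∅ {n}) ∅ r id (∣∅∣≤ n))
  (cong₂ _C_ (∣∁∅∣ n) (cong (r ∸_) (∣⊥∣≡0 n)))

elems : Subset n → List (Fin n)
elems [] = []
elems (outside ∷ A) = map suc (elems A)
elems (inside ∷ A) = zero ∷ map suc (elems A)

∈-elems⁺ : ∀ {A : Subset n} {x} → x ∈ A → x ∈ₗ elems A
∈-elems⁺ {A = inside ∷ A} Vec.here = here refl
∈-elems⁺ {A = inside ∷ A} (Vec.there p) = there (∈-map⁺ suc (∈-elems⁺ p))
∈-elems⁺ {A = outside ∷ A} (Vec.there p) = ∈-map⁺ suc (∈-elems⁺ p)

length-elems : ∀ (A : Subset n) → length (elems A) ≡ ∣ A ∣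
length-elems [] = refl
length-elems (outside ∷ A) = trans (List.length-map suc (elems A)) (length-elems A)
length-elems (inside ∷ A) = cong suc (trans (List.length-map suc (elems A)) (length-elems A))

-- Binomial coefficients

pascal : ∀ n k → suc n C suc k ≡ n C k + n C suc k
pascal n k = sym (nCk+nC[k+1]≡[n+1]C[k+1] n k)

0C1+k : ∀ k → 0 C suc k ≡ 0
0C1+k k = k>n⇒nCk≡0 {0} {suc k} (s≤s z≤n)

nCr≤n^r : ∀ n r → n C r ≤ n ^ r
nCr≤n^r n zero = ≤-reflexive (nC0≡1 n)
nCr≤n^r zero (suc r) = ≤-reflexive (0C1+k r)
nCr≤n^r (suc n) (suc r) = begin
  suc n C suc r               ≡⟨ pascal n r ⟩
  n C r + n C suc r           ≤⟨ +-mono-≤ (nCr≤n^r n r) (nCr≤n^r n (suc r)) ⟩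
  suc n * n ^ r               ≤⟨ *-monoʳ-≤ (suc n) (^-monoˡ-≤ r (n≤1+n n)) ⟩
  suc n * suc n ^ r           ∎
  where open ≤-Reasoning

C-monoˡ-≤ : ∀ {m n} r → m ≤ n → m C r ≤ n C r
C-monoˡ-≤ {m} {n} zero l = ≤-reflexive (trans (nC0≡1 m) (sym (nC0≡1 n)))
C-monoˡ-≤ {zero} {n} (suc r) l = ≤-trans (≤-reflexive (0C1+k r)) z≤n
C-monoˡ-≤ {suc m} {suc n} (suc r) (s≤s l) = begin
  suc m C suc r               ≡⟨ pascal m r ⟩
  m C r + m C suc r           ≤⟨ +-mono-≤ (C-monoˡ-≤ r l) (C-monoˡ-≤ (suc r) l) ⟩
  n C r + n C suc r           ≡⟨ pascal n r ⟨
  suc n C suc r               ∎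
  where open ≤-Reasoning

absorption : ∀ n k → suc k * (suc n C suc k) ≡ suc n * (n C k)
absorption n zero = begin
  1 * (suc n C 1)         ≡⟨ *-identityˡ _ ⟩
  suc n C 1               ≡⟨ nC1 (suc n) ⟩
  suc n                   ≡⟨ *-identityʳ (suc n) ⟨
  suc n * 1               ≡⟨ cong (suc n *_) (nC0≡1 n) ⟨
  suc n * (n C 0)         ∎
  where
  open ≡-Reasoning
  nC1 : ∀ m → m C 1 ≡ m
  nC1 zero = refl
  nC1 (suc m) = trans (pascal m 0) (cong₂ _+_ (nC0≡1 m) (nC1 m))
absorption zero (suc k) = begin
  suc (suc k) * (1 C suc (suc k)) ≡⟨ cong (suc (suc k) *_) (k>n⇒nCk≡0 {1} {suc (suc k)} (s≤s (s≤s z≤n))) ⟩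
  suc (suc k) * 0                 ≡⟨ *-zeroʳ (suc (suc k)) ⟩
  0                               ≡⟨ 0C1+k k ⟨
  0 C suc k                       ≡⟨ *-identityˡ _ ⟨
  1 * (0 C suc k)                 ∎
  where open ≡-Reasoning
absorption (suc n) (suc k) = begin
  (2 + k) * ((2 + n) C (2 + k))   ≡⟨ cong ((2 + k) *_) (pascal (suc n) (suc k)) ⟩
  (2 + k) * (a + b)               ≡⟨ *-distribˡ-+ (2 + k) a b ⟩
  (a + (1 + k) * a) + (2 + k) * b ≡⟨ cong₂ (λ x y → (a + x) + y) (absorption n k) (absorption n (suc k)) ⟩
  (a + (1 + n) * c) + (1 + n) * d ≡⟨ +-assoc a _ _ ⟩
  a + ((1 + n) * c + (1 + n) * d) ≡⟨ cong (a +_) (*-distribˡ-+ (1 + n) c d) ⟨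
  a + (1 + n) * (c + d)           ≡⟨ cong (λ x → a + (1 + n) * x) (pascal n k) ⟨
  (2 + n) * a                     ∎
  where
  open ≡-Reasoning
  a = suc n C suc k
  b = suc n C (2 + k)
  c = n C k
  d = n C suc k

m^r≤r!*C : ∀ m r → m ^ r ≤ r ! * ((m + r) C r)
m^r≤r!*C m zero = ≤-reflexive (sym (trans (+-identityʳ _) (nC0≡1 (m + 0))))
m^r≤r!*C m (suc r) = begin
  m * m ^ r                            ≤⟨ *-mono-≤ (m≤n⇒m≤1+n (m≤m+n m r)) (m^r≤r!*C m r) ⟩
  suc (m + r) * (r ! * ((m + r) C r))  ≡⟨ swap (suc (m + r)) (r !) _ ⟩
  r ! * (suc (m + r) * ((m + r) C r))  ≡⟨ cong (r ! *_) (absorption (m + r) r) ⟨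
  r ! * (suc r * (suc (m + r) C suc r)) ≡⟨ *-assoc (r !) (suc r) _ ⟨
  r ! * suc r * (suc (m + r) C suc r)  ≡⟨ cong₂ (λ x y → x * (y C suc r)) (*-comm (r !) (suc r)) (sym (+-suc m r)) ⟩
  suc r ! * ((m + suc r) C suc r)      ∎
  where
  open ≤-Reasoning
  swap : ∀ a b c → a * (b * c) ≡ b * (a * c)
  swap = solve 3 (λ a b c → a :* (b :* c) := b :* (a :* c)) refl

!-mono-≤ : ∀ {m n} → m ≤ n → m ! ≤ n !
!-mono-≤ {zero} {zero} l = ≤-refl
!-mono-≤ {zero} {suc n} l = ≤-trans (!-mono-≤ {zero} {n} z≤n) (m≤m+n (n !) (n * n !))
!-mono-≤ {suc m} {suc n} (s≤s l) = *-mono-≤ (s≤s l) (!-mono-≤ l)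

chooseConst : ℕ → ℕ
chooseConst k = 2 ^ k * k !

^-distribˡ-* : ∀ a b r → (a * b) ^ r ≡ a ^ r * b ^ r
^-distribˡ-* a b zero = refl
^-distribˡ-* a b (suc r) = trans (cong (a * b *_) (^-distribˡ-* a b r))
  (solve 4 (λ a b c d → (a :* b) :* (c :* d) := (a :* c) :* (b :* d)) refl a b (a ^ r) (b ^ r))

-- Turns powers of n back into binomial coefficients after the loss of w points, with one constant
-- for all r ≤ k. The factor 2 ^ k pays for replacing n by m = n - w - k, which is at least n / 2,
-- and k! for m ^ r ≤ r! C(m + r, r).
n^r≤K*C : ∀ k {n w r} → r ≤ k → 2 * (w + k) ≤ n → n ^ r ≤ chooseConst k * ((n ∸ w) C r)
n^r≤K*C k {n} {w} {r} r≤k big = begin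
  n ^ r                             ≤⟨ ^-monoˡ-≤ r n≤2m ⟩
  (2 * m) ^ r                       ≡⟨ ^-distribˡ-* 2 m r ⟩
  2 ^ r * m ^ r                     ≤⟨ *-mono-≤ (^-monoʳ-≤ 2 r≤k) (m^r≤r!*C m r) ⟩
  2 ^ k * (r ! * ((m + r) C r))     ≡⟨ *-assoc (2 ^ k) (r !) _ ⟨
  2 ^ k * r ! * ((m + r) C r)       ≤⟨ *-mono-≤ (*-monoʳ-≤ (2 ^ k) (!-mono-≤ r≤k)) (C-monoˡ-≤ r m+r≤) ⟩
  chooseConst k * ((n ∸ w) C r)     ∎
  where
  open ≤-Reasoning
  m = n ∸ (w + k)
  w+k≤n : w + k ≤ n
  w+k≤n = ≤-trans (m≤m+n (w + k) _) big
  n≤2m : n ≤ 2 * m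
  n≤2m = +-cancelˡ-≤ n n (2 * m) (begin
    n + n                           ≡⟨ cong₂ _+_ (m∸n+n≡m w+k≤n) (m∸n+n≡m w+k≤n) ⟨
    (m + (w + k)) + (m + (w + k))   ≡⟨ solve 2 (λ m x → (m :+ x) :+ (m :+ x) := con 2 :* x :+ con 2 :* m) refl m (w + k) ⟩
    2 * (w + k) + 2 * m             ≤⟨ +-monoˡ-≤ (2 * m) big ⟩
    n + 2 * m                       ∎)
  m+r≤ : m + r ≤ n ∸ w
  m+r≤ = begin
    m + r                           ≤⟨ +-monoʳ-≤ m r≤k ⟩
    n ∸ (w + k) + k                 ≡⟨ cong (_+ k) (∸-+-assoc n w k) ⟨
    n ∸ w ∸ k + k                   ≡⟨ m∸n+n≡m (m+n≤o⇒n≤o∸m w w+k≤n) ⟩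
    n ∸ w                           ∎
    where
    m+n≤o⇒n≤o∸m : ∀ a {b c} → a + b ≤ c → b ≤ c ∸ a
    m+n≤o⇒n≤o∸m a {b} {c} h = ≤-trans (≤-reflexive (sym (m+n∸m≡n a b))) (∸-monoˡ-≤ a h)

-- By Pascal's rule each of the y lost points costs at most C(n - 1, r - 1) sets, hence at most n ^
-- (r - 1).
C-diff : ∀ n r y → y ≤ n → (n C r) * n ≤ ((n ∸ y) C r) * n + y * n ^ r
C-diff n r zero l = m≤m+n _ _
C-diff n r (suc y) l = begin
  (n C r) * n                                ≤⟨ C-diff n r y (<⇒≤ l) ⟩
  ((n ∸ y) C r) * n + y * n ^ r              ≡⟨ cong (λ z → (z C r) * n + y * n ^ r) (+-∸-assoc 1 l) ⟩
  (suc m C r) * n + y * n ^ r                ≤⟨ +-monoˡ-≤ _ (step r) ⟩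
  (m C r) * n + n ^ r + y * n ^ r            ≡⟨ +-assoc ((m C r) * n) _ _ ⟩
  (m C r) * n + suc y * n ^ r                ∎
  where
  open ≤-Reasoning
  m = n ∸ suc y
  step : ∀ r → (suc m C r) * n ≤ (m C r) * n + n ^ r
  step zero = ≤-trans (≤-reflexive (cong (_* n) (trans (nC0≡1 (suc m)) (sym (nC0≡1 m))))) (m≤m+n _ _)
  step (suc r) = begin
    (suc m C suc r) * n                      ≡⟨ cong (_* n) (trans (pascal m r) (+-comm (m C r) _)) ⟩
    (m C suc r + m C r) * n                  ≡⟨ *-distribʳ-+ n (m C suc r) _ ⟩
    (m C suc r) * n + (m C r) * n            ≤⟨ +-monoʳ-≤ _ (*-monoˡ-≤ n (≤-trans (nCr≤n^r m r) (^-monoˡ-≤ r (m∸n≤m n (suc y))))) ⟩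
    (m C suc r) * n + n ^ r * n              ≡⟨ cong ((m C suc r) * n +_) (*-comm (n ^ r) n) ⟩
    (m C suc r) * n + n ^ suc r              ∎

length-sized≤ : ∀ n r → length (sized n r) ≤ n ^ r
length-sized≤ n r = ≤-trans (≤-reflexive (length-sized n r)) (nCr≤n^r n r)

-- Sums and double counting

∑ : ∀ {A : Set} → List A → (A → ℕ) → ℕ
∑ xs f = sum (map f xs)

∑-mono : ∀ {A : Set} (xs : List A) {f g : A → ℕ} → (∀ {x} → x ∈ₗ xs → f x ≤ g x) → ∑ xs f ≤ ∑ xs g
∑-mono [] h = z≤n
∑-mono (x ∷ xs) h = +-mono-≤ (h (here refl)) (∑-mono xs (h ∘ there))

∑-cong : ∀ {A : Set} (xs : List A) {f g : A → ℕ} → (∀ {x} → x ∈ₗ xs → f x ≡ g x) → ∑ xs f ≡ ∑ xs g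
∑-cong [] h = refl
∑-cong (x ∷ xs) h = cong₂ _+_ (h (here refl)) (∑-cong xs (h ∘ there))

∑-const : ∀ {A : Set} (xs : List A) m → ∑ xs (const m) ≡ length xs * m
∑-const [] m = refl
∑-const (x ∷ xs) m = cong (m +_) (∑-const xs m)

∑-≤ : ∀ {A : Set} (xs : List A) {f : A → ℕ} {m} → (∀ {x} → x ∈ₗ xs → f x ≤ m) → ∑ xs f ≤ length xs * m
∑-≤ xs h = ≤-trans (∑-mono xs h) (≤-reflexive (∑-const xs _))

∑-≥ : ∀ {A : Set} (xs : List A) {f : A → ℕ} {m} → (∀ {x} → x ∈ₗ xs → m ≤ f x) → length xs * m ≤ ∑ xs f
∑-≥ xs h = ≤-trans (≤-reflexive (sym (∑-const xs _))) (∑-mono xs h)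

∑-+ : ∀ {A : Set} (xs : List A) (f g : A → ℕ) → ∑ xs (λ x → f x + g x) ≡ ∑ xs f + ∑ xs g
∑-+ [] f g = refl
∑-+ (x ∷ xs) f g = trans (cong (f x + g x +_) (∑-+ xs f g))
  (solve 4 (λ a b c d → (a :+ b) :+ (c :+ d) := (a :+ c) :+ (b :+ d)) refl (f x) (g x) (∑ xs f) (∑ xs g))

∑-* : ∀ {A : Set} (xs : List A) (f : A → ℕ) m → ∑ xs (λ x → f x * m) ≡ ∑ xs f * m
∑-* [] f m = refl
∑-* (x ∷ xs) f m = trans (cong (f x * m +_) (∑-* xs f m)) (sym (*-distribʳ-+ m (f x) _))

∑-0 : ∀ {A : Set} (xs : List A) → ∑ xs (const 0) ≡ 0
∑-0 [] = refl
∑-0 (x ∷ xs) = ∑-0 xs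

∑-++ : ∀ {A : Set} (xs ys : List A) (f : A → ℕ) → ∑ (xs ++ ys) f ≡ ∑ xs f + ∑ ys f
∑-++ [] ys f = refl
∑-++ (x ∷ xs) ys f = trans (cong (f x +_) (∑-++ xs ys f)) (sym (+-assoc (f x) _ _))

∑-swap : ∀ {A B : Set} (xs : List A) (ys : List B) (f : A → B → ℕ) →
         ∑ xs (λ x → ∑ ys (f x)) ≡ ∑ ys (λ y → ∑ xs (λ x → f x y))
∑-swap [] ys f = sym (∑-0 ys)
∑-swap (x ∷ xs) ys f = trans (cong (∑ ys (f x) +_) (∑-swap xs ys f)) (sym (∑-+ ys (f x) _))

∑-member : ∀ {A : Set} (xs : List A) (f : A → ℕ) {x} → x ∈ₗ xs → f x ≤ ∑ xs f
∑-member (x ∷ xs) f (here refl) = m≤m+n _ _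
∑-member (x ∷ xs) f (there i) = ≤-trans (∑-member xs f i) (m≤n+m _ (f x))

length-concatMap : ∀ {A B : Set} (f : A → List B) (xs : List A) → length (concatMap f xs) ≡ ∑ xs (length ∘ f)
length-concatMap f [] = refl
length-concatMap f (x ∷ xs) = trans (List.length-++ (f x)) (cong (length (f x) +_) (length-concatMap f xs))

indicator : ∀ {P : Set} → Dec P → ℕ
indicator (yes _) = 1
indicator (no _) = 0

length-filter≡∑ : ∀ {A : Set} {P : Pred A 0ℓ} (P? : Decidable P) (xs : List A) →
                  length (filter P? xs) ≡ ∑ xs (indicator ∘ P?)
length-filter≡∑ P? [] = refl
length-filter≡∑ P? (x ∷ xs) with P? x
... | yes _ = cong suc (length-filter≡∑ P? xs)
... | no _ = length-filter≡∑ P? xs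

length-partition : ∀ {A : Set} {P : Pred A 0ℓ} (P? : Decidable P) (xs : List A) →
                   length (filter (¬? ∘ P?) xs) + length (filter P? xs) ≡ length xs
length-partition P? [] = refl
length-partition P? (x ∷ xs) with P? x
... | yes _ = trans (+-suc _ _) (cong suc (length-partition P? xs))
... | no _ = cong suc (length-partition P? xs)

∑-filter-swap : ∀ {A B : Set} {R : A → B → Set} (R? : ∀ x y → Dec (R x y)) (xs : List A) (ys : List B) →
                ∑ xs (λ x → length (filter (R? x) ys)) ≡ ∑ ys (λ y → length (filter (λ x → R? x y) xs))
∑-filter-swap R? xs ys = trans (∑-cong xs λ {x} _ → length-filter≡∑ (R? x) ys)
  (trans (∑-swap xs ys (λ x y → indicator (R? x y)))
    (∑-cong ys λ {y} _ → sym (length-filter≡∑ (λ x → R? x y) xs)))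

doubleCounting : ∀ {A B : Set} {R : A → B → Set} (R? : ∀ x y → Dec (R x y)) (xs : List A) (ys : List B) {m w} K →
                 (∀ {x} → x ∈ₗ xs → m ≤ length (filter (R? x) ys) * K) →
                 (∀ {y} → y ∈ₗ ys → length (filter (λ x → R? x y) xs) ≤ w) →
                 length xs * m ≤ length ys * w * K
doubleCounting R? xs ys K f g = ≤-trans (∑-≥ xs f) (≤-trans (≤-reflexive (∑-* xs _ K))
  (*-monoˡ-≤ K (≤-trans (≤-reflexive (∑-filter-swap R? xs ys)) (∑-≤ ys g))))

averaging : ∀ {A : Set} (x : A) (xs : List A) (f : A → ℕ) →
            ∃[ y ] y ∈ₗ x ∷ xs × f y * length (x ∷ xs) ≤ ∑ (x ∷ xs) f
averaging x [] f = x , here refl , ≤-reflexive (trans (*-identityʳ _) (sym (+-identityʳ _)))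
averaging x (x′ ∷ xs) f with averaging x′ xs f
... | y , i , l with ≤-total (f x) (f y)
... | inj₁ h = x , here refl , (begin
    f x * suc (length (x′ ∷ xs))         ≡⟨ *-suc (f x) _ ⟩
    f x + f x * length (x′ ∷ xs)         ≤⟨ +-monoʳ-≤ (f x) (≤-trans (*-monoˡ-≤ _ h) l) ⟩
    f x + ∑ (x′ ∷ xs) f                  ∎)
  where open ≤-Reasoning
... | inj₂ h = y , there i , (begin
    f y * suc (length (x′ ∷ xs))         ≡⟨ *-suc (f y) _ ⟩
    f y + f y * length (x′ ∷ xs)         ≤⟨ +-mono-≤ h l ⟩
    f x + ∑ (x′ ∷ xs) f                  ∎)
  where open ≤-Reasoning

length-cartesianProduct : ∀ {A B : Set} (xs : List A) (ys : List B) →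
                          length (cartesianProduct xs ys) ≡ length xs * length ys
length-cartesianProduct [] ys = refl
length-cartesianProduct (x ∷ xs) ys = trans (List.length-++ (map (x ,_) ys))
  (cong₂ _+_ (List.length-map _ ys) (length-cartesianProduct xs ys))

-- `P` is not assumed decidable, so a longer list cannot be searched for; but each refutation of
-- maximality supplies one, and `fuel` counts how often the bound still permits this.
¬¬-longest : ∀ {A : Set} (P : List A → Set) {b xs} → P xs → (∀ {ys} → P ys → length ys ≤ b) →
             ¬ ¬ (∃[ ys ] P ys × (∀ {zs} → P zs → length zs ≤ length ys))
¬¬-longest P {b} {xs} p bound = go b xs p (m≤n+m b (length xs))
  where
  go : ∀ fuel xs → P xs → b ≤ length xs + fuel → ¬ ¬ (∃[ ys ] P ys × (∀ {zs} → P zs → length zs ≤ length ys))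
  go zero xs p h k = k (xs , p , λ q → ≤-trans (bound q) (≤-trans h (≤-reflexive (+-identityʳ _))))
  go (suc fuel) xs p h k = k (xs , p , λ {zs} q → ≮⇒≥ λ lt →
    go fuel zs q (≤-trans h (≤-trans (≤-reflexive (+-suc _ fuel)) (+-monoˡ-≤ fuel lt))) k)

familyOf : {P : Pred (Subset n) 0ℓ} → Decidable P → Family n
familyOf P? = family (filter P? (subsets full)) (Unique.filter⁺ P? (subsets-unique full))

∈-familyOf⁺ : {P : Pred (Subset n) 0ℓ} (P? : Decidable P) → ∀ {A} → P A → A ∈ᶠ familyOf P?
∈-familyOf⁺ P? p = ∈-filter⁺ P? (∈-subsets⁺ ⊆⊤) p

∈-familyOf⁻ : {P : Pred (Subset n) 0ℓ} (P? : Decidable P) → ∀ {A} → A ∈ᶠ familyOf P? → P A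
∈-familyOf⁻ P? i = proj₂ (∈-filter⁻ P? {xs = subsets full} i)

slices : Subset n → ℕ → List (Subset n) → List (Subset n)
slices Y k = concatMap (λ A → slice Y A k)

∈-slices⁺ : ∀ (Y : Subset n) {k xs X} → ∣ X ∣ ≡ k → X ∩ Y ∈ₗ xs → X ∈ₗ slices Y k xs
∈-slices⁺ Y e i = ∈-concatMap⁺ i (∈-slice⁺ Y e)

∈-slices⁻ : ∀ (Y : Subset n) {k xs X} → (∀ {A} → A ∈ₗ xs → A ⊆ Y) → X ∈ₗ slices Y k xs → ∣ X ∣ ≡ k × X ∩ Y ∈ₗ xs
∈-slices⁻ Y {k} {xs} sub i = let A , A∈ , j = ∈-concatMap⁻ xs i ; e , eq = ∈-slice⁻ Y A (sub A∈) j in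
  e , subst (_∈ₗ xs) (sym eq) A∈

slices-unique : ∀ (Y : Subset n) k {xs} → Unique xs → (∀ {A} → A ∈ₗ xs → A ⊆ Y) → Unique (slices Y k xs)
slices-unique Y k {[]} _ _ = []
slices-unique Y k {A ∷ xs} (A∉ ∷ u) sub = Unique.++⁺ (slice-unique Y A k) (slices-unique Y k u (sub ∘ there)) λ (i , j) →
  All.lookup A∉ (proj₂ (∈-slices⁻ Y {xs = xs} (sub ∘ there) j)) (sym (proj₂ (∈-slice⁻ Y A (sub (here refl)) i)))

length-slices : ∀ (Y : Subset n) k xs → (∀ {A} → A ∈ₗ xs → A ⊆ Y × ∣ A ∣ ≤ k) →
                length (slices Y k xs) ≡ ∑ xs (λ A → (n ∸ ∣ Y ∣) C (k ∸ ∣ A ∣))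
length-slices Y k xs h = trans (length-concatMap (λ A → slice Y A k) xs) (∑-cong xs λ {A} i →
  trans (length-slice Y A k (proj₁ (h i)) (proj₂ (h i))) (cong (_C (k ∸ ∣ A ∣)) (∣∁p∣≡n∸∣p∣ Y)))

private variable
  s : ℕ

-- Kernels of sunflowers

-- The E i may coincide here; they are distinct as soon as all of them are
-- larger than K.
Kernel : Subset n → (Fin s → Subset n) → Set
Kernel K E = (∀ i → K ⊆ E i) × (∀ {i j} → i ≢ j → ∀ {x} → x ∈ E i → x ∈ E j → x ∈ K)

Avoids : ℕ → ℕ → Pred (Subset n) 0ℓ → Set
Avoids {n} s c P = ∀ (A : Fin s → Subset n) K → Kernel K A → (∀ i → P (A i)) → ∣ K ∣ ≤ c → ⊥

two : 2 ≤ s → ∀ (i : Fin s) → ∃[ j ] i ≢ j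
two (s≤s (s≤s z≤n)) zero = suc zero , λ ()
two (s≤s (s≤s z≤n)) (suc i) = zero , λ ()

kernel-injective : ∀ {E : Fin s → Subset n} {K} → Kernel K E → (∀ i → ∣ K ∣ < ∣ E i ∣) →
                   ∀ {i j} → E i ≡ E j → i ≡ j
kernel-injective {E = E} (_ , meet) big {i} {j} eq with i Fin.≟ j
... | yes e = e
... | no ne = contradiction (big i)
  (≤⇒≯ (p⊆q⇒∣p∣≤∣q∣ λ {x} p → meet ne p (subst (x ∈_) eq p)))

sunflower⇒kernel : {F : Fin s → Subset n} → IsSunflower F → Kernel (core F) F
sunflower⇒kernel {F = F} (_ , eq) =
  (λ i p → ∈core⁻ F p i) , λ {i} {j} ne {x} p q → subst (x ∈_) (eq ne) (∩⁺ p q)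

kernel⇒core≡ : 2 ≤ s → {E : Fin s → Subset n} {K : Subset n} → Kernel K E → core E ≡ K
kernel⇒core≡ {s} 2≤s {E} {K} (sub , meet) = ⊆-antisym
  (λ p → let i = fromℕ< (≤-trans (s≤s z≤n) 2≤s) ; j , ne = two 2≤s i in
    meet ne (∈core⁻ E p i) (∈core⁻ E p j))
  (λ p → ∈core⁺ E λ i → sub i p)

kernel⇒sunflower : 2 ≤ s → {E : Fin s → Subset n} {K : Subset n} → Kernel K E → (∀ i → ∣ K ∣ < ∣ E i ∣) →
                   IsSunflower E
kernel⇒sunflower 2≤s {E} {K} ker@(sub , meet) big = kernel-injective ker big , λ {i} {j} ne →
  trans (⊆-antisym (λ p → meet ne (∩ˡ (E i) (E j) p) (∩ʳ (E i) (E j) p)) (λ p → ∩⁺ (sub i p) (sub j p)))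
    (sym (kernel⇒core≡ 2≤s ker))

avoids⇒¬contains : ∀ {c} {𝓢 : Family n} → Avoids s c (_∈ᶠ 𝓢) → ¬ ContainsSunflower s (_≤ c) 𝓢
avoids⇒¬contains av (F , sf , mem , l) = av F (core F) (sunflower⇒kernel sf) mem l

¬contains⇒avoids : ∀ {c} {𝓢 : Family n} → 2 ≤ s → (∀ {A} → A ∈ᶠ 𝓢 → c < ∣ A ∣) →
                   ¬ ContainsSunflower s (_≤ c) 𝓢 → Avoids s c (_∈ᶠ 𝓢)
¬contains⇒avoids {c = c} 2≤s big none A K ker mem l = none
  (A , kernel⇒sunflower 2≤s ker (λ i → ≤-trans (s≤s l) (big (mem i))) , mem ,
   subst (λ B → ∣ B ∣ ≤ c) (sym (kernel⇒core≡ 2≤s ker)) l)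

-- Extendable sets

-- An extendable set behaves like the core of a large sunflower in 𝓕.  Members
-- of 𝓕 are extendable too, so the two can be mixed when building sunflowers.
module Extension {n : ℕ} (𝓕 : List (Subset n)) (L : ℕ) where

  Extendable : Subset n → Set
  Extendable E = ∀ V → ∣ V ∣ ≤ L → Disj V E → ∃[ F ] F ∈ₗ 𝓕 × E ⊆ F × Disj F V

  Cover : Subset n → Subset n → Set
  Cover E V = ∣ V ∣ ≤ L × Disj V E × (All (λ F → E ⊆ F → ¬ Disj F V) 𝓕)

  Blocked : Subset n → Set
  Blocked E = ∃[ V ] Cover E V

  Blocked? : Decidable Blocked
  Blocked? E = anySubset? λ V → (∣ V ∣ ≤? L) ×-dec Disj? V E ×-dec All.all? (λ F → (E ⊆? F) →-dec ¬? (Disj? F V)) 𝓕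

  ¬blocked⇒extendable : ∀ {E} → ¬ Blocked E → Extendable E
  ¬blocked⇒extendable {E} nb V l d with Any.any? (λ F → (E ⊆? F) ×-dec Disj? F V) 𝓕
  ... | yes a = find a
  ... | no na = contradiction (V , l , d , All.tabulate {P = λ F → E ⊆ F → ¬ Disj F V} cover) nb
    where
    cover : ∀ {F} → F ∈ₗ 𝓕 → E ⊆ F → ¬ Disj F V
    cover i p q = na (lose {P = λ F → (E ⊆ F) × Disj F V} i ((λ {x} → p) , q))

  member⇒extendable : ∀ {F} → F ∈ₗ 𝓕 → Extendable F
  member⇒extendable {F} i V l d = F , i , id , λ x p q → d x q p

  extendable⇒superset : ∀ {E} → Extendable E → ∃[ F ] F ∈ₗ 𝓕 × E ⊆ F
  extendable⇒superset ex =
    let F , i , p , _ = ex ∅ (∣∅∣≤ n) (λ _ p _ → ∉⊥ p) in F , i , p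

  module Build {s k : ℕ} (2≤s : 2 ≤ s) (s*k≤L : s * k ≤ L) (uniform : ∀ {F} → F ∈ₗ 𝓕 → ∣ F ∣ ≡ k) where

    replace : (Fin s → Subset n) → Fin s → Subset n → Fin s → Subset n
    replace E j F i with i Fin.≟ j
    ... | yes _ = F
    ... | no _ = E i

    -- Petals are replaced by members one at a time. The new member must avoid the points of the
    -- current petals outside `E j`; each petal lies in a member of 𝓕, so there are at most s k such
    -- points, whence the choice `L = s * k` in `Setting`. Replaced petals remain extendable, which
    -- keeps the induction going.
    extendAll : ∀ {K E} → Kernel K E → (∀ i → Extendable (E i)) → (is : List (Fin s)) →
                ∃[ F ] Kernel K F × (∀ i → Extendable (F i)) × (∀ {i} → i ∈ₗ is → F i ∈ₗ 𝓕)
    extendAll {K} {E} ker ex [] = E , ker , ex , λ ()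
    extendAll {K} ker₀ ex₀ (j ∷ is) with extendAll ker₀ ex₀ is
    ... | E , (sub , meet) , ex , mem = E′ , (sub′ , meet′) , ex′ , mem′
      where
      V : Subset n
      V = ⋃ (List.tabulate E) ─ E j
      ∣E∣≤ : ∀ {A} → A ∈ₗ List.tabulate E → ∣ A ∣ ≤ k
      ∣E∣≤ i with ∈-tabulate⁻ i
      ... | l , refl = let F , i , p = extendable⇒superset (ex l) in ≤-trans (p⊆q⇒∣p∣≤∣q∣ p) (≤-reflexive (uniform i))
      ∣V∣≤ : ∣ V ∣ ≤ L
      ∣V∣≤ = ≤-trans (∣p─q∣≤∣p∣ (⋃ (List.tabulate E)) (E j)) (≤-trans (∣⋃∣≤ (List.tabulate E) ∣E∣≤)
        (≤-trans (≤-reflexive (cong (_* k) (List.length-tabulate E))) s*k≤L))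
      extension : ∃[ F ] F ∈ₗ 𝓕 × E j ⊆ F × Disj F V
      extension = ex j V ∣V∣≤ (λ _ p q → ─ʳ (⋃ (List.tabulate E)) (E j) p q)
      F = proj₁ extension
      F∈ = proj₁ (proj₂ extension)
      Ej⊆F = proj₁ (proj₂ (proj₂ extension))
      disj : Disj F V
      disj = proj₂ (proj₂ (proj₂ extension))
      E′ = replace E j F
      back : ∀ {l x} → x ∈ F → x ∈ E l → x ∈ E j
      back {l} {x} p q with x ∈? E j
      ... | yes r = r
      ... | no nr = ⊥-elim (disj x p (─⁺ (∈⋃⁺ (∈-tabulate⁺ l) q) nr))
      sub′ : ∀ i → K ⊆ E′ i
      sub′ i with i Fin.≟ j
      ... | yes _ = Ej⊆F ∘ sub j
      ... | no _ = sub i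
      meet′ : ∀ {i l} → i ≢ l → ∀ {x} → x ∈ E′ i → x ∈ E′ l → x ∈ K
      meet′ {i} {l} ne p q with i Fin.≟ j | l Fin.≟ j
      ... | yes refl | yes refl = contradiction refl ne
      ... | yes refl | no ne′ = meet ne (back p q) q
      ... | no ne′ | yes refl = meet ne p (back q p)
      ... | no _ | no _ = meet ne p q
      ex′ : ∀ i → Extendable (E′ i)
      ex′ i with i Fin.≟ j
      ... | yes _ = member⇒extendable F∈
      ... | no _ = ex i
      mem′ : ∀ {i} → i ∈ₗ j ∷ is → E′ i ∈ₗ 𝓕
      mem′ {i} m with i Fin.≟ j | m
      ... | yes _ | _ = F∈
      ... | no ne | here e = contradiction e ne
      ... | no _ | there i∈ = mem i∈

    kernel⇒sunflowerIn : ∀ {K E} → Kernel K E → (∀ i → Extendable (E i)) → ∣ K ∣ < k →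
                         ∃[ F ] IsSunflower F × (∀ (i : Fin s) → F i ∈ₗ 𝓕) × core F ≡ K
    kernel⇒sunflowerIn {K} ker ex c<k with extendAll ker ex (List.allFin s)
    ... | F , kerF , _ , mem =
      F , kernel⇒sunflower 2≤s kerF (λ i → ≤-trans c<k (≤-reflexive (sym (uniform (mem (∈-tabulate⁺ i)))))) ,
      (λ i → mem (∈-tabulate⁺ i)) , kernel⇒core≡ 2≤s kerF

∣─∣≡ : ∀ {X E : Subset n} {q e} → E ⊆ X → ∣ X ∣ ≡ q → ∣ E ∣ ≡ e → ∣ X ─ E ∣ ≡ q ∸ e
∣─∣≡ {X = X} {E} s refl refl = trans (sym (m+n∸m≡n ∣ E ∣ _)) (cong (_∸ ∣ E ∣) (∣─∣-⊆ X E s))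

-- `X` is recovered from `E`, one point of `V`, and the remaining q - |E| - 1 elements. Having to
-- meet a bounded set outside `E` thus costs a factor n; for q = |E| there is no such `X`.
hitting≤ : ∀ {xs : List (Subset n)} (E V : Subset n) q → Unique xs →
           (∀ {X} → X ∈ₗ xs → ∣ X ∣ ≡ q × E ⊆ X × ∃[ x ] x ∈ V × x ∈ X × x ∉ E) →
           length xs * n ≤ ∣ V ∣ * n ^ (q ∸ ∣ E ∣)
hitting≤ {n} {xs} E V q u h with q ∸ ∣ E ∣ in eq
... | zero with xs
... | [] = z≤n
... | X ∷ _ = let e , s , x , _ , x∈X , x∉E = h (here refl) in
  contradiction (subst (x ∈_) (sym (⊆∧∣∣⇒≡ s (≤-trans (≤-reflexive e) (m∸n≡0⇒m≤n eq)))) x∈X) x∉E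
hitting≤ {n} {xs} E V q u h | suc p = begin
  length xs * n                                        ≤⟨ *-monoˡ-≤ n (length≤-code decode codes u code) ⟩
  length codes * n                                     ≡⟨ cong (_* n) (length-cartesianProduct (elems V) (sized n p)) ⟩
  length (elems V) * length (sized n p) * n            ≤⟨ *-monoˡ-≤ n (*-mono-≤ (≤-reflexive (length-elems V)) (length-sized≤ n p)) ⟩
  ∣ V ∣ * n ^ p * n                                    ≡⟨ trans (*-assoc ∣ V ∣ _ n) (cong (∣ V ∣ *_) (*-comm (n ^ p) n)) ⟩
  ∣ V ∣ * n ^ suc p                                    ∎
  where
  open ≤-Reasoning
  codes = cartesianProduct (elems V) (sized n p)
  decode : Fin n × Subset n → Subset n
  decode (x , R) = (E ∪ ⁅ x ⁆) ∪ R
  code : ∀ {X} → X ∈ₗ xs → ∃[ c ] c ∈ₗ codes × X ≡ decode c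
  code {X} i = let e , s , x , x∈V , x∈X , x∉E = h i
                   s′ : E ∪ ⁅ x ⁆ ⊆ X
                   s′ = ∪-⊆ s λ y∈ → subst (_∈ X) (sym (x∈⁅y⁆⇒x≡y x y∈)) x∈X
                   size : ∣ E ∪ ⁅ x ⁆ ∣ ≡ suc ∣ E ∣
                   size = trans (∣∪∣-disj E ⁅ x ⁆ λ y p q → x∉E (subst (_∈ E) (x∈⁅y⁆⇒x≡y x q) p))
                            (trans (cong (∣ E ∣ +_) (∣⁅x⁆∣≡1 x)) (+-comm ∣ E ∣ 1))
               in (x , X ─ (E ∪ ⁅ x ⁆)) ,
                  ∈-cartesianProduct⁺ (∈-elems⁺ x∈V) (∈-sized⁺ (trans (∣─∣≡ s′ e size)
                    (trans (cong (q ∸_) (+-comm 1 ∣ E ∣)) (trans (sym (∸-+-assoc q ∣ E ∣ 1)) (cong (_∸ 1) eq))))) ,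
                  sym (∪─ s′)

¬Disj⇒common : ∀ (A B : Subset n) → ¬ Disj A B → ∃[ x ] x ∈ A × x ∈ B
¬Disj⇒common A B nd with nonempty? (A ∩ B)
... | yes (x , p) = x , ∩ˡ A B p , ∩ʳ A B p
... | no np = contradiction (λ x p q → np (x , ∩⁺ p q)) nd

∪-─ : ∀ {A B : Subset n} → Disj A B → (A ∪ B) ─ A ≡ B
∪-─ {A = A} {B} d = ⊆-antisym
  (λ p → ∪-elim A B (─ˡ (A ∪ B) A p) (λ q → contradiction q (─ʳ (A ∪ B) A p)) id)
  (λ {x} p → ─⁺ (∪ʳ p) (λ q → d x q p))

-- Concentration

-- An H with fewer than α related sets is deficient.  Two non-deficient sets
-- meeting in at least c elements are related to the same sets.  Some U₀ of
-- size c has few deficient supersets, and an H = U ∪ V with |U| = c is then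
-- linked to a fixed superset of U₀ through U₀ ∪ V.
module Concentration {n : ℕ} (c r : ℕ) (2c≤r : c + c ≤ r) (cands : List (Subset n)) (cands-unique : Unique cands)
  {R : Subset n → Subset n → Set} (R? : ∀ G H → Dec (R G H)) (α E κ : ℕ)
  (union : ∀ {H H′} → ∣ H ∣ ≡ r → ∣ H′ ∣ ≡ r → c ≤ ∣ H ∩ H′ ∣ → ∀ {xs} → Unique xs →
           (∀ {G} → G ∈ₗ xs → G ∈ₗ cands × (R G H ⊎ R G H′)) → length xs ≤ α)
  where

  related : Subset n → List (Subset n)
  related H = filter (λ G → R? G H) cands

  related-unique : ∀ H → Unique (related H)
  related-unique H = Unique.filter⁺ (λ G → R? G H) cands-unique

  ∈-related⁻ : ∀ {H G} → G ∈ₗ related H → G ∈ₗ cands × R G H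
  ∈-related⁻ {H} i = ∈-filter⁻ (λ G → R? G H) {xs = cands} i

  exceptional? : ∀ H₀ → Decidable (λ H → ¬ All (λ G → R G H) (related H₀))
  exceptional? H₀ H = ¬? (All.all? (λ G → R? G H) (related H₀))

  exceptions : Subset n → List (Subset n)
  exceptions H₀ = filter (exceptional? H₀) (sized n r)

  unexceptional : ∀ {H₀ G H} → ∣ H ∣ ≡ r → H ∉ₗ exceptions H₀ → G ∈ₗ related H₀ → R G H
  unexceptional {H₀} {G} {H} e ni i = decidable-stable (R? G H) λ nr →
    ni (∈-filter⁺ (exceptional? H₀) (∈-sized⁺ e) λ all → nr (All.lookup all i))

  -- `κ₁` counts the `V` unsuited to be joined to `U₀`: c for those meeting `U₀`, the other summand
  -- for the deficient supersets of `U₀`. `κ₂` adds the deficient `H` themselves.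
  κ₁ κ₂ : ℕ
  κ₁ = c + chooseConst r * (2 ^ r * κ)
  κ₂ = κ + κ₁

  module _ (lower : α * (n C r) ≤ ∑ (sized n r) (length ∘ related) + E) (E-small : E * n ≤ κ * n ^ r)
           (large : 2 * (0 + r) ≤ n) (large′ : chooseConst r * κ₁ < n) where

    private
      c≤r : c ≤ r
      c≤r = ≤-trans (m≤m+n c c) 2c≤r

      c+[r∸c] : c + (r ∸ c) ≡ r
      c+[r∸c] = m+[n∸m]≡n c≤r

      n^c*n^[r∸c] : n ^ c * n ^ (r ∸ c) ≡ n ^ r
      n^c*n^[r∸c] = trans (sym (^-distribˡ-+-* n c (r ∸ c))) (cong (n ^_) c+[r∸c])

      instance
        n≢0 : NonZero n
        n≢0 = >-nonZero (≤-trans (s≤s z≤n) large′)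

      n^≢0 : ∀ m → NonZero (n ^ m)
      n^≢0 m = m^n≢0 n m

      Deficient : Subset n → Set
      Deficient H = length (related H) < α

      deficient? : Decidable Deficient
      deficient? H = length (related H) <? α

      deficient : List (Subset n)
      deficient = filter deficient? (sized n r)

      related≤α : ∀ {H} → ∣ H ∣ ≡ r → length (related H) ≤ α
      related≤α {H} e = union e e (≤-trans c≤r (≤-reflexive (trans (sym e) (cong ∣_∣ (sym (∩-idem H))))))
        (related-unique H) (λ i → let j , p = ∈-related⁻ i in j , inj₁ p)

      -- By `union` with H′ = H, no `H` has more than α related sets. So each deficient `H` uses up
      -- at least one of the E units by which the total may fall short of α C(n, r).
      deficient≤ : length deficient ≤ E
      deficient≤ = +-cancelˡ-≤ (∑ (sized n r) (length ∘ related)) _ _ (begin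
        S + length deficient                                   ≡⟨ cong (S +_) (length-filter≡∑ deficient? (sized n r)) ⟩
        S + ∑ (sized n r) (indicator ∘ deficient?)             ≡⟨ ∑-+ (sized n r) _ _ ⟨
        ∑ (sized n r) (λ H → length (related H) + indicator (deficient? H)) ≤⟨ ∑-≤ (sized n r) (λ i → pointwise (∈-sized⁻ i)) ⟩
        length (sized n r) * α                                 ≡⟨ trans (cong (_* α) (length-sized n r)) (*-comm (n C r) α) ⟩
        α * (n C r)                                            ≤⟨ lower ⟩
        S + E                                                  ∎)
        where
        open ≤-Reasoning
        S = ∑ (sized n r) (length ∘ related)
        pointwise : ∀ {H} → ∣ H ∣ ≡ r → length (related H) + indicator (deficient? H) ≤ α
        pointwise {H} e with deficient? H
        ... | yes l = ≤-trans (≤-reflexive (+-comm _ 1)) l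
        ... | no _ = ≤-trans (≤-reflexive (+-identityʳ _)) (related≤α e)

      Us = sized n c
      Vs = sized n (r ∸ c)

      weight : Subset n → ℕ
      weight U = length (filter (λ H → U ⊆? H) deficient)

      -- Each deficient set contains at most 2 ^ r sets of size c, so the average weight of a c-set
      -- is at most E 2 ^ r divided by their number.
      light : ∃[ U₀ ] ∣ U₀ ∣ ≡ c × weight U₀ * length Us ≤ E * 2 ^ r
      light = go Us refl
        where
        go : ∀ xs → xs ≡ Us → ∃[ U₀ ] ∣ U₀ ∣ ≡ c × weight U₀ * length Us ≤ E * 2 ^ r
        go [] eq = contradiction (≤-trans (>-nonZero⁻¹ (n ^ c) {{n^≢0 c}}) (≤-trans
            (n^r≤K*C r {n} {0} c≤r large)
            (≤-reflexive (trans (cong (chooseConst r *_) (trans (sym (length-sized n c)) (cong length (sym eq)))) (*-zeroʳ (chooseConst r))))))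
          (λ ())
        go (x ∷ xs) eq with averaging x xs weight
        ... | U₀ , i , l = U₀ , ∈-sized⁻ (subst (U₀ ∈ₗ_) eq i) ,
          ≤-trans (subst (λ zs → weight U₀ * length zs ≤ ∑ zs weight) eq l) (begin
          ∑ Us weight                                                   ≡⟨ ∑-filter-swap _⊆?_ Us deficient ⟩
          ∑ deficient (λ H → length (filter (λ U → U ⊆? H) Us))         ≤⟨ ∑-≤ deficient few ⟩
          length deficient * 2 ^ r                                      ≤⟨ *-monoˡ-≤ (2 ^ r) deficient≤ ⟩
          E * 2 ^ r                                                     ∎)
          where
          open ≤-Reasoning
          few : ∀ {H} → H ∈ₗ deficient → length (filter (λ U → U ⊆? H) Us) ≤ 2 ^ r
          few {H} j = ≤-trans
            (Unique-⊆⇒length≤ (Unique.filter⁺ (λ U → U ⊆? H) (slice-unique ∅ ∅ c))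
              (λ k → ∈-subsets⁺ (proj₂ (∈-filter⁻ (λ U → U ⊆? H) {xs = Us} k))))
            (≤-reflexive (trans (length-subsets H)
              (cong (2 ^_) (∈-sized⁻ (proj₁ (∈-filter⁻ deficient? {xs = sized n r} j))))))

      U₀ = proj₁ light
      ∣U₀∣ : ∣ U₀ ∣ ≡ c
      ∣U₀∣ = proj₁ (proj₂ light)

      weight≤ : weight U₀ * n ≤ chooseConst r * (2 ^ r * κ) * n ^ (r ∸ c)
      weight≤ = *-cancelʳ-≤ _ _ (n ^ c) {{n^≢0 c}} (begin
        weight U₀ * n * n ^ c                                 ≤⟨ *-monoʳ-≤ (weight U₀ * n) (n^r≤K*C r {n} {0} c≤r large) ⟩
        weight U₀ * n * (K * (n C c))                         ≡⟨ cong (λ z → weight U₀ * n * (K * z)) (length-sized n c) ⟨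
        weight U₀ * n * (K * length Us)                       ≡⟨ shuffle₁ (weight U₀) n K (length Us) ⟩
        weight U₀ * length Us * (K * n)                       ≤⟨ *-monoˡ-≤ (K * n) (proj₂ (proj₂ light)) ⟩
        E * 2 ^ r * (K * n)                                   ≡⟨ shuffle₂ E (2 ^ r) K n ⟩
        E * n * (K * 2 ^ r)                                   ≤⟨ *-monoˡ-≤ (K * 2 ^ r) E-small ⟩
        κ * n ^ r * (K * 2 ^ r)                               ≡⟨ cong (λ z → κ * z * (K * 2 ^ r)) n^c*n^[r∸c] ⟨
        κ * (n ^ c * n ^ (r ∸ c)) * (K * 2 ^ r)               ≡⟨ shuffle₃ κ (n ^ c) (n ^ (r ∸ c)) K (2 ^ r) ⟩
        K * (2 ^ r * κ) * n ^ (r ∸ c) * n ^ c                 ∎)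
        where
        open ≤-Reasoning
        K = chooseConst r
        shuffle₁ : ∀ a b c d → a * b * (c * d) ≡ a * d * (c * b)
        shuffle₁ = solve 4 (λ a b c d → a :* b :* (c :* d) := a :* d :* (c :* b)) refl
        shuffle₂ : ∀ a b c d → a * b * (c * d) ≡ a * d * (c * b)
        shuffle₂ = shuffle₁
        shuffle₃ : ∀ a b c d e → a * (b * c) * (d * e) ≡ d * (e * a) * c * b
        shuffle₃ = solve 5 (λ a b c d e → a :* (b :* c) :* (d :* e) := d :* (e :* a) :* c :* b) refl

      Bad : Subset n → Set
      Bad V = ¬ Disj U₀ V ⊎ Deficient (U₀ ∪ V)

      bad? : Decidable Bad
      bad? V = ¬? (Disj? U₀ V) ⊎-dec deficient? (U₀ ∪ V)

      bad : List (Subset n)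
      bad = filter bad? Vs

      meeting : List (Subset n)
      meeting = filter (λ V → ¬? (Disj? U₀ V)) Vs

      Vs-unique : Unique Vs
      Vs-unique = slice-unique ∅ ∅ (r ∸ c)

      bad≤ : length bad ≤ length meeting + weight U₀
      bad≤ = begin
        length bad
          ≤⟨ Unique-⊆⇒length≤ (Unique.filter⁺ bad? Vs-unique) split ⟩
        length (meeting ++ map (_─ U₀) (filter (λ H → U₀ ⊆? H) deficient))
          ≡⟨ List.length-++ meeting ⟩
        length meeting + length (map (_─ U₀) (filter (λ H → U₀ ⊆? H) deficient))
          ≡⟨ cong (length meeting +_) (List.length-map (_─ U₀) (filter (λ H → U₀ ⊆? H) deficient)) ⟩
        length meeting + weight U₀ ∎
        where
        open ≤-Reasoning
        split : ∀ {V} → V ∈ₗ bad → V ∈ₗ meeting ++ map (_─ U₀) (filter (λ H → U₀ ⊆? H) deficient)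
        split {V} i with ∈-filter⁻ bad? {xs = Vs} i
        ... | j , b with Disj? U₀ V
        ... | no nd = ∈-++⁺ˡ (∈-filter⁺ (λ V → ¬? (Disj? U₀ V)) j nd)
        ... | yes d with b
        ... | inj₁ nd = contradiction d nd
        ... | inj₂ def = ∈-++⁺ʳ meeting (subst (_∈ₗ map (_─ U₀) (filter (λ H → U₀ ⊆? H) deficient)) (∪-─ d)
          (∈-map⁺ (_─ U₀) (∈-filter⁺ (λ H → U₀ ⊆? H)
            (∈-filter⁺ deficient? (∈-sized⁺ (trans (∣∪∣-disj U₀ V d)
              (trans (cong₂ _+_ ∣U₀∣ (∈-sized⁻ j)) c+[r∸c]))) def) ∪ˡ)))

      meeting≤ : length meeting * n ≤ c * n ^ (r ∸ c)
      meeting≤ = ≤-trans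
        (hitting≤ ∅ U₀ (r ∸ c) (Unique.filter⁺ (λ V → ¬? (Disj? U₀ V)) Vs-unique) λ {X} i →
          let j , nd = ∈-filter⁻ (λ V → ¬? (Disj? U₀ V)) {xs = Vs} i
              x , p , q = ¬Disj⇒common U₀ X nd
          in ∈-sized⁻ j , ⊆-min X , x , p , q , ∉⊥)
        (≤-reflexive (cong₂ (λ a b → a * n ^ b) ∣U₀∣ (cong (r ∸ c ∸_) (∣⊥∣≡0 n))))

      bad*n≤ : length bad * n ≤ κ₁ * n ^ (r ∸ c)
      bad*n≤ = begin
        length bad * n                                        ≤⟨ *-monoˡ-≤ n bad≤ ⟩
        (length meeting + weight U₀) * n                      ≡⟨ *-distribʳ-+ n (length meeting) _ ⟩
        length meeting * n + weight U₀ * n                    ≤⟨ +-mono-≤ meeting≤ weight≤ ⟩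
        c * n ^ (r ∸ c) + chooseConst r * (2 ^ r * κ) * n ^ (r ∸ c) ≡⟨ *-distribʳ-+ (n ^ (r ∸ c)) c _ ⟨
        κ₁ * n ^ (r ∸ c)                                      ∎
        where open ≤-Reasoning

      good : ∃[ V₀ ] ∣ V₀ ∣ ≡ r ∸ c × ¬ Bad V₀
      good with Any.any? (λ V → ¬? (bad? V)) Vs
      ... | yes a = let V , i , nb = find a in V , ∈-sized⁻ i , nb
      ... | no na = contradiction large′ (≤⇒≯ (*-cancelʳ-≤ n (chooseConst r * κ₁) (n ^ (r ∸ c)) {{n^≢0 (r ∸ c)}} (begin
        n * n ^ (r ∸ c)                                       ≤⟨ *-monoʳ-≤ n (n^r≤K*C r {n} {0} (m∸n≤m r c) large) ⟩
        n * (chooseConst r * (n C (r ∸ c)))                   ≡⟨ cong (λ z → n * (chooseConst r * z)) (length-sized n (r ∸ c)) ⟨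
        n * (chooseConst r * length Vs)                       ≤⟨ *-monoʳ-≤ n (*-monoʳ-≤ (chooseConst r) (Unique-⊆⇒length≤ Vs-unique allBad)) ⟩
        n * (chooseConst r * length bad)                      ≡⟨ solve 3 (λ a b c → a :* (b :* c) := b :* (c :* a)) refl n (chooseConst r) (length bad) ⟩
        chooseConst r * (length bad * n)                      ≤⟨ *-monoʳ-≤ (chooseConst r) bad*n≤ ⟩
        chooseConst r * (κ₁ * n ^ (r ∸ c))                    ≡⟨ *-assoc (chooseConst r) κ₁ _ ⟨
        chooseConst r * κ₁ * n ^ (r ∸ c)                      ∎)))
        where
        open ≤-Reasoning
        allBad : ∀ {V} → V ∈ₗ Vs → V ∈ₗ bad
        allBad {V} i with bad? V
        ... | yes b = ∈-filter⁺ bad? i b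
        ... | no nb = contradiction (lose i nb) na

      V₀ = proj₁ good

      union-size : ∀ (U V : Subset n) → Disj U V → ∣ U ∣ ≡ c → ∣ V ∣ ≡ r ∸ c → ∣ U ∪ V ∣ ≡ r
      union-size U V d e f = trans (∣∪∣-disj U V d) (trans (cong₂ _+_ e f) c+[r∸c])

      ¬bad⇒disj : ∀ V → ¬ Bad V → Disj U₀ V
      ¬bad⇒disj V nb = decidable-stable (Disj? U₀ V) (nb ∘ inj₁)

      -- A set related to `H` but not to `H′` could be added to the α sets related to `H′`, giving
      -- more than `union` allows. Only the target has to be non-deficient.
      transfer : ∀ {H H′} → ∣ H ∣ ≡ r → ∣ H′ ∣ ≡ r → c ≤ ∣ H ∩ H′ ∣ → ¬ Deficient H′ →
                 ∀ {G} → G ∈ₗ related H → G ∈ₗ related H′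
      transfer {H} {H′} e e′ l nd {G} i = decidable-stable (G ∈ₗ? related H′) λ ni →
        nd (union e e′ l {G ∷ related H′} (All.tabulate (λ j eq → ni (subst (_∈ₗ related H′) (sym eq) j)) ∷ related-unique H′) λ where
          (here refl) → let j , p = ∈-related⁻ i in j , inj₁ p
          (there j) → let j , p = ∈-related⁻ j in j , inj₂ p)

    concentration : ∃[ H₀ ] ∣ H₀ ∣ ≡ r × length (related H₀) ≡ α × length (exceptions H₀) * n ≤ κ₂ * n ^ r
    concentration = H₀ , ∣H₀∣ ,
      ≤-antisym (related≤α ∣H₀∣) (≮⇒≥ (proj₂ (proj₂ good) ∘ inj₂)) , (begin
        length (exceptions H₀) * n
          ≤⟨ *-monoˡ-≤ n (Unique-⊆⇒length≤ (Unique.filter⁺ (exceptional? H₀) (slice-unique ∅ ∅ r)) code) ⟩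
        length (deficient ++ cartesianProductWith _∪_ Us bad) * n
          ≡⟨ cong (_* n) (trans (List.length-++ deficient) (cong (length deficient +_) (length-cartesianProductWith Us bad))) ⟩
        (length deficient + length Us * length bad) * n
          ≡⟨ trans (*-distribʳ-+ n (length deficient) _) (cong (length deficient * n +_) (*-assoc (length Us) _ n)) ⟩
        length deficient * n + length Us * (length bad * n)
          ≤⟨ +-mono-≤ (≤-trans (*-monoˡ-≤ n deficient≤) E-small) (*-mono-≤ (length-sized≤ n c) bad*n≤) ⟩
        κ * n ^ r + n ^ c * (κ₁ * n ^ (r ∸ c))
          ≡⟨ cong (κ * n ^ r +_) (trans (solve 3 (λ a b c → a :* (b :* c) := b :* (a :* c)) refl (n ^ c) κ₁ (n ^ (r ∸ c))) (cong (κ₁ *_) n^c*n^[r∸c])) ⟩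
        κ * n ^ r + κ₁ * n ^ r
          ≡⟨ *-distribʳ-+ (n ^ r) κ κ₁ ⟨
        κ₂ * n ^ r ∎)
      where
      open ≤-Reasoning
      H₀ = U₀ ∪ V₀
      ∣H₀∣ : ∣ H₀ ∣ ≡ r
      ∣H₀∣ = union-size U₀ V₀ (¬bad⇒disj V₀ (proj₂ (proj₂ good))) ∣U₀∣ (proj₁ (proj₂ good))
      length-cartesianProductWith : ∀ (xs ys : List (Subset n)) → length (cartesianProductWith _∪_ xs ys) ≡ length xs * length ys
      length-cartesianProductWith [] ys = refl
      length-cartesianProductWith (x ∷ xs) ys = trans (List.length-++ (map (x ∪_) ys))
        (cong₂ _+_ (List.length-map (x ∪_) ys) (length-cartesianProductWith xs ys))
      code : ∀ {H} → H ∈ₗ exceptions H₀ → H ∈ₗ deficient ++ cartesianProductWith _∪_ Us bad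
      code {H} i with ∈-filter⁻ (exceptional? H₀) {xs = sized n r} i
      ... | H∈ , exc with deficient? H
      ... | yes d = ∈-++⁺ˡ (∈-filter⁺ deficient? H∈ d)
      ... | no nd with subsetOfSize H (≤-trans c≤r (≤-reflexive (sym (∈-sized⁻ H∈))))
      ... | U , U⊆H , ∣U∣ = ∈-++⁺ʳ deficient (subst (_∈ₗ cartesianProductWith _∪_ Us bad) (∪─ U⊆H)
          (∈-cartesianProductWith⁺ _∪_ (∈-sized⁺ ∣U∣) (∈-filter⁺ bad? (∈-sized⁺ ∣V∣) isBad)))
        where
        V = H ─ U
        ∣V∣ : ∣ V ∣ ≡ r ∸ c
        ∣V∣ = ∣─∣≡ U⊆H (∈-sized⁻ H∈) ∣U∣
        isBad : Bad V
        -- The chain is `U₀ ∪ V₀`, `U₀ ∪ V`, `H`: the first two share `U₀`, the last two share `V`,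
        -- whose size r - c is at least c because 2c ≤ r.
        isBad = decidable-stable (bad? V) λ nb → exc (All.tabulate λ {G} g →
          let d = ¬bad⇒disj V nb
              e₁ = union-size U₀ V d ∣U₀∣ ∣V∣
              g₁ = transfer ∣H₀∣ e₁ (≤-trans (≤-reflexive (sym ∣U₀∣)) (∣⊆∣ U₀ ((U₀ ∪ V₀) ∩ (U₀ ∪ V)) λ p → ∩⁺ (∪ˡ {B = V₀} p) (∪ˡ {B = V} p))) (nb ∘ inj₂) g
              g₂ = transfer e₁ (∈-sized⁻ H∈) (≤-trans (≤-trans (m+n≤o⇒m≤o∸n c 2c≤r) (≤-reflexive (sym ∣V∣)))
                     (∣⊆∣ V ((U₀ ∪ V) ∩ H) λ p → ∩⁺ (∪ʳ {A = U₀} p) (─ˡ H U p))) nd g₁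
          in proj₂ (∈-related⁻ g₂))

-- Throughout, c stands for t - 1.
record Setting (s k c n : ℕ) : Set where
  field
    2≤s : 2 ≤ s
    c<k : c < k
    𝓕 : Family n
    uniform : Uniform k 𝓕
    sunflowerFree : ¬ ContainsSunflower s (_≡ c) 𝓕
    maximal : ∀ (𝓖 : Family n) → Uniform k 𝓖 → ¬ ContainsSunflower s (_≡ c) 𝓖 → size 𝓖 ≤ size 𝓕

  open Extension (members 𝓕) (s * k) public
  open Build 2≤s ≤-refl uniform public

  noKernel : ∀ {K E} → Kernel {s = s} K E → (∀ i → Extendable (E i)) → ∣ K ∣ ≡ c → ⊥
  noKernel ker ex e = let F , sf , mem , eq = kernel⇒sunflowerIn ker ex (≤-trans (s≤s (≤-reflexive e)) c<k) in
    sunflowerFree (F , sf , mem , trans (cong ∣_∣ eq) e)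

  -- Taken s times, an extendable c-set is a kernel system with itself as kernel, and its extensions
  -- form a sunflower with this core.
  ¬extendable : ∀ {E} → ∣ E ∣ ≡ c → ¬ Extendable E
  ¬extendable {E} e ex = noKernel {E} {const E} ((λ _ → id) , λ _ p _ → p) (const ex) e

powers : ℕ → List (Subset n) → List (Subset n)
powers zero xs = [ ∅ ]
powers (suc q) xs = concatMap (λ D → map (D ∪_) (powers q xs)) xs

length-powers≤ : ∀ q (xs : List (Subset n)) → length (powers q xs) ≤ length xs ^ q
length-powers≤ zero xs = ≤-refl
length-powers≤ (suc q) xs = length-concatMap≤ _ xs λ {D} _ →
  ≤-trans (≤-reflexive (List.length-map (D ∪_) (powers q xs))) (length-powers≤ q xs)

-- The d-sets are cut off from `M` one after another, hence are disjoint. In `Cleanup` each of them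
-- is a blocked set, so a code has few choices for each.
∈-powers : ∀ q {xs : List (Subset n)} {d} (M : Subset n) → (∀ {D} → D ⊆ M → ∣ D ∣ ≡ d → D ∈ₗ xs) →
           d * q ≤ ∣ M ∣ → ∃[ Z ] Z ∈ₗ powers q xs × Z ⊆ M × ∣ Z ∣ ≡ d * q
∈-powers {n} zero {d = d} M h l = ∅ , here refl , ⊆-min M , trans (∣⊥∣≡0 n) (sym (*-zeroʳ d))
∈-powers (suc q) {d = d} M h l with subsetOfSize M (≤-trans (≤-trans (m≤m+n d (d * q)) (≤-reflexive (sym (*-suc d q)))) l)
... | D , D⊆M , e with ∈-powers q {d = d} (M ─ D) (λ D′⊆ → h (─ˡ M D ∘ D′⊆)) (≤-trans
        (≤-trans (≤-reflexive (sym (m+n∸m≡n d (d * q)))) (∸-monoˡ-≤ d (≤-trans (≤-reflexive (sym (*-suc d q))) l)))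
        (≤-reflexive (sym (∣─∣≡ D⊆M refl e))))
... | Z , Z∈ , Z⊆ , f = D ∪ Z , ∈-concatMap⁺ (h D⊆M e) (∈-map⁺ (D ∪_) Z∈) , ∪-⊆ D⊆M (─ˡ M D ∘ Z⊆) ,
  trans (∣∪∣-disj D Z λ x p q → ─ʳ M D (Z⊆ q) p) (trans (cong₂ _+_ e f) (sym (*-suc d q)))

-- The sets of size m - 1. For m = 0 the list is empty, as truncated subtraction would break the
-- bound `length-sizedBelow` there.
sizedBelow : ∀ n → ℕ → List (Subset n)
sizedBelow n zero = []
sizedBelow n (suc m) = sized n m

length-sizedBelow : ∀ n m → length (sizedBelow n m) * n ≤ n ^ m
length-sizedBelow n zero = z≤n
length-sizedBelow n (suc m) = ≤-trans (*-monoˡ-≤ n (length-sized≤ n m)) (≤-reflexive (*-comm (n ^ m) n))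

∈-sizedBelow : ∀ {X : Subset n} {m} → suc ∣ X ∣ ≡ m → X ∈ₗ sizedBelow n m
∈-sizedBelow refl = ∈-sized⁺ refl

-- Clean-up of the families with small trace

-- Replacing the members of 𝓕 with a small trace outside 𝒮, and those with a
-- larger trace that contain a blocked set, by all sets with trace in 𝒮 keeps
-- the family sunflower-free.  Each blocked d-set accounts for order n^(k-a-d)
-- missing sets, but only for order n^(k-a-d-1) removed ones; so there are no
-- blocked sets at all.
module Cleanup {s k c n : ℕ} (S : Setting s k c n) (a B κ : ℕ) (a+c≤k : a + c ≤ k)
  (Y : Subset n) (∣Y∣≤B : ∣ Y ∣ ≤ B) (𝒮 : List (Subset n))
  (𝒮-bounds : ∀ {A} → A ∈ₗ 𝒮 → A ⊆ Y × c < ∣ A ∣ × ∣ A ∣ ≤ a)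
  (𝒮-avoids : Avoids s c (_∈ₗ 𝒮)) where

  open Setting S

  BlockedBy : Subset n → Set
  BlockedBy D = Any (λ A → Blocked (A ∪ D)) 𝒮

  blockedBy? : Decidable BlockedBy
  blockedBy? D = Any.any? (λ A → Blocked? (A ∪ D)) 𝒮

  private
    missing? : Decidable (λ X → X ∩ Y ∈ₗ 𝒮 × X ∉ₗ members 𝓕)
    missing? X = ((X ∩ Y) ∈ₗ? 𝒮) ×-dec ¬? (X ∈ₗ? members 𝓕)

  missing : List (Subset n)
  missing = filter missing? (sized n k)

  -- `κ₀` stems from counting blocked sets against missing sets, `κ₁` bounds the density of blocked
  -- sets in `δ-small`, `κ₃` counts removed members relative to the blocked d-sets (its summands
  -- belong to large and to small traces), and `κ₄` sums over d ≤ c. `w` bounds the size of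
  -- `Y ∪ (V ∪ D)`.
  κ₀ κ₁ κ₃ κ₄ w : ℕ
  κ₀ = 2 ^ k * chooseConst k
  κ₁ = κ * κ₀
  κ₃ = 2 ^ B + suc a * (2 ^ B * suc κ₁ ^ suc a)
  κ₄ = suc c * (κ₀ * κ₃)
  w = B + (s * k + c)

  module _ (rich : length missing * n ≤ κ * n ^ (k ∸ a))
    (low : ∀ {F} → F ∈ᶠ 𝓕 → ∣ F ∩ Y ∣ ≤ a → F ∩ Y ∉ₗ 𝒮 →
           c * (2 + a ∸ ∣ F ∩ Y ∣) + ∣ F ∩ Y ∣ ≤ k ×
           ¬ ¬ (∃[ d ] d ≤ c × (∀ {D} → D ⊆ F ─ Y → ∣ D ∣ ≡ d → BlockedBy D)))
    (large : 2 * (w + k) ≤ n) (large′ : κ₄ < n) where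

    private
      instance
        n≢0 : NonZero n
        n≢0 = >-nonZero (≤-trans (s≤s z≤n) large′)

      n^≢0 : ∀ m → NonZero (n ^ m)
      n^≢0 m = m^n≢0 n m

      blocked? : Decidable (λ D → Disj D Y × BlockedBy D)
      blocked? D = Disj? D Y ×-dec blockedBy? D

      𝒟 : ℕ → List (Subset n)
      𝒟 d = filter blocked? (sized n d)

      ∈-𝒟⁺ : ∀ {F D} → D ⊆ F ─ Y → BlockedBy D → D ∈ₗ 𝒟 ∣ D ∣
      ∈-𝒟⁺ {F} D⊆ b = ∈-filter⁺ blocked? (∈-sized⁺ refl) ((λ x p q → ─ʳ F Y (D⊆ p) q) , b)

      δ : ℕ → ℕ
      δ d = length (𝒟 d)

      -- If `V` covers `A ∪ D`, a k-set with trace `A ∪ D` on `Y ∪ (V ∪ D)` avoids `V` and so is not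
      -- in 𝓕. All these sets contain `D` and have trace `A` on `Y`.
      missedBy : ∀ {d D} → d ≤ c → D ∈ₗ 𝒟 d →
                 n ^ (k ∸ a ∸ d) ≤ length (filter (λ X → D ⊆? X) missing) * chooseConst k
      missedBy {d} {D} d≤c i with ∈-filter⁻ blocked? {xs = sized n d} i
      ... | D∈ , disjY , b with find b
      ... | A , A∈ , V , ∣V∣≤ , disjV , cover = begin
        n ^ (k ∸ a ∸ d)                             ≡⟨ cong (n ^_) (∸-+-assoc k a d) ⟩
        n ^ (k ∸ (a + d))                           ≤⟨ ^-monoʳ-≤ n (∸-monoʳ-≤ k ∣AD∣≤) ⟩
        n ^ (k ∸ ∣ A ∪ D ∣)                         ≤⟨ n^r≤K*C k {n} {w} (m∸n≤m k ∣ A ∪ D ∣) large ⟩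
        chooseConst k * ((n ∸ w) C (k ∸ ∣ A ∪ D ∣)) ≤⟨ *-monoʳ-≤ (chooseConst k) (C-monoˡ-≤ (k ∸ ∣ A ∪ D ∣) n∸w≤) ⟩
        chooseConst k * (∣ ∁ W ∣ C (k ∸ ∣ A ∪ D ∣)) ≡⟨ cong (chooseConst k *_) (length-slice W (A ∪ D) k AD⊆W ∣AD∣≤k) ⟨
        chooseConst k * length (slice W (A ∪ D) k)  ≤⟨ *-monoʳ-≤ (chooseConst k) (Unique-⊆⇒length≤ (slice-unique W (A ∪ D) k) isMissing) ⟩
        chooseConst k * length (filter (λ X → D ⊆? X) missing) ≡⟨ *-comm (chooseConst k) _ ⟩
        length (filter (λ X → D ⊆? X) missing) * chooseConst k ∎
        where
        open ≤-Reasoning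
        W = Y ∪ (V ∪ D)
        A⊆Y = proj₁ (𝒮-bounds A∈)
        ∣AD∣≤ : ∣ A ∪ D ∣ ≤ a + d
        ∣AD∣≤ = ≤-trans (∣∪∣≤ A D) (+-mono-≤ (proj₂ (proj₂ (𝒮-bounds A∈))) (≤-reflexive (∈-sized⁻ D∈)))
        ∣AD∣≤k : ∣ A ∪ D ∣ ≤ k
        ∣AD∣≤k = ≤-trans ∣AD∣≤ (≤-trans (+-monoʳ-≤ a d≤c) a+c≤k)
        AD⊆W : A ∪ D ⊆ W
        AD⊆W = ∪-⊆ (∪ˡ ∘ A⊆Y) (∪ʳ ∘ ∪ʳ {A = V})
        n∸w≤ : n ∸ w ≤ ∣ ∁ W ∣
        n∸w≤ = ≤-trans (∸-monoʳ-≤ n (≤-trans (∣∪∣≤ Y (V ∪ D)) (+-mono-≤ ∣Y∣≤B (≤-trans (∣∪∣≤ V D)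
          (+-mono-≤ ∣V∣≤ (≤-trans (≤-reflexive (∈-sized⁻ D∈)) d≤c)))))) (≤-reflexive (sym (∣∁p∣≡n∸∣p∣ W)))
        isMissing : ∀ {X} → X ∈ₗ slice W (A ∪ D) k → X ∈ₗ filter (λ X → D ⊆? X) missing
        isMissing {X} j with ∈-slice⁻ W (A ∪ D) AD⊆W j
        ... | ∣X∣ , eq = ∈-filter⁺ (λ X → D ⊆? X) (∈-filter⁺ missing? (∈-sized⁺ ∣X∣)
            (subst (_∈ₗ 𝒮) (sym X∩Y≡A) A∈ , λ X∈ → All.lookup cover X∈ AD⊆X disjXV)) (AD⊆X ∘ ∪ʳ)
          where
          AD⊆X : A ∪ D ⊆ X
          AD⊆X p = ∩ˡ X W (subst (_ ∈_) (sym eq) p)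
          into : ∀ {x} → x ∈ X → x ∈ W → x ∈ A ∪ D
          into p q = subst (_ ∈_) eq (∩⁺ p q)
          disjXV : Disj X V
          disjXV x p q = disjV x q (into p (∪ʳ (∪ˡ q)))
          X∩Y≡A : X ∩ Y ≡ A
          X∩Y≡A = ⊆-antisym
            (λ {x} p → ∪-elim A D (into (∩ˡ X Y p) (∪ˡ (∩ʳ X Y p))) id (λ q → ⊥-elim (disjY x q (∩ʳ X Y p))))
            (λ p → ∩⁺ (AD⊆X (∪ˡ p)) (A⊆Y p))

      δ≤missing : ∀ {d} → d ≤ c → δ d * n ^ (k ∸ a ∸ d) ≤ length missing * κ₀
      δ≤missing {d} d≤c = ≤-trans
        (doubleCounting _⊆?_ (𝒟 d) missing {w = 2 ^ k} (chooseConst k) (missedBy d≤c) λ {X} i →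
          ≤-trans (Unique-⊆⇒length≤ (Unique.filter⁺ (λ D → D ⊆? X) (Unique.filter⁺ blocked? (slice-unique ∅ ∅ d)))
              (λ j → ∈-subsets⁺ (proj₂ (∈-filter⁻ (λ D → D ⊆? X) {xs = 𝒟 d} j))))
            (≤-reflexive (trans (length-subsets X)
              (cong (2 ^_) (∈-sized⁻ (proj₁ (∈-filter⁻ missing? {xs = sized n k} i)))))))
        (≤-reflexive (*-assoc (length missing) (2 ^ k) (chooseConst k)))

      d≤k∸a : ∀ {d} → d ≤ c → d ≤ k ∸ a
      d≤k∸a d≤c = ≤-trans d≤c (≤-trans (≤-reflexive (sym (m+n∸m≡n a c))) (∸-monoˡ-≤ a a+c≤k))

      -- Since few sets are missing, blocked d-sets form only a fraction of order 1/n of all d-sets.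
      -- This preliminary bound is what makes several blocked sets in one member so rare.
      δ-small : ∀ {d} → d ≤ c → δ d * n ≤ κ₁ * n ^ d
      δ-small {d} d≤c = *-cancelʳ-≤ _ _ (n ^ e) {{n^≢0 e}} (begin
        δ d * n * n ^ e                    ≡⟨ solve 3 (λ x y z → x :* y :* z := x :* z :* y) refl (δ d) n (n ^ e) ⟩
        δ d * n ^ e * n                    ≤⟨ *-monoˡ-≤ n (δ≤missing d≤c) ⟩
        length missing * κ₀ * n            ≡⟨ solve 3 (λ x y z → x :* y :* z := x :* z :* y) refl (length missing) κ₀ n ⟩
        length missing * n * κ₀            ≤⟨ *-monoˡ-≤ κ₀ rich ⟩
        κ * n ^ (k ∸ a) * κ₀               ≡⟨ cong (λ z → κ * n ^ z * κ₀) (m+[n∸m]≡n (d≤k∸a d≤c)) ⟨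
        κ * n ^ (d + e) * κ₀               ≡⟨ cong (λ z → κ * z * κ₀) (^-distribˡ-+-* n d e) ⟩
        κ * (n ^ d * n ^ e) * κ₀           ≡⟨ solve 4 (λ x y z u → x :* (y :* z) :* u := x :* u :* y :* z) refl κ (n ^ d) (n ^ e) κ₀ ⟩
        κ₁ * n ^ d * n ^ e                 ∎)
        where
        open ≤-Reasoning
        e = k ∸ a ∸ d

      Dirty : Subset n → Set
      Dirty F = Any (λ D → ∣ D ∣ ≤ c × BlockedBy D) (subsets (F ─ Y))

      dirty? : Decidable Dirty
      dirty? F = Any.any? (λ D → (∣ D ∣ ≤? c) ×-dec blockedBy? D) (subsets (F ─ Y))

      Removed : Subset n → Set
      Removed F = (∣ F ∩ Y ∣ ≤ a × F ∩ Y ∉ₗ 𝒮) ⊎ (a < ∣ F ∩ Y ∣ × Dirty F)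

      removed? : Decidable Removed
      removed? F = ((∣ F ∩ Y ∣ ≤? a) ×-dec ¬? ((F ∩ Y) ∈ₗ? 𝒮)) ⊎-dec ((a <? ∣ F ∩ Y ∣) ×-dec dirty? F)

      removed : List (Subset n)
      removed = filter removed? (members 𝓕)

      New : Subset n → Set
      New X = ∣ X ∣ ≡ k × (X ∩ Y ∈ₗ 𝒮 ⊎ (X ∈ᶠ 𝓕 × a < ∣ X ∩ Y ∣ × ¬ Dirty X))

      new? : Decidable New
      new? X = (∣ X ∣ ≟ k) ×-dec (((X ∩ Y) ∈ₗ? 𝒮) ⊎-dec ((X ∈ₗ? members 𝓕) ×-dec (a <? ∣ X ∩ Y ∣) ×-dec ¬? (dirty? X)))

      new : Family n
      new = familyOf new?

      -- If all petals have traces in 𝒮, the traces contradict `𝒮-avoids`. Otherwise some petal is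
      -- an old member that is not dirty, so `D = K ─ Y` is not blocked by any `A` in 𝒮; each petal
      -- with trace `A` in 𝒮, which may be new, can then be shrunk to the extendable set `A ∪ D`,
      -- and the kernel stays `K`.
      new-sunflowerFree : ¬ ContainsSunflower s (_≡ c) new
      new-sunflowerFree (F , sf , mem , ∣K∣) = contradiction′
        where
        K = core F
        ker = sunflower⇒kernel sf
        kinds : ∀ i → New (F i)
        kinds i = ∈-familyOf⁻ new? (mem i)
        D = K ─ Y
        ∣D∣≤c : ∣ D ∣ ≤ c
        ∣D∣≤c = ≤-trans (∣p─q∣≤∣p∣ K Y) (≤-reflexive ∣K∣)
        traces : Kernel (K ∩ Y) (λ i → F i ∩ Y)
        traces = (λ i p → ∩⁺ (proj₁ ker i (∩ˡ K Y p)) (∩ʳ K Y p)) ,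
                 λ {i} {j} ne p q → ∩⁺ (proj₂ ker ne (∩ˡ (F i) Y p) (∩ˡ (F j) Y q)) (∩ʳ (F i) Y p)
        clean : (∃[ i ] F i ∩ Y ∉ₗ 𝒮) → ⊥
        clean (i₀ , ni) with kinds i₀
        ... | _ , inj₁ i = ni i
        ... | _ , inj₂ (_ , _ , nd) = noKernel {K} {E} (E-sub , E-meet) E-ext ∣K∣
          where
          extendable : ∀ {A} → A ∈ₗ 𝒮 → Extendable (A ∪ D)
          extendable A∈ = ¬blocked⇒extendable λ b → nd (lose
            (∈-subsets⁺ {A = F i₀ ─ Y} {D} λ p → ─⁺ (proj₁ ker i₀ (─ˡ K Y p)) (─ʳ K Y p))
            (∣D∣≤c , lose A∈ b))
          petal : ∀ i → F i ∩ Y ∈ₗ 𝒮 ⊎ F i ∈ᶠ 𝓕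
          petal i with proj₂ (kinds i)
          ... | inj₁ j = inj₁ j
          ... | inj₂ (j , _) = inj₂ j
          E : Fin s → Subset n
          E i with petal i
          ... | inj₁ _ = (F i ∩ Y) ∪ D
          ... | inj₂ _ = F i
          E⊆F : ∀ i → E i ⊆ F i
          E⊆F i with petal i
          ... | inj₁ _ = ∪-⊆ (∩ˡ (F i) Y) (proj₁ ker i ∘ ─ˡ K Y)
          ... | inj₂ _ = id
          E-sub : ∀ i → K ⊆ E i
          E-sub i {x} p with petal i
          ... | inj₂ _ = proj₁ ker i p
          ... | inj₁ _ with x ∈? Y
          ... | yes q = ∪ˡ (∩⁺ (proj₁ ker i p) q)
          ... | no nq = ∪ʳ (─⁺ p nq)
          E-meet : ∀ {i j} → i ≢ j → ∀ {x} → x ∈ E i → x ∈ E j → x ∈ K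
          E-meet {i} {j} ne p q = proj₂ ker ne (E⊆F i p) (E⊆F j q)
          E-ext : ∀ i → Extendable (E i)
          E-ext i with petal i
          ... | inj₁ A∈ = extendable A∈
          ... | inj₂ j = member⇒extendable j
        contradiction′ : ⊥
        contradiction′ with Fin.all? (λ i → (F i ∩ Y) ∈ₗ? 𝒮)
        ... | yes all = 𝒮-avoids (λ i → F i ∩ Y) (K ∩ Y) traces all (≤-trans (∣p∩q∣≤∣p∣ K Y) (≤-reflexive ∣K∣))
        ... | no ¬all = clean (Fin.¬∀⟶∃¬ s _ (λ i → (F i ∩ Y) ∈ₗ? 𝒮) ¬all)

      -- The missing sets enter and only the removed sets leave, so by extremality the gain is at
      -- most the loss.
      missing≤removed : length missing ≤ length removed
      missing≤removed = +-cancelˡ-≤ (size 𝓕) _ _ (begin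
        size 𝓕 + length missing             ≡⟨ List.length-++ (members 𝓕) ⟨
        length (members 𝓕 ++ missing)       ≤⟨ Unique-⊆⇒length≤ (Unique.++⁺ (unique 𝓕) (Unique.filter⁺ missing? (slice-unique ∅ ∅ k)) disj) split ⟩
        length (members new ++ removed)     ≡⟨ List.length-++ (members new) ⟩
        size new + length removed           ≤⟨ +-monoˡ-≤ (length removed) (maximal new (λ i → proj₁ (∈-familyOf⁻ new? i)) new-sunflowerFree) ⟩
        size 𝓕 + length removed             ∎)
        where
        open ≤-Reasoning
        disj : ∀ {X} → X ∈ₗ members 𝓕 × X ∈ₗ missing → ⊥
        disj (i , j) = proj₂ (proj₂ (∈-filter⁻ missing? {xs = sized n k} j)) i
        split : ∀ {X} → X ∈ₗ members 𝓕 ++ missing → X ∈ₗ members new ++ removed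
        split {X} i with ∈-++⁻ (members 𝓕) i
        ... | inj₂ j = let X∈ , tr , _ = ∈-filter⁻ missing? {xs = sized n k} j in
          ∈-++⁺ˡ (∈-familyOf⁺ new? (∈-sized⁻ X∈ , inj₁ tr))
        ... | inj₁ j with removed? X
        ... | yes r = ∈-++⁺ʳ (members new) (∈-filter⁺ removed? j r)
        ... | no nr = ∈-++⁺ˡ (∈-familyOf⁺ new? (uniform j , kind))
          where
          kind : X ∩ Y ∈ₗ 𝒮 ⊎ (X ∈ᶠ 𝓕 × a < ∣ X ∩ Y ∣ × ¬ Dirty X)
          kind with ∣ X ∩ Y ∣ ≤? a
          ... | yes l = inj₁ (decidable-stable ((X ∩ Y) ∈ₗ? 𝒮) λ ni → nr (inj₁ (l , ni)))
          ... | no nl = inj₂ (j , ≰⇒> nl , λ dirty → nr (inj₂ (≰⇒> nl , dirty)))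

      -- Codes for dirty members: a + 1 points of the trace, a blocked d-set and the remaining
      -- elements. The trace point beyond a is where the factor n is saved.
      high : ℕ → List (Subset n)
      high d = concatMap (λ A → concatMap (λ D → map ((A ∪ D) ∪_) (sizedBelow n (k ∸ a ∸ d))) (𝒟 d)) (subsets Y)

      -- A single blocked d-set next to a trace of size a′ ≤ a would leave too many choices. Each
      -- further disjoint one saves a factor n, and a - a′ + 2 of them in all beat n^(k-a-d) by one
      -- factor. The guard keeps the subtraction from k exact.
      lowCodes : ℕ → ℕ → List (Subset n)
      lowCodes d a′ with d * (2 + a ∸ a′) + a′ ≤? k
      ... | no _ = []
      ... | yes _ = concatMap (λ A → concatMap (λ Z → map ((A ∪ Z) ∪_) (sized n (k ∸ (a′ + d * (2 + a ∸ a′)))))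
                      (powers (2 + a ∸ a′) (𝒟 d))) (subsets Y)

      ∣subsetsY∣ : length (subsets Y) ≤ 2 ^ B
      ∣subsetsY∣ = ≤-trans (≤-reflexive (length-subsets Y)) (^-monoʳ-≤ 2 ∣Y∣≤B)

      length-high : ∀ d → length (high d) * n ≤ 2 ^ B * (δ d * n ^ (k ∸ a ∸ d))
      length-high d = begin
        length (high d) * n
          ≤⟨ *-monoˡ-≤ n (length-concatMap≤ _ (subsets Y) λ {A} _ → length-concatMap≤ _ (𝒟 d) λ {D} _ →
               ≤-reflexive (List.length-map ((A ∪ D) ∪_) (sizedBelow n (k ∸ a ∸ d)))) ⟩
        length (subsets Y) * (δ d * l) * n
          ≡⟨ trans (*-assoc (length (subsets Y)) _ n) (cong (length (subsets Y) *_) (*-assoc (δ d) l n)) ⟩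
        length (subsets Y) * (δ d * (l * n))
          ≤⟨ *-mono-≤ ∣subsetsY∣ (*-monoʳ-≤ (δ d) (length-sizedBelow n (k ∸ a ∸ d))) ⟩
        2 ^ B * (δ d * n ^ (k ∸ a ∸ d)) ∎
        where
        open ≤-Reasoning
        l = length (sizedBelow n (k ∸ a ∸ d))

      -- δ^q n^(k-a'-dq+1) ≤ κ₁^(q-1) δ n^(k-a-d) with q = a - a' + 2, from q - 1 uses of δ n ≤ κ₁ n^d.
      power-bound : ∀ {d} j a′ → d ≤ c → j + a′ ≡ a → d * (2 + j) + a′ ≤ k →
                    δ d ^ (2 + j) * n ^ (k ∸ (a′ + d * (2 + j))) * n ≤ suc κ₁ ^ suc a * (δ d * n ^ (k ∸ a ∸ d))
      power-bound {d} j a′ d≤c refl l = *-cancelʳ-≤ _ _ (n ^ j) {{n^≢0 j}} (begin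
        δ′ * δ′ ^ suc j * n ^ e * n * n ^ j
          ≡⟨ solve 5 (λ x y z u v → x :* y :* z :* u :* v := x :* (y :* (u :* v)) :* z) refl δ′ (δ′ ^ suc j) (n ^ e) n (n ^ j) ⟩
        δ′ * (δ′ ^ suc j * n ^ suc j) * n ^ e
          ≡⟨ cong (λ z → δ′ * z * n ^ e) (^-distribˡ-* δ′ n (suc j)) ⟨
        δ′ * (δ′ * n) ^ suc j * n ^ e
          ≤⟨ *-monoˡ-≤ (n ^ e) (*-monoʳ-≤ δ′ (^-monoˡ-≤ (suc j) (≤-trans (δ-small d≤c) (*-monoˡ-≤ (n ^ d) (n≤1+n κ₁))))) ⟩
        δ′ * (suc κ₁ * n ^ d) ^ suc j * n ^ e
          ≡⟨ cong (λ z → δ′ * z * n ^ e) (^-distribˡ-* (suc κ₁) (n ^ d) (suc j)) ⟩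
        δ′ * (suc κ₁ ^ suc j * (n ^ d) ^ suc j) * n ^ e
          ≤⟨ *-monoˡ-≤ (n ^ e) (*-monoʳ-≤ δ′ (*-monoˡ-≤ _ (^-monoʳ-≤ (suc κ₁) (s≤s (m≤m+n j a′))))) ⟩
        δ′ * (suc κ₁ ^ suc a * (n ^ d) ^ suc j) * n ^ e
          ≡⟨ solve 4 (λ x y z u → x :* (y :* z) :* u := y :* x :* (z :* u)) refl δ′ (suc κ₁ ^ suc a) ((n ^ d) ^ suc j) (n ^ e) ⟩
        suc κ₁ ^ suc a * δ′ * ((n ^ d) ^ suc j * n ^ e)
          ≡⟨ cong (suc κ₁ ^ suc a * δ′ *_) (trans (cong (_* n ^ e) (^-*-assoc n d (suc j))) (trans (sym (^-distribˡ-+-* n (d * suc j) e))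
               (trans (cong (n ^_) exponents) (^-distribˡ-+-* n (k ∸ a ∸ d) j)))) ⟩
        suc κ₁ ^ suc a * δ′ * (n ^ (k ∸ a ∸ d) * n ^ j)
          ≡⟨ solve 4 (λ x y z u → x :* y :* (z :* u) := x :* (y :* z) :* u) refl (suc κ₁ ^ suc a) δ′ (n ^ (k ∸ a ∸ d)) (n ^ j) ⟩
        suc κ₁ ^ suc a * (δ′ * n ^ (k ∸ a ∸ d)) * n ^ j ∎)
        where
        open ≤-Reasoning
        δ′ = δ d
        e = k ∸ (a′ + d * (2 + j))
        exponents : d * suc j + e ≡ k ∸ a ∸ d + j
        exponents = +-cancelˡ-≡ (a′ + d) _ _ (begin-equality
          a′ + d + (d * suc j + e)          ≡⟨ solve 4 (λ a d j e → a :+ d :+ (d :* (con 1 :+ j) :+ e) := a :+ d :* (con 2 :+ j) :+ e) refl a′ d j e ⟩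
          a′ + d * (2 + j) + e              ≡⟨ m+[n∸m]≡n (≤-trans (≤-reflexive (+-comm a′ _)) l) ⟩
          k                                 ≡⟨ m+[n∸m]≡n (≤-trans (+-monoʳ-≤ a d≤c) a+c≤k) ⟨
          a + d + (k ∸ (a + d))             ≡⟨ cong (a + d +_) (∸-+-assoc k a d) ⟨
          j + a′ + d + (k ∸ a ∸ d)          ≡⟨ solve 4 (λ j a d m → j :+ a :+ d :+ m := a :+ d :+ (m :+ j)) refl j a′ d (k ∸ a ∸ d) ⟩
          a′ + d + (k ∸ a ∸ d + j)          ∎)

      length-lowCodes : ∀ {d a′} → d ≤ c → a′ ≤ a → length (lowCodes d a′) * n ≤ 2 ^ B * suc κ₁ ^ suc a * (δ d * n ^ (k ∸ a ∸ d))
      length-lowCodes {d} {a′} d≤c a′≤a with d * (2 + a ∸ a′) + a′ ≤? k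
      ... | no _ = z≤n
      ... | yes l = begin
        length (concatMap (λ A → concatMap (λ Z → map ((A ∪ Z) ∪_) rest) (powers q (𝒟 d))) (subsets Y)) * n
          ≤⟨ *-monoˡ-≤ n (length-concatMap≤ _ (subsets Y) λ {A} _ → length-concatMap≤ _ (powers q (𝒟 d)) λ {Z} _ →
               ≤-trans (≤-reflexive (List.length-map ((A ∪ Z) ∪_) rest)) (length-sized≤ n e)) ⟩
        length (subsets Y) * (length (powers q (𝒟 d)) * n ^ e) * n
          ≡⟨ *-assoc (length (subsets Y)) _ n ⟩
        length (subsets Y) * (length (powers q (𝒟 d)) * n ^ e * n)
          ≤⟨ *-mono-≤ ∣subsetsY∣ (*-monoˡ-≤ n (*-monoˡ-≤ (n ^ e) (length-powers≤ q (𝒟 d)))) ⟩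
        2 ^ B * (δ d ^ q * n ^ e * n)
          ≤⟨ *-monoʳ-≤ (2 ^ B) (subst (λ q → d * q + a′ ≤ k → δ d ^ q * n ^ (k ∸ (a′ + d * q)) * n ≤ suc κ₁ ^ suc a * (δ d * n ^ (k ∸ a ∸ d))) (sym q≡)
               (power-bound (a ∸ a′) a′ d≤c (m∸n+n≡m a′≤a)) l) ⟩
        2 ^ B * (suc κ₁ ^ suc a * (δ d * n ^ (k ∸ a ∸ d)))
          ≡⟨ *-assoc (2 ^ B) _ _ ⟨
        2 ^ B * suc κ₁ ^ suc a * (δ d * n ^ (k ∸ a ∸ d)) ∎
        where
        open ≤-Reasoning
        q = 2 + a ∸ a′
        e = k ∸ (a′ + d * q)
        rest = sized n e
        q≡ : 2 + a ∸ a′ ≡ 2 + (a ∸ a′)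
        q≡ = +-∸-assoc 2 a′≤a

      codes : List (Subset n)
      codes = concatMap (λ d → high d ++ concatMap (lowCodes d) (upTo (suc a))) (upTo (suc c))

      removed⊆codes : ∀ {F} → F ∈ₗ removed → F ∈ₗ codes
      removed⊆codes {F} i with ∈-filter⁻ removed? {xs = members 𝓕} i
      ... | F∈ , inj₂ (a< , dirty) with find dirty
      ... | D , D∈ , ∣D∣≤c , b with subsetOfSize (F ∩ Y) a<
      ... | A , A⊆ , ∣A∣ = ∈-concatMap⁺ {xs = upTo (suc c)} (∈-upTo⁺ (s≤s ∣D∣≤c)) (∈-++⁺ˡ
          (∈-concatMap⁺ (∈-subsets⁺ (∩ʳ F Y ∘ A⊆)) (∈-concatMap⁺ (∈-𝒟⁺ {F} D⊆ b)
            (subst (_∈ₗ map ((A ∪ D) ∪_) (sizedBelow n (k ∸ a ∸ ∣ D ∣))) (∪─ AD⊆F) (∈-map⁺ ((A ∪ D) ∪_) (∈-sizedBelow rest))))))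
        where
        D⊆ : D ⊆ F ─ Y
        D⊆ = ∈-subsets⁻ D∈
        AD⊆F : A ∪ D ⊆ F
        AD⊆F = ∪-⊆ (∩ˡ F Y ∘ A⊆) (─ˡ F Y ∘ D⊆)
        rest : suc ∣ F ─ (A ∪ D) ∣ ≡ k ∸ a ∸ ∣ D ∣
        rest = begin
          suc ∣ F ─ (A ∪ D) ∣                       ≡⟨ m+n∸m≡n (a + ∣ D ∣) _ ⟨
          a + ∣ D ∣ + suc ∣ F ─ (A ∪ D) ∣ ∸ (a + ∣ D ∣) ≡⟨ cong (_∸ (a + ∣ D ∣)) (trans (+-suc (a + ∣ D ∣) _) (trans
             (cong (_+ ∣ F ─ (A ∪ D) ∣) (sym (trans (∣∪∣-disj A D λ x p q → ─ʳ F Y (D⊆ q) (∩ʳ F Y (A⊆ p))) (cong (_+ ∣ D ∣) ∣A∣))))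
             (trans (∣─∣-⊆ F (A ∪ D) AD⊆F) (uniform F∈)))) ⟩
          k ∸ (a + ∣ D ∣)                           ≡⟨ ∸-+-assoc k a ∣ D ∣ ⟨
          k ∸ a ∸ ∣ D ∣                             ∎
          where open ≡-Reasoning
      removed⊆codes {F} i | F∈ , inj₁ (l , ni) = decidable-stable (F ∈ₗ? codes) λ no-code →
          proj₂ (low F∈ l ni) λ (d , d≤c , all) → no-code (found d d≤c all)
        where
        a′ = ∣ F ∩ Y ∣
        q = 2 + a ∸ a′
        found : ∀ d → d ≤ c → (∀ {D} → D ⊆ F ─ Y → ∣ D ∣ ≡ d → BlockedBy D) → F ∈ₗ codes
        found d d≤c all = ∈-concatMap⁺ {xs = upTo (suc c)} (∈-upTo⁺ (s≤s d≤c)) (∈-++⁺ʳ (high d)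
          (∈-concatMap⁺ {f = lowCodes d} {xs = upTo (suc a)} (∈-upTo⁺ (s≤s l)) inLow))
          where
          room : d * q + a′ ≤ k
          room = ≤-trans (+-monoˡ-≤ a′ (*-monoˡ-≤ q d≤c)) (proj₁ (low F∈ l ni))
          inLow : F ∈ₗ lowCodes d a′
          inLow with d * (2 + a ∸ a′) + a′ ≤? k
          ... | no nl = contradiction room nl
          ... | yes _ with ∈-powers q {𝒟 d} {d} (F ─ Y) (λ {D} D⊆ e → subst (λ z → D ∈ₗ 𝒟 z) e (∈-𝒟⁺ {F} D⊆ (all D⊆ e)))
                 (+-cancelˡ-≤ a′ _ _ (≤-trans (≤-reflexive (+-comm a′ _)) (≤-trans room
                   (≤-reflexive (trans (sym (uniform F∈)) (sym (∣∩∣+∣─∣ F Y)))))))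
          ... | Z , Z∈ , Z⊆ , ∣Z∣ = ∈-concatMap⁺ (∈-subsets⁺ (∩ʳ F Y)) (∈-concatMap⁺ Z∈
              (subst (_∈ₗ map (((F ∩ Y) ∪ Z) ∪_) (sized n (k ∸ (a′ + d * q)))) (∪─ sub)
                (∈-map⁺ (((F ∩ Y) ∪ Z) ∪_) (∈-sized⁺ (∣─∣≡ sub (uniform F∈)
                  (trans (∣∪∣-disj (F ∩ Y) Z λ x p p′ → ─ʳ F Y (Z⊆ p′) (∩ʳ F Y p)) (cong (a′ +_) ∣Z∣)))))))
            where
            sub : (F ∩ Y) ∪ Z ⊆ F
            sub = ∪-⊆ (∩ˡ F Y) (─ˡ F Y ∘ Z⊆)

      codes≤ : length codes * n ≤ κ₄ * length missing
      codes≤ = begin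
        length codes * n
          ≡⟨ cong (_* n) (length-concatMap part (upTo (suc c))) ⟩
        ∑ (upTo (suc c)) (length ∘ part) * n
          ≡⟨ ∑-* (upTo (suc c)) (length ∘ part) n ⟨
        ∑ (upTo (suc c)) (λ d → length (part d) * n)
          ≤⟨ ∑-≤ (upTo (suc c)) (λ i → part≤ (s≤s⁻¹ (∈-upTo⁻ i))) ⟩
        length (upTo (suc c)) * (κ₃ * (length missing * κ₀))
          ≡⟨ cong (_* (κ₃ * (length missing * κ₀))) (List.length-upTo (suc c)) ⟩
        suc c * (κ₃ * (length missing * κ₀))
          ≡⟨ solve 4 (λ x y z u → x :* (y :* (z :* u)) := x :* (u :* y) :* z) refl (suc c) κ₃ (length missing) κ₀ ⟩
        κ₄ * length missing ∎
        where
        open ≤-Reasoning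
        part : ℕ → List (Subset n)
        part d = high d ++ concatMap (lowCodes d) (upTo (suc a))
        part≤ : ∀ {d} → d ≤ c → length (part d) * n ≤ κ₃ * (length missing * κ₀)
        part≤ {d} d≤c = begin
          length (part d) * n
            ≡⟨ trans (cong (_* n) (List.length-++ (high d))) (*-distribʳ-+ n (length (high d)) _) ⟩
          length (high d) * n + length (concatMap (lowCodes d) (upTo (suc a))) * n
            ≡⟨ cong (length (high d) * n +_) (trans (cong (_* n) (length-concatMap (lowCodes d) (upTo (suc a)))) (sym (∑-* (upTo (suc a)) (length ∘ lowCodes d) n))) ⟩
          length (high d) * n + ∑ (upTo (suc a)) (λ a′ → length (lowCodes d a′) * n)
            ≤⟨ +-mono-≤ (length-high d) (∑-≤ (upTo (suc a)) λ i → length-lowCodes d≤c (s≤s⁻¹ (∈-upTo⁻ i))) ⟩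
          2 ^ B * x + length (upTo (suc a)) * (2 ^ B * suc κ₁ ^ suc a * x)
            ≡⟨ cong (2 ^ B * x +_) (trans (cong (_* (2 ^ B * suc κ₁ ^ suc a * x)) (List.length-upTo (suc a)))
                 (sym (*-assoc (suc a) (2 ^ B * suc κ₁ ^ suc a) x))) ⟩
          2 ^ B * x + suc a * (2 ^ B * suc κ₁ ^ suc a) * x
            ≡⟨ *-distribʳ-+ x (2 ^ B) _ ⟨
          κ₃ * x
            ≤⟨ *-monoʳ-≤ κ₃ (δ≤missing d≤c) ⟩
          κ₃ * (length missing * κ₀) ∎
          where x = δ d * n ^ (k ∸ a ∸ d)

      -- Removed sets are at most κ₄ / n times the missing ones, which are no more numerous than the
      -- removed ones; as n > κ₄, both vanish.
      nothingRemoved : length removed ≡ 0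
      nothingRemoved with length removed in eq
      ... | zero = refl
      ... | suc m = contradiction large′ (≤⇒≯ (*-cancelʳ-≤ n κ₄ (length removed) {{>-nonZero (≤-trans (s≤s z≤n) (≤-reflexive (sym eq)))}} (begin
        n * length removed          ≡⟨ *-comm n _ ⟩
        length removed * n          ≤⟨ *-monoˡ-≤ n (Unique-⊆⇒length≤ (Unique.filter⁺ removed? (unique 𝓕)) removed⊆codes) ⟩
        length codes * n            ≤⟨ codes≤ ⟩
        κ₄ * length missing         ≤⟨ *-monoʳ-≤ κ₄ missing≤removed ⟩
        κ₄ * length removed         ∎)))
        where open ≤-Reasoning

      length≡0 : ∀ {A : Set} {xs : List A} {x} → length xs ≤ 0 → x ∈ₗ xs → ⊥
      length≡0 {xs = x ∷ xs} () i

    traces∈𝒮 : ∀ {F} → F ∈ᶠ 𝓕 → ∣ F ∩ Y ∣ ≤ a → F ∩ Y ∈ₗ 𝒮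
    traces∈𝒮 {F} i l = decidable-stable ((F ∩ Y) ∈ₗ? 𝒮) λ ni →
      length≡0 (≤-reflexive nothingRemoved) (∈-filter⁺ removed? i (inj₁ (l , ni)))

    𝒮-saturated : ∀ {X} → ∣ X ∣ ≡ k → X ∩ Y ∈ₗ 𝒮 → X ∈ᶠ 𝓕
    𝒮-saturated {X} e i = decidable-stable (X ∈ₗ? members 𝓕) λ ni →
      length≡0 (≤-trans missing≤removed (≤-reflexive nothingRemoved)) (∈-filter⁺ missing? (∈-sized⁺ e) (i , ni))

module _ {s k c n : ℕ} (S : Setting s k c n) where

  open Setting S

  -- Given `V`, the set `A ∪ D` is filled up to size k by points outside `Y ∪ V`; its trace remains
  -- `A`, so it belongs to 𝓕.
  saturated⇒extendable : ∀ {Y A D : Subset n} {B} → ∣ Y ∣ ≤ B → A ⊆ Y → Disj D Y → ∣ A ∪ D ∣ ≤ k →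
                         B + s * k + k ≤ n → (∀ {X} → ∣ X ∣ ≡ k → X ∩ Y ≡ A → X ∈ᶠ 𝓕) → Extendable (A ∪ D)
  saturated⇒extendable {Y} {A} {D} {B} ∣Y∣≤ A⊆Y disjY ∣AD∣≤k large sat V ∣V∣≤ disjV
    with between (A ∪ D) ((A ∪ D) ∪ ∁ (Y ∪ V)) ∪ˡ ∣AD∣≤k room
    where
    room : k ≤ ∣ (A ∪ D) ∪ ∁ (Y ∪ V) ∣
    room = begin
      k                                     ≡⟨ m+n∸m≡n (B + s * k) k ⟨
      B + s * k + k ∸ (B + s * k)           ≤⟨ ∸-mono large (≤-trans (∣∪∣≤ Y V) (+-mono-≤ ∣Y∣≤ ∣V∣≤)) ⟩
      n ∸ ∣ Y ∪ V ∣                         ≡⟨ ∣∁p∣≡n∸∣p∣ (Y ∪ V) ⟨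
      ∣ ∁ (Y ∪ V) ∣                         ≤⟨ ∣q∣≤∣p∪q∣ (A ∪ D) (∁ (Y ∪ V)) ⟩
      ∣ (A ∪ D) ∪ ∁ (Y ∪ V) ∣               ∎
      where open ≤-Reasoning
  ... | X , AD⊆X , X⊆ , ∣X∣ = X , sat ∣X∣ (⊆-antisym
        (λ {x} p → ∪-elim A D (inner (∩ˡ X Y p) (∪ˡ (∩ʳ X Y p))) id (λ q → ⊥-elim (disjY x q (∩ʳ X Y p))))
        (λ p → ∩⁺ (AD⊆X (∪ˡ p)) (A⊆Y p))) , AD⊆X , λ x p q → disjV x q (inner p (∪ʳ q))
    where
    inner : ∀ {x} → x ∈ X → x ∈ Y ∪ V → x ∈ A ∪ D
    inner p q = ∪-elim (A ∪ D) (∁ (Y ∪ V)) (X⊆ p) id (λ r → contradiction q (x∈∁p⇒x∉p r))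

  traces-sunflowerFree : ∀ {P : Pred (Subset n) 0ℓ} (Y : Subset n) → Avoids s c P →
                         {𝓖 : Family n} → (∀ {X} → X ∈ᶠ 𝓖 → P (X ∩ Y)) → ¬ ContainsSunflower s (_≡ c) 𝓖
  traces-sunflowerFree Y av h (F , sf , mem , e) = let ker = sunflower⇒kernel sf in
    av (λ i → F i ∩ Y) (core F ∩ Y)
      ((λ i p → ∩⁺ (proj₁ ker i (∩ˡ (core F) Y p)) (∩ʳ (core F) Y p)) ,
       (λ {i} {j} ne p q → ∩⁺ (proj₂ ker ne (∩ˡ (F i) Y p) (∩ˡ (F j) Y q)) (∩ʳ (F i) Y p)))
      (h ∘ mem) (≤-trans (∣p∩q∣≤∣p∣ (core F) Y) (≤-reflexive e))

  kernel-∪ : ∀ {K D : Subset n} {A : Fin s → Subset n} → Kernel K A → Kernel (K ∪ D) (λ i → A i ∪ D)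
  kernel-∪ {K} {D} {A} (sub , meet) =
    (λ i → ∪-⊆ (∪ˡ ∘ sub i) ∪ʳ) ,
    λ {i} {j} ne p q → ∪-elim (A i) D p
      (λ p′ → ∪-elim (A j) D q (λ q′ → ∪ˡ (meet ne p′ q′)) ∪ʳ) ∪ʳ

  someIndex : Fin s
  someIndex = fromℕ< {0} (≤-trans (s≤s z≤n) 2≤s)

module Rooted {s k c n : ℕ} (S : Setting s k c n) (Z : Subset n) where

  open Setting S

  -- Extendability is recorded only for at most c additional elements of `H`, which is what
  -- enlarging a kernel to size c takes. `Z` is the base known so far, empty at the first stage.
  Root : Subset n → Subset n → Set
  Root G H = Disj G H × Disj H Z × G ∪ H ∈ᶠ 𝓕 × All (λ D → ∣ D ∣ ≤ c → ¬ Blocked (G ∪ D)) (subsets H)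

  root? : ∀ G H → Dec (Root G H)
  root? G H = Disj? G H ×-dec Disj? H Z ×-dec ((G ∪ H) ∈ₗ? members 𝓕) ×-dec
              All.all? (λ D → (∣ D ∣ ≤? c) →-dec ¬? (Blocked? (G ∪ D))) (subsets H)

-- Members of 𝓕 with traces of a given size a

-- Serves the first stage, with `Z` and `𝒮₀` empty and all t-sets as candidates, and every later
-- one, with `Z` the base, `𝒮₀` the traces found so far and the a-subsets of the base as candidates.
module OneLevel {s k c n : ℕ} (S : Setting s k c n) (a B b κ : ℕ)
  (c<a : c < a) (a+c≤k : a + c ≤ k) (2c≤k∸a : c + c ≤ k ∸ a)
  (Z : Subset n) (𝒮₀ : List (Subset n))
  (base-bounds : ∀ {A} → A ∈ₗ 𝒮₀ → A ⊆ Z × c < ∣ A ∣ × ∣ A ∣ < a)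
  (base-extendable : ∀ {A D} → A ∈ₗ 𝒮₀ → ∣ D ∣ ≤ c → Disj D Z → Setting.Extendable S (A ∪ D))
  (base-avoids : Avoids s c (_∈ₗ 𝒮₀))
  (cands : List (Subset n)) (cands-unique : Unique cands) (cands-size : ∀ {G} → G ∈ₗ cands → ∣ G ∣ ≡ a)
  where

  open Setting S

  r : ℕ
  r = k ∸ a

  a≤k : a ≤ k
  a≤k = ≤-trans (m≤m+n a c) a+c≤k

  open Rooted S Z public

  Admissible : List (Subset n) → Set
  Admissible xs = Unique xs × (∀ {G} → G ∈ₗ xs → G ∈ₗ cands) × Avoids s c (_∈ₗ 𝒮₀ ++ xs)

  -- A kernel of size at most c is enlarged to size c inside H ∩ H′.
  roots-admissible : ∀ {H H′} → c ≤ ∣ H ∩ H′ ∣ → ∀ {xs} → Unique xs →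
                     (∀ {G} → G ∈ₗ xs → G ∈ₗ cands × (Root G H ⊎ Root G H′)) → Admissible xs
  roots-admissible l {[]} u h = u , (λ ()) , λ A K ker mem →
    base-avoids A K ker (λ i → subst (A i ∈ₗ_) (List.++-identityʳ 𝒮₀) (mem i))
  roots-admissible {H} {H′} l {xs@(G₀ ∷ _)} u h = u , proj₁ ∘ h , avoids
    where
    avoids : Avoids s c (_∈ₗ 𝒮₀ ++ xs)
    avoids A K ker mem ∣K∣≤c with subsetOfSize (H ∩ H′) (≤-trans (m∸n≤m c ∣ K ∣) l)
    ... | D , D⊆ , ∣D∣ = noKernel (kernel-∪ S ker) (proj₁ ∘ fact)
        (trans (∣∪∣-disj K D λ x p → proj₂ (fact (someIndex S)) x (proj₁ ker (someIndex S) p))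
          (trans (cong (∣ K ∣ +_) ∣D∣) (m+[n∸m]≡n ∣K∣≤c)))
      where
      D⊆H : D ⊆ H
      D⊆H = ∩ˡ H H′ ∘ D⊆
      D⊆H′ : D ⊆ H′
      D⊆H′ = ∩ʳ H H′ ∘ D⊆
      ∣D∣≤c : ∣ D ∣ ≤ c
      ∣D∣≤c = ≤-trans (≤-reflexive ∣D∣) (m∸n≤m c ∣ K ∣)
      -- Only a root reveals that `H` or `H′` avoids `Z`; hence the separate case of an empty list.
      disjZ : Disj D Z
      disjZ x p q with proj₂ (h (here refl))
      ... | inj₁ (_ , d , _) = d x (D⊆H p) q
      ... | inj₂ (_ , d , _) = d x (D⊆H′ p) q
      root : ∀ {G H} → Root G H → D ⊆ H → Extendable (G ∪ D) × Disj G D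
      root (d , _ , _ , all) s = ¬blocked⇒extendable (All.lookup all (∈-subsets⁺ s) ∣D∣≤c) , λ x p q → d x p (s q)
      fact : ∀ i → Extendable (A i ∪ D) × Disj (A i) D
      fact i with ∈-++⁻ 𝒮₀ (mem i)
      ... | inj₁ j = base-extendable j ∣D∣≤c disjZ , λ x p q → disjZ x q (proj₁ (base-bounds j) p)
      ... | inj₂ j with proj₂ (h j)
      ... | inj₁ ρ = root ρ D⊆H
      ... | inj₂ ρ = root ρ D⊆H′

  -- To the unclean members `κ₁` adds what `C-diff` loses on at most B base points for each of at
  -- most b traces; `κ₂` is the constant of `Concentration` for this; `κ₃` allows b missing sets per
  -- exceptional `H`.
  κ₁ κ₂ κ₃ : ℕ
  κ₁ = κ + b * B
  κ₂ = κ₁ + (c + chooseConst r * (2 ^ r * κ₁))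
  κ₃ = b * κ₂

  module Rich
    (α : ℕ) (α-max : ∀ {xs} → Admissible xs → length xs ≤ α)
    (𝒞 : List (Subset n)) (𝒞-admissible : Admissible 𝒞) (∣𝒞∣ : length 𝒞 ≡ α) (α≤b : α ≤ b)
    (W : Subset n) (∣W∣≤B : ∣ W ∣ ≤ B) (⊆W : ∀ {A} → A ∈ₗ 𝒮₀ ++ 𝒞 → A ⊆ W)
    (keep : ∀ {F} → F ∈ᶠ 𝓕 → F ∩ Z ∈ₗ 𝒮₀ → F ∩ W ∈ₗ 𝒮₀)
    (unclean : List (Subset n)) (unclean-small : length unclean * n ≤ κ * n ^ r)
    (clean : ∀ {F} → F ∈ᶠ 𝓕 → F ∩ Z ∉ₗ 𝒮₀ → F ∈ₗ unclean ⊎ ∃[ G ] G ∈ₗ cands × G ⊆ F × Root G (F ─ G))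
    (large : 2 * (B + k) ≤ n)
    (large′ : chooseConst r * (c + chooseConst r * (2 ^ r * κ₁)) < n)
    where

    private
      related : Subset n → List (Subset n)
      related H = filter (λ G → root? G H) cands

      kept? : Decidable (λ F → F ∩ Z ∈ₗ 𝒮₀)
      kept? F = (F ∩ Z) ∈ₗ? 𝒮₀

      kept rest : List (Subset n)
      kept = filter kept? (members 𝓕)
      rest = filter (¬? ∘ kept?) (members 𝓕)

      rest≤ : length rest ≤ length unclean + ∑ (sized n r) (length ∘ related)
      rest≤ = begin
        length rest
          ≤⟨ Unique-⊆⇒length≤ (Unique.filter⁺ (¬? ∘ kept?) (unique 𝓕)) code ⟩
        length (unclean ++ concatMap unions (sized n r))
          ≡⟨ trans (List.length-++ unclean) (cong (length unclean +_) (length-concatMap unions (sized n r))) ⟩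
        length unclean + ∑ (sized n r) (length ∘ unions)
          ≡⟨ cong (length unclean +_) (∑-cong (sized n r) λ {H} _ → List.length-map (_∪ H) (related H)) ⟩
        length unclean + ∑ (sized n r) (length ∘ related) ∎
        where
        open ≤-Reasoning
        unions : Subset n → List (Subset n)
        unions H = map (_∪ H) (related H)
        code : ∀ {F} → F ∈ₗ rest → F ∈ₗ unclean ++ concatMap unions (sized n r)
        code {F} i with ∈-filter⁻ (¬? ∘ kept?) {xs = members 𝓕} i
        ... | F∈ , nk with clean F∈ nk
        ... | inj₁ j = ∈-++⁺ˡ j
        ... | inj₂ (G , G∈ , G⊆F , ρ) = ∈-++⁺ʳ unclean (∈-concatMap⁺ {xs = sized n r}
            (∈-sized⁺ (∣─∣≡ G⊆F (uniform F∈) (cands-size G∈)))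
            (subst (_∈ₗ unions (F ─ G)) (∪─ G⊆F) (∈-map⁺ (_∪ (F ─ G)) (∈-filter⁺ (λ G′ → root? G′ (F ─ G)) G∈ ρ))))

      -- Extremality against a competitor: the kept members together with all k-sets whose trace on
      -- `W` lies in `𝒞`. All its traces are in `𝒮₀ ++ 𝒞`, which avoids small kernels.
      rest≥ : α * ((n ∸ B) C r) ≤ length rest
      rest≥ = +-cancelʳ-≤ (length kept) _ _ (begin
        α * ((n ∸ B) C r) + length kept
          ≤⟨ +-monoˡ-≤ (length kept) slices≥ ⟩
        length (slices W k 𝒞) + length kept
          ≡⟨ List.length-++ (slices W k 𝒞) ⟨
        length (slices W k 𝒞 ++ kept)
          ≤⟨ Unique-⊆⇒length≤ (Unique.++⁺ (slices-unique W k (proj₁ 𝒞-admissible) G⊆W) (Unique.filter⁺ kept? (unique 𝓕)) slices-kept) inNew ⟩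
        size new
          ≤⟨ maximal new (λ i → proj₁ (∈-familyOf⁻ new? i)) (traces-sunflowerFree S {_∈ₗ 𝒮₀ ++ 𝒞} W (proj₂ (proj₂ 𝒞-admissible)) {new} (λ i → proj₂ (∈-familyOf⁻ new? i))) ⟩
        size 𝓕
          ≤⟨ Unique-⊆⇒length≤ (unique 𝓕) splitKept ⟩
        length (rest ++ kept)
          ≡⟨ List.length-++ rest ⟩
        length rest + length kept ∎)
        where
        open ≤-Reasoning
        new? : Decidable (λ X → ∣ X ∣ ≡ k × X ∩ W ∈ₗ 𝒮₀ ++ 𝒞)
        new? X = (∣ X ∣ ≟ k) ×-dec ((X ∩ W) ∈ₗ? (𝒮₀ ++ 𝒞))
        new : Family n
        new = familyOf new?
        𝒞-size : ∀ {G} → G ∈ₗ 𝒞 → ∣ G ∣ ≡ a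
        𝒞-size i = cands-size (proj₁ (proj₂ 𝒞-admissible) i)
        G⊆W : ∀ {G} → G ∈ₗ 𝒞 → G ⊆ W
        G⊆W i = ⊆W (∈-++⁺ʳ 𝒮₀ i)
        slices≥ : α * ((n ∸ B) C r) ≤ length (slices W k 𝒞)
        slices≥ = begin
          α * ((n ∸ B) C r)                      ≡⟨ cong (_* ((n ∸ B) C r)) ∣𝒞∣ ⟨
          length 𝒞 * ((n ∸ B) C r)               ≤⟨ ∑-≥ 𝒞 (λ i → ≤-trans (C-monoˡ-≤ r (∸-monoʳ-≤ n ∣W∣≤B)) (≤-reflexive (cong (λ z → (n ∸ ∣ W ∣) C (k ∸ z)) (sym (𝒞-size i))))) ⟩
          ∑ 𝒞 (λ G → (n ∸ ∣ W ∣) C (k ∸ ∣ G ∣))  ≡⟨ length-slices W k 𝒞 (λ i → G⊆W i , ≤-trans (≤-reflexive (𝒞-size i)) a≤k) ⟨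
          length (slices W k 𝒞)                  ∎
        slices-kept : ∀ {X} → X ∈ₗ slices W k 𝒞 × X ∈ₗ kept → ⊥
        slices-kept {X} (i , j) =
          let X∈ , tr = ∈-filter⁻ kept? {xs = members 𝓕} j
          in <⇒≢ (proj₂ (proj₂ (base-bounds (keep X∈ tr)))) (𝒞-size (proj₂ (∈-slices⁻ W {xs = 𝒞} G⊆W i)))
        inNew : ∀ {X} → X ∈ₗ slices W k 𝒞 ++ kept → X ∈ᶠ new
        inNew {X} i with ∈-++⁻ (slices W k 𝒞) i
        ... | inj₁ j = let e , tr = ∈-slices⁻ W {xs = 𝒞} G⊆W j in ∈-familyOf⁺ new? (e , ∈-++⁺ʳ 𝒮₀ tr)
        ... | inj₂ j = let X∈ , tr = ∈-filter⁻ kept? {xs = members 𝓕} j in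
          ∈-familyOf⁺ new? (uniform X∈ , ∈-++⁺ˡ (keep X∈ tr))
        splitKept : ∀ {X} → X ∈ᶠ 𝓕 → X ∈ₗ rest ++ kept
        splitKept {X} i with kept? X
        ... | yes p = ∈-++⁺ʳ rest (∈-filter⁺ kept? i p)
        ... | no np = ∈-++⁺ˡ (∈-filter⁺ (¬? ∘ kept?) i np)

      Σrel = ∑ (sized n r) (length ∘ related)
      E = α * (n C r) ∸ Σrel

      -- `rest≥` and `rest≤` give at least α C(n - B, r) pairs of a root and its `H`, up to the
      -- unclean members; `C-diff` compares this with the ideal value α C(n, r).
      E-small : E * n ≤ κ₁ * n ^ r
      E-small = begin
        (α * (n C r) ∸ Σrel) * n                    ≡⟨ *-distribʳ-∸ n (α * (n C r)) Σrel ⟩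
        α * (n C r) * n ∸ Σrel * n                  ≤⟨ m≤n+o⇒m∸n≤o (α * (n C r) * n) (Σrel * n) (begin
          α * (n C r) * n                             ≡⟨ *-assoc α _ n ⟩
          α * ((n C r) * n)                           ≤⟨ *-monoʳ-≤ α (C-diff n r B (≤-trans (≤-trans (m≤m+n B k) (m≤m+n (B + k) _)) large)) ⟩
          α * (((n ∸ B) C r) * n + B * n ^ r)         ≡⟨ solve 4 (λ x y z u → x :* (y :* z :+ u) := x :* y :* z :+ x :* u) refl α ((n ∸ B) C r) n (B * n ^ r) ⟩
          α * ((n ∸ B) C r) * n + α * (B * n ^ r)     ≤⟨ +-mono-≤ (*-monoˡ-≤ n (≤-trans rest≥ rest≤)) (*-monoˡ-≤ (B * n ^ r) α≤b) ⟩
          (length unclean + Σrel) * n + b * (B * n ^ r) ≡⟨ solve 5 (λ x y z u v → (x :+ y) :* z :+ u := y :* z :+ (x :* z :+ u)) refl (length unclean) Σrel n (b * (B * n ^ r)) 0 ⟩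
          Σrel * n + (length unclean * n + b * (B * n ^ r)) ≤⟨ +-monoʳ-≤ (Σrel * n) (+-monoˡ-≤ _ unclean-small) ⟩
          Σrel * n + (κ * n ^ r + b * (B * n ^ r))    ≡⟨ cong (Σrel * n +_) (solve 4 (λ x y z u → x :* y :+ z :* (u :* y) := (x :+ z :* u) :* y) refl κ (n ^ r) b B) ⟩
          Σrel * n + κ₁ * n ^ r                       ∎) ⟩
        κ₁ * n ^ r                                  ∎
        where open ≤-Reasoning

      module Conc = Concentration {n} c r 2c≤k∸a cands cands-unique root? α E κ₁
        (λ _ _ l u h → α-max (roots-admissible l u h))

      concentrated : ∃[ H₀ ] ∣ H₀ ∣ ≡ r × length (Conc.related H₀) ≡ α × length (Conc.exceptions H₀) * n ≤ κ₂ * n ^ r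
      concentrated = Conc.concentration (m≤n+m∸n (α * (n C r)) Σrel) E-small
        (≤-trans (*-monoʳ-≤ 2 (≤-trans (m∸n≤m k a) (m≤n+m k B))) large) large′

    -- The collection `𝒞` was an arbitrary one of maximal length, used only for comparison. `𝒢`, the
    -- roots of a single `H₀`, has the same length and is in addition tied to 𝓕.
    Core : Set
    Core = ∃[ 𝒢 ] Admissible 𝒢 × length 𝒢 ≡ α ×
           (∃[ exceptions ] length exceptions * n ≤ κ₂ * n ^ r ×
             (∀ {G H} → G ∈ₗ 𝒢 → ∣ H ∣ ≡ r → H ∉ₗ exceptions → G ∪ H ∈ᶠ 𝓕))

    rich : Core
    rich = fromHost concentrated
      where
      fromHost : (∃[ H₀ ] ∣ H₀ ∣ ≡ r × length (Conc.related H₀) ≡ α × length (Conc.exceptions H₀) * n ≤ κ₂ * n ^ r) → Core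
      fromHost (H₀ , ∣H₀∣ , len , few) = Conc.related H₀ , roots-admissible
          (≤-trans (≤-trans (m≤m+n c c) 2c≤k∸a) (≤-reflexive (trans (sym ∣H₀∣) (cong ∣_∣ (sym (∩-idem H₀))))))
          (Conc.related-unique H₀) (λ i → let j , ρ = Conc.∈-related⁻ i in j , inj₁ ρ) ,
        len , Conc.exceptions H₀ , few , λ G∈ e ni → proj₁ (proj₂ (proj₂ (Conc.unexceptional e ni G∈)))

  module Finish
    (α : ℕ) (α-max : ∀ {xs} → Admissible xs → length xs ≤ α) (α≤b : α ≤ b)
    (𝒢 : List (Subset n)) (𝒢-admissible : Admissible 𝒢) (∣𝒢∣ : length 𝒢 ≡ α)
    (exceptions : List (Subset n)) (few : length exceptions * n ≤ κ₂ * n ^ r)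
    (typical : ∀ {G H} → G ∈ₗ 𝒢 → ∣ H ∣ ≡ r → H ∉ₗ exceptions → G ∪ H ∈ᶠ 𝓕)
    (Y : Subset n) (∣Y∣≤B : ∣ Y ∣ ≤ B) (⊆Y : ∀ {A} → A ∈ₗ 𝒮₀ ++ 𝒢 → A ⊆ Y)
    (base-saturated : ∀ {X} → ∣ X ∣ ≡ k → X ∩ Y ∈ₗ 𝒮₀ → X ∈ᶠ 𝓕)
    (enlarge : ∀ {F} → F ∈ᶠ 𝓕 → ∣ F ∩ Y ∣ ≤ a → F ∩ Y ∉ₗ 𝒮₀ → c * (2 + a ∸ ∣ F ∩ Y ∣) + ∣ F ∩ Y ∣ ≤ k ×
               ∃[ A ] A ∈ₗ cands × A ⊆ F × F ∩ Y ⊆ A)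
    where

    𝒮 : List (Subset n)
    𝒮 = 𝒮₀ ++ 𝒢

    𝒢-size : ∀ {G} → G ∈ₗ 𝒢 → ∣ G ∣ ≡ a
    𝒢-size i = cands-size (proj₁ (proj₂ 𝒢-admissible) i)

    𝒮-bounds : ∀ {A} → A ∈ₗ 𝒮 → A ⊆ Y × c < ∣ A ∣ × ∣ A ∣ ≤ a
    𝒮-bounds {A} i with ∈-++⁻ 𝒮₀ i
    ... | inj₁ j = ⊆Y i , proj₁ (proj₂ (base-bounds j)) , <⇒≤ (proj₂ (proj₂ (base-bounds j)))
    ... | inj₂ j = ⊆Y i , ≤-trans c<a (≤-reflexive (sym (𝒢-size j))) , ≤-reflexive (𝒢-size j)

    open Cleanup S a B κ₃ a+c≤k Y ∣Y∣≤B 𝒮 𝒮-bounds (proj₂ (proj₂ 𝒢-admissible)) public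
      using (missing; κ₄; w; BlockedBy; blockedBy?; traces∈𝒮; 𝒮-saturated)

    missing-small : length missing * n ≤ κ₃ * n ^ r
    missing-small = begin
      length missing * n
        ≤⟨ *-monoˡ-≤ n (length≤-code (uncurry _∪_) (cartesianProduct 𝒢 exceptions) (Unique.filter⁺ m? (slice-unique ∅ ∅ k)) code) ⟩
      length (cartesianProduct 𝒢 exceptions) * n
        ≡⟨ trans (cong (_* n) (length-cartesianProduct 𝒢 exceptions)) (*-assoc (length 𝒢) _ n) ⟩
      length 𝒢 * (length exceptions * n)
        ≤⟨ *-mono-≤ (≤-trans (≤-reflexive ∣𝒢∣) α≤b) few ⟩
      b * (κ₂ * n ^ r)
        ≡⟨ *-assoc b κ₂ _ ⟨
      κ₃ * n ^ r ∎
      where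
      open ≤-Reasoning
      m? : Decidable (λ X → X ∩ Y ∈ₗ 𝒮 × X ∉ₗ members 𝓕)
      m? X = ((X ∩ Y) ∈ₗ? 𝒮) ×-dec ¬? (X ∈ₗ? members 𝓕)
      code : ∀ {X} → X ∈ₗ missing → ∃[ p ] p ∈ₗ cartesianProduct 𝒢 exceptions × X ≡ uncurry _∪_ p
      code {X} i with ∈-filter⁻ m? {xs = sized n k} i
      ... | X∈ , tr , ni with ∈-++⁻ 𝒮₀ tr
      ... | inj₁ j = contradiction (base-saturated (∈-sized⁻ X∈) j) ni
      ... | inj₂ j = (G , X ─ G) , ∈-cartesianProduct⁺ j
            (decidable-stable ((X ─ G) ∈ₗ? exceptions) λ ne →
              ni (subst (_∈ᶠ 𝓕) (∪─ (∩ˡ X Y)) (typical j (∣─∣≡ (∩ˡ X Y) (∈-sized⁻ X∈) (𝒢-size j)) ne))) ,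
            sym (∪─ (∩ˡ X Y))
        where G = X ∩ Y

    -- By maximality of α, adding the candidate `A′` to `𝒢` creates a kernel `K` of size at most c.
    -- Every `D` in `F ─ Y` of size c - |K| must then be blocked by some trace: otherwise the petals
    -- `A i ∪ D`, with `F` itself in place of `A′`, would be extendable with kernel `K ∪ D` of size
    -- c. Since |A′| > c ≥ |K|, at most one petal equals `A′`, so `K` lies in `Y`. The kernel is
    -- obtained by refutation, hence the double negation.
    low : ∀ {F} → F ∈ᶠ 𝓕 → ∣ F ∩ Y ∣ ≤ a → F ∩ Y ∉ₗ 𝒮 →
          c * (2 + a ∸ ∣ F ∩ Y ∣) + ∣ F ∩ Y ∣ ≤ k ×
          ¬ ¬ (∃[ d ] d ≤ c × (∀ {D} → D ⊆ F ─ Y → ∣ D ∣ ≡ d → BlockedBy D))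
    low {F} F∈ l ni with enlarge F∈ l (ni ∘ ∈-++⁺ˡ)
    ... | room , A′ , A′∈ , A′⊆F , tr⊆A′ = room , λ none → 1+n≰n (≤-trans (≤-reflexive (cong suc (sym ∣𝒢∣)))
            (α-max {A′ ∷ 𝒢} (uniq , inCands , avoids none)))
      where
      A′∉𝒮 : A′ ∉ₗ 𝒮
      A′∉𝒮 i = ni (subst (_∈ₗ 𝒮) (⊆-antisym (λ p → ∩⁺ (A′⊆F p) (⊆Y i p)) tr⊆A′) i)
      uniq : Unique (A′ ∷ 𝒢)
      uniq = All.tabulate (λ i eq → A′∉𝒮 (∈-++⁺ʳ 𝒮₀ (subst (_∈ₗ 𝒢) (sym eq) i))) ∷ proj₁ 𝒢-admissible
      inCands : ∀ {G} → G ∈ₗ A′ ∷ 𝒢 → G ∈ₗ cands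
      inCands (here refl) = A′∈
      inCands (there i) = proj₁ (proj₂ 𝒢-admissible) i
      avoids : ¬ (∃[ d ] d ≤ c × (∀ {D} → D ⊆ F ─ Y → ∣ D ∣ ≡ d → BlockedBy D)) → Avoids s c (_∈ₗ 𝒮₀ ++ (A′ ∷ 𝒢))
      avoids none A K ker mem ∣K∣≤c = none (c ∸ ∣ K ∣ , m∸n≤m c ∣ K ∣ , λ {D} D⊆ ∣D∣ →
          decidable-stable (blockedBy? D) (contra D⊆ ∣D∣))
        where
        kind : ∀ i → A i ≡ A′ ⊎ A i ∈ₗ 𝒮
        kind i with ∈-++⁻ 𝒮₀ (mem i)
        ... | inj₁ j = inj₂ (∈-++⁺ˡ j)
        ... | inj₂ (here e) = inj₁ e
        ... | inj₂ (there j) = inj₂ (∈-++⁺ʳ 𝒮₀ j)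
        onlyOne : ∀ {i j} → i ≢ j → A i ≡ A′ → A j ≡ A′ → ⊥
        onlyOne {i} {j} ne e f = <⇒≱ c<a (≤-trans (≤-reflexive (sym (cands-size A′∈)))
          (≤-trans (∣⊆∣ A′ K (λ {x} p → proj₂ ker ne (subst (x ∈_) (sym e) p) (subst (x ∈_) (sym f) p))) ∣K∣≤c))
        K⊆Y : K ⊆ Y
        K⊆Y p with kind i₀ | kind j₀
          where
          i₀ = someIndex S
          j₀ = proj₁ (two 2≤s i₀)
        ... | inj₂ i | _ = proj₁ (𝒮-bounds i) (proj₁ ker _ p)
        ... | inj₁ _ | inj₂ j = proj₁ (𝒮-bounds j) (proj₁ ker _ p)
        ... | inj₁ e | inj₁ f = ⊥-elim (onlyOne (proj₂ (two 2≤s (someIndex S))) e f)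
        contra : ∀ {D} → D ⊆ F ─ Y → ∣ D ∣ ≡ c ∸ ∣ K ∣ → ¬ ¬ BlockedBy D
        contra {D} D⊆ ∣D∣ nb = noKernel {K ∪ D} {E} (E-sub , E-meet) E-ext
            (trans (∣∪∣-disj K D λ x p q → ─ʳ F Y (D⊆ q) (K⊆Y p)) (trans (cong (∣ K ∣ +_) ∣D∣) (m+[n∸m]≡n ∣K∣≤c)))
          where
          E : Fin s → Subset n
          E i with kind i
          ... | inj₁ _ = F
          ... | inj₂ _ = A i ∪ D
          E-sub : ∀ i → K ∪ D ⊆ E i
          E-sub i with kind i
          ... | inj₁ e = ∪-⊆ (λ {x} p → A′⊆F (subst (x ∈_) e (proj₁ ker i p))) (─ˡ F Y ∘ D⊆)
          ... | inj₂ _ = ∪-⊆ (∪ˡ ∘ proj₁ ker i) ∪ʳ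
          -- `F ∩ A j` lies in `F ∩ Y` and so in `A′`; replacing `A′` by `F` creates no new common
          -- points.
          cross : ∀ {i j} → i ≢ j → A i ≡ A′ → A j ∈ₗ 𝒮 → ∀ {x} → x ∈ F → x ∈ A j ∪ D → x ∈ K ∪ D
          cross {i} {j} ne e m {x} p q = ∪-elim (A j) D q
            (λ q′ → ∪ˡ (proj₂ ker ne (subst (x ∈_) (sym e) (tr⊆A′ (∩⁺ p (proj₁ (𝒮-bounds m) q′)))) q′)) ∪ʳ
          E-meet : ∀ {i j} → i ≢ j → ∀ {x} → x ∈ E i → x ∈ E j → x ∈ K ∪ D
          E-meet {i} {j} ne p q with kind i | kind j
          ... | inj₁ e | inj₁ f = ⊥-elim (onlyOne ne e f)
          ... | inj₁ e | inj₂ m = cross ne e m p q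
          ... | inj₂ m | inj₁ e = cross (ne ∘ sym) e m q p
          ... | inj₂ _ | inj₂ _ = proj₂ (kernel-∪ S ker) ne p q
          E-ext : ∀ i → Extendable (E i)
          E-ext i with kind i
          ... | inj₁ _ = member⇒extendable F∈
          ... | inj₂ m = ¬blocked⇒extendable λ bl → nb (lose m bl)

-- Generating sets and roots

-- Z(D) is a cover of the blocked set D, and J is closed in F when
-- Z(D) ∩ F ⊆ J for all blocked D ⊆ J.  Closed subsets of members of 𝓕 are
-- extendable and closed under intersection; this replaces the intersection
-- structure of Füredi's theorem.
module Roots {s k c n : ℕ} (S : Setting s k c n) where

  open Setting S

  extendable⇒¬blocked : ∀ {E} → Extendable E → ¬ Blocked E
  extendable⇒¬blocked ex (V , ∣V∣≤ , disj , cover) =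
    let F , F∈ , E⊆F , avoid = ex V ∣V∣≤ disj in All.lookup cover F∈ E⊆F avoid

  coverElems : ∀ {D} → Dec (Blocked D) → List (Fin n)
  coverElems (yes (V , _)) = elems V
  coverElems (no _) = []

  forced : Subset n → List (Fin n)
  forced J = concatMap (λ D → coverElems (Blocked? D)) (subsets J)

  forced-mono : ∀ {J J′} → J ⊆ J′ → ∀ {z} → z ∈ₗ forced J → z ∈ₗ forced J′
  forced-mono {J} s i = let D , D∈ , z∈ = ∈-concatMap⁻ (subsets J) i in ∈-concatMap⁺ (∈-subsets⁺ (s ∘ ∈-subsets⁻ D∈)) z∈

  length-forced≤ : ∀ J → length (forced J) ≤ 2 ^ ∣ J ∣ * (s * k)
  length-forced≤ J = ≤-trans (length-concatMap≤ (λ D → coverElems (Blocked? D)) (subsets J) (λ {D} _ → coverElems≤ (Blocked? D)))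
    (≤-reflexive (cong (_* (s * k)) (length-subsets J)))
    where
    coverElems≤ : ∀ {D} (d : Dec (Blocked D)) → length (coverElems d) ≤ s * k
    coverElems≤ (yes (V , ∣V∣≤ , _)) = ≤-trans (≤-reflexive (length-elems V)) ∣V∣≤
    coverElems≤ (no _) = z≤n

  Closed : Subset n → Subset n → Set
  Closed F J = All (λ z → z ∈ F → z ∈ J) (forced J)

  closed? : ∀ F J → Dec (Closed F J)
  closed? F J = All.all? (λ z → (z ∈? F) →-dec (z ∈? J)) (forced J)

  -- A cover of `J` would meet `F`, as `J ⊆ F`; the common point is forced and so lies in `J`, which
  -- the cover avoids.
  closed⇒extendable : ∀ {F J} → F ∈ᶠ 𝓕 → J ⊆ F → Closed F J → Extendable J
  closed⇒extendable {F} {J} F∈ J⊆F cl = ¬blocked⇒extendable λ b → escape (Blocked? J) b λ z∈ →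
      All.lookup cl (∈-concatMap⁺ {f = λ D → coverElems (Blocked? D)} (∈-subsets⁺ {A = J} id) z∈)
    where
    escape : ∀ (d : Dec (Blocked J)) → Blocked J → (∀ {z} → z ∈ₗ coverElems d → z ∈ F → z ∈ J) → ⊥
    escape (no nb) b h = nb b
    escape (yes (V , _ , disj , cover)) b h =
      let x , x∈F , x∈V = ¬Disj⇒common F V (All.lookup cover F∈ J⊆F) in disj x x∈V (h (∈-elems⁺ x∈V) x∈F)

  closed-∩ : ∀ {F J} → Closed F J → Closed F (J ∩ F)
  closed-∩ {F} {J} cl = All.tabulate λ i z∈F → ∩⁺ (All.lookup cl (forced-mono (∩ˡ J F) i) z∈F) z∈F

  Proper : Subset n → Subset n → Subset n → Set
  Proper F Q J = Closed F J × Q ⊆ J × ¬ (F ⊆ J)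

  proper? : ∀ F Q → Dec (∃[ J ] Proper F Q J)
  proper? F Q = anySubset? λ J → closed? F J ×-dec (Q ⊆? J) ×-dec ¬? (F ⊆? J)

  Generates : Subset n → Subset n → Set
  Generates F Q = ∀ {J} → Closed F J → Q ⊆ J → F ⊆ J

  ¬proper⇒generates : ∀ {F Q} → ¬ (∃[ J ] Proper F Q J) → Generates F Q
  ¬proper⇒generates {F} {Q} np {J} cl Q⊆J = decidable-stable (F ⊆? J) (λ nf → np (J , cl , (λ {x} → Q⊆J {x}) , nf))

  generates-⊆ : ∀ {F Q Q′} → Q ⊆ Q′ → Generates F Q → Generates F Q′
  generates-⊆ s g cl Q′⊆J = g cl (Q′⊆J ∘ s)

  MinimalGenerating : Subset n → Subset n → Set
  MinimalGenerating F Q = Q ⊆ F × Generates F Q × (∀ {x} → x ∈ Q → ∃[ J ] Proper F (Q - x) J)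

  minimalGenerating : ∀ F → ∃[ Q ] MinimalGenerating F Q
  minimalGenerating F = go ∣ F ∣ F ≤-refl id (λ _ s → s)
    where
    go : ∀ m Q → ∣ Q ∣ ≤ m → Q ⊆ F → Generates F Q → ∃[ Q ] MinimalGenerating F Q
    go m Q l s g with Fin.any? (λ x → (x ∈? Q) ×-dec ¬? (proper? F (Q - x)))
    go m Q l s g | no none = Q , s , g , λ {x} x∈Q → decidable-stable (proper? F (Q - x)) λ np → none (x , x∈Q , np)
    go zero Q l s g | yes (x , x∈Q , np) = contradiction (≤-trans (x∈p⇒∣p-x∣<∣p∣ x∈Q) l) λ ()
    go (suc m) Q l s g | yes (x , x∈Q , np) = go m (Q - x) (s≤s⁻¹ (≤-trans (x∈p⇒∣p-x∣<∣p∣ x∈Q) l)) (s ∘ p─q⊆p Q ⁅ x ⁆) (¬proper⇒generates np)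

  -- Everything obtained from `J` by adjoining forced elements at most f times. The number of forced
  -- elements is bounded independently of n, so a generating set determines its member up to
  -- boundedly many choices.
  reach : ℕ → Subset n → List (Subset n)
  reach zero J = [ J ]
  reach (suc f) J = J ∷ concatMap (λ z → reach f (J ∪ ⁅ z ⁆)) (forced J)

  -- If no forced element of `F` is missing from `J`, then `J` is closed in `F` and contains the `F`
  -- it generates. Otherwise such an element is adjoined, using up one step.
  ∈-reach : ∀ f {F J} → J ⊆ F → ∣ F ∣ ≤ ∣ J ∣ + f → Generates F J → F ∈ₗ reach f J
  ∈-reach zero s l g = here (sym (⊆∧∣∣⇒≡ s (≤-trans l (≤-reflexive (+-identityʳ _)))))
  ∈-reach (suc f) {F} {J} s l g with Any.any? (λ z → (z ∈? F) ×-dec ¬? (z ∈? J)) (forced J)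
  ... | no none = here (⊆-antisym (g (All.tabulate λ {z} i z∈F → decidable-stable (z ∈? J) λ nz → none (lose i (z∈F , nz))) id) s)
  ... | yes some with find some
  ... | z , i , z∈F , z∉J = there (∈-concatMap⁺ i (∈-reach f
      (∪-⊆ s λ p → subst (_∈ F) (sym (x∈⁅y⁆⇒x≡y z p)) z∈F)
      (≤-trans l (≤-reflexive (trans (+-suc ∣ J ∣ f) (cong (_+ f) (sym grow)))))
      (generates-⊆ ∪ˡ g)))
    where
    grow : ∣ J ∪ ⁅ z ⁆ ∣ ≡ suc ∣ J ∣
    grow = trans (∣∪∣-disj J ⁅ z ⁆ λ x p q → z∉J (subst (_∈ J) (x∈⁅y⁆⇒x≡y z q) p))
             (trans (cong (∣ J ∣ +_) (∣⁅x⁆∣≡1 z)) (+-comm ∣ J ∣ 1))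

  branching : ℕ
  branching = suc (2 ^ (k + k) * (s * k))

  length-reach≤ : ∀ f J → ∣ J ∣ + f ≤ k + k → length (reach f J) ≤ branching ^ f
  length-reach≤ zero J l = ≤-refl
  length-reach≤ (suc f) J l = +-mono-≤ (m^n>0 branching f) (≤-trans
    (length-concatMap≤ (λ z → reach f (J ∪ ⁅ z ⁆)) (forced J) λ {z} _ → length-reach≤ f (J ∪ ⁅ z ⁆) (≤-trans
      (+-monoˡ-≤ f (≤-trans (∣∪∣≤ J ⁅ z ⁆) (≤-reflexive (trans (cong (∣ J ∣ +_) (∣⁅x⁆∣≡1 z)) (+-comm ∣ J ∣ 1)))))
      (≤-trans (≤-reflexive (sym (+-suc ∣ J ∣ f))) l)))
    (*-monoˡ-≤ (branching ^ f) (≤-trans (length-forced≤ J) (*-monoˡ-≤ (s * k) (^-monoʳ-≤ 2 (≤-trans (m≤m+n ∣ J ∣ (suc f)) l))))))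

  generated : ℕ → List (Subset n)
  generated q = concatMap (reach k) (sizedBelow n q)

  length-generated : ∀ {q} → q ≤ k → length (generated q) * n ≤ branching ^ k * n ^ q
  length-generated {q} q≤k = begin
    length (generated q) * n                      ≤⟨ *-monoˡ-≤ n (length-concatMap≤ (reach k) (sizedBelow n q) λ {J} i → length-reach≤ k J (+-monoˡ-≤ k (small q i q≤k))) ⟩
    length (sizedBelow n q) * branching ^ k * n   ≡⟨ solve 3 (λ x y z → x :* y :* z := y :* (x :* z)) refl (length (sizedBelow n q)) (branching ^ k) n ⟩
    branching ^ k * (length (sizedBelow n q) * n) ≤⟨ *-monoʳ-≤ (branching ^ k) (length-sizedBelow n q) ⟩
    branching ^ k * n ^ q                         ∎
    where
    open ≤-Reasoning
    small : ∀ q {J} → J ∈ₗ sizedBelow n q → q ≤ k → ∣ J ∣ ≤ k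
    small (suc q) i l = ≤-trans (≤-reflexive (∈-sized⁻ i)) (≤-trans (n≤1+n q) l)

  ∈-generated : ∀ {F Q q} → F ∈ᶠ 𝓕 → Q ⊆ F → Generates F Q → ∣ Q ∣ < q → q ≤ k → F ∈ₗ generated q
  ∈-generated {F} {Q} {suc q} F∈ s g (s≤s l) q≤k with between Q F s l (≤-trans (n≤1+n q) (≤-trans q≤k (≤-reflexive (sym (uniform F∈)))))
  ... | Q′ , Q⊆Q′ , Q′⊆F , e = ∈-concatMap⁺ {xs = sizedBelow n (suc q)} (∈-sizedBelow (cong suc e))
    (∈-reach k Q′⊆F (≤-trans (≤-reflexive (uniform F∈)) (m≤n+m k ∣ Q′ ∣)) (generates-⊆ Q⊆Q′ g))

  module Structure {F Q : Subset n} (F∈ : F ∈ᶠ 𝓕) (Q⊆F : Q ⊆ F) (gen : Generates F Q)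
    (properSets : ∀ {x} → x ∈ Q → ∃[ J ] Proper F (Q - x) J) where

    J : Fin n → Subset n
    J x with x ∈? Q
    ... | yes x∈Q = proj₁ (properSets x∈Q) ∩ F
    ... | no _ = F

    J-facts : ∀ {x} → x ∈ Q → Closed F (J x) × J x ⊆ F × (Q - x) ⊆ J x × x ∉ J x
    J-facts {x} x∈Q with x ∈? Q
    ... | no nx = contradiction x∈Q nx
    ... | yes x∈Q′ = let J′ , cl , sub , np = properSets x∈Q′ in
      closed-∩ cl , ∩ʳ J′ F , (λ p → ∩⁺ (sub p) (Q⊆F (p─q⊆p Q ⁅ x ⁆ p))) ,
      λ x∈J → np (gen cl λ {y} y∈Q → case y Fin.≟ x of λ where
        (yes refl) → ∩ˡ J′ F x∈J
        (no y≢x) → sub (x∈p∧x≢y⇒x∈p-y y∈Q y≢x))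

    P : Subset n
    P = F ─ Q

    ∣P∣+∣Q∣ : ∣ P ∣ + ∣ Q ∣ ≡ k
    ∣P∣+∣Q∣ = trans (+-comm ∣ P ∣ ∣ Q ∣) (trans (∣─∣-⊆ F Q Q⊆F) (uniform F∈))

    common? : Decidable (λ y → y ∈ P × (∀ x → x ∈ Q → y ∈ J x))
    common? y = (y ∈? P) ×-dec Fin.all? (λ x → (x ∈? Q) →-dec (y ∈? J x))

    P′ : Subset n
    P′ = ⟪ common? ⟫

    P′⊆P : P′ ⊆ P
    P′⊆P = proj₁ ∘ ∈⟪⟫⁻ common?

    P∩Q : ∀ {x} → x ∈ P → x ∉ Q
    P∩Q = ─ʳ F Q

    missed : ∀ {y} → y ∈ P → y ∉ P′ → ∃[ x ] x ∈ Q × y ∉ J x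
    missed {y} y∈P y∉P′ with Fin.¬∀⟶∃¬ n _ (λ x → (x ∈? Q) →-dec (y ∈? J x)) (λ all → y∉P′ (∈⟪⟫⁺ common? (y∈P , all)))
    ... | x , nx = x , decidable-stable (x ∈? Q) (λ x∉Q → nx λ x∈Q → contradiction x∈Q x∉Q) , λ y∈J → nx λ _ → y∈J

    -- The hypothesis makes `R ∪ P′` the intersection within `F` of the closed sets `J x` with x in
    -- `Q` outside `R`: each such `J x` omits only `x` from `Q`, and together they omit all of `P`
    -- outside `P′`.
    closed-∪ : ∀ {R} → R ⊆ Q → (∀ {y} → y ∈ P → y ∉ P′ → ∃[ x ] x ∈ Q × x ∉ R × y ∉ J x) → Closed F (R ∪ P′)
    closed-∪ {R} R⊆Q escape = All.tabulate λ {z} i z∈F → inside? z i z∈F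
      where
      within : ∀ {x} → x ∈ Q → x ∉ R → R ∪ P′ ⊆ J x
      within {x} x∈Q x∉R = ∪-⊆
        (λ {y} y∈R → proj₁ (proj₂ (proj₂ (J-facts x∈Q))) (x∈p∧x≢y⇒x∈p-y (R⊆Q y∈R) λ { refl → x∉R y∈R }))
        (λ y∈P′ → proj₂ (∈⟪⟫⁻ common? y∈P′) x x∈Q)
      inside? : ∀ z → z ∈ₗ forced (R ∪ P′) → z ∈ F → z ∈ R ∪ P′
      inside? z i z∈F with z ∈? R | z ∈? Q
      ... | yes z∈R | _ = ∪ˡ z∈R
      ... | no z∉R | yes z∈Q = contradiction (All.lookup (proj₁ (J-facts z∈Q)) (forced-mono (within z∈Q z∉R) i) z∈F)
                                 (proj₂ (proj₂ (proj₂ (J-facts z∈Q))))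
      ... | no _ | no z∉Q with z ∈? P′
      ... | yes z∈P′ = ∪ʳ z∈P′
      ... | no z∉P′ = let x , x∈Q , x∉R , z∉J = escape (─⁺ z∈F z∉Q) z∉P′ in
        contradiction (All.lookup (proj₁ (J-facts x∈Q)) (forced-mono (within x∈Q x∉R) i) z∈F) z∉J

    R∪P′⊆F : ∀ {R} → R ⊆ Q → R ∪ P′ ⊆ F
    R∪P′⊆F R⊆Q = ∪-⊆ (Q⊆F ∘ R⊆Q) (─ˡ F Q ∘ P′⊆P)

    noneOfSizeC : ∀ {R} → R ⊆ Q → (∀ {y} → y ∈ P → y ∉ P′ → ∃[ x ] x ∈ Q × x ∉ R × y ∉ J x) → ∣ R ∣ + ∣ P′ ∣ ≢ c
    noneOfSizeC {R} R⊆Q escape e = ¬extendable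
      (trans (∣∪∣-disj R P′ λ x p q → P∩Q (P′⊆P q) (R⊆Q p)) e)
      (closed⇒extendable F∈ (R∪P′⊆F R⊆Q) (closed-∪ R⊆Q escape))

    witness : Fin n → Subset n
    witness y with y ∈? P | y ∈? P′
    ... | yes y∈P | no y∉P′ = ⁅ proj₁ (missed y∈P y∉P′) ⁆
    ... | _ | _ = ∅

    ∣witness∣≤1 : ∀ y → ∣ witness y ∣ ≤ 1
    ∣witness∣≤1 y with y ∈? P | y ∈? P′
    ... | yes y∈P | no y∉P′ = ≤-reflexive (∣⁅x⁆∣≡1 (proj₁ (missed y∈P y∉P′)))
    ... | yes _ | yes _ = (∣∅∣≤ n)
    ... | no _ | _ = (∣∅∣≤ n)

    ∈-witness : ∀ {y} → y ∈ P → y ∉ P′ → ∃[ x ] x ∈ Q × x ∈ witness y × y ∉ J x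
    ∈-witness {y} y∈P y∉P′ with y ∈? P | y ∈? P′
    ... | yes p | no np = let x , x∈Q , y∉J = missed p np in x , x∈Q , x∈⁅x⁆ x , y∉J
    ... | yes _ | yes p′ = contradiction p′ y∉P′
    ... | no np | _ = contradiction y∈P np

    -- One `x` with `y ∉ J x` for every `y` of `P ─ P′`. Any `R ⊆ Q` that avoids these witnesses
    -- satisfies the hypothesis of `closed-∪`.
    reserved : Subset n
    reserved = ⋃ (map witness (elems (P ─ P′)))

    ∣reserved∣ : ∣ reserved ∣ ≤ ∣ P ∣ ∸ ∣ P′ ∣
    ∣reserved∣ = begin
      ∣ reserved ∣                                     ≤⟨ ∣⋃∣≤ (map witness (elems (P ─ P′))) (λ i → small i) ⟩
      length (map witness (elems (P ─ P′))) * 1        ≡⟨ trans (*-identityʳ _) (trans (List.length-map witness (elems (P ─ P′))) (length-elems (P ─ P′))) ⟩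
      ∣ P ─ P′ ∣                                       ≡⟨ ∣─∣≡ P′⊆P refl refl ⟩
      ∣ P ∣ ∸ ∣ P′ ∣                                   ∎
      where
      open ≤-Reasoning
      small : ∀ {A} → A ∈ₗ map witness (elems (P ─ P′)) → ∣ A ∣ ≤ 1
      small i with ∈-map⁻ witness i
      ... | y , _ , refl = ∣witness∣≤1 y

    -- Otherwise some `R` in `Q ─ reserved` with |R| + |P′| = c would make `R ∪ P′` an extendable
    -- c-set.
    noRoom : ∣ P′ ∣ ≤ c → ∣ Q ─ reserved ∣ < c ∸ ∣ P′ ∣
    noRoom l = ≰⇒> λ room → let R , R⊆ , e = subsetOfSize (Q ─ reserved) room in
      noneOfSizeC (─ˡ Q reserved ∘ R⊆)
        (λ {y} y∈P y∉P′ → let x , x∈Q , x∈w , y∉J = ∈-witness y∈P y∉P′ in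
          x , x∈Q , (λ x∈R → ─ʳ Q reserved (R⊆ x∈R) (∈⋃⁺ (∈-map⁺ witness (∈-elems⁺ (─⁺ y∈P y∉P′))) x∈w)) , y∉J)
        (trans (cong (_+ ∣ P′ ∣) e) (m∸n+n≡m l))

    ∣Q∣≤ : ∣ Q ∣ ≤ ∣ Q ─ reserved ∣ + (∣ P ∣ ∸ ∣ P′ ∣)
    ∣Q∣≤ = begin
      ∣ Q ∣                                      ≡⟨ ∣∩∣+∣─∣ Q reserved ⟨
      ∣ Q ∩ reserved ∣ + ∣ Q ─ reserved ∣        ≡⟨ +-comm ∣ Q ∩ reserved ∣ _ ⟩
      ∣ Q ─ reserved ∣ + ∣ Q ∩ reserved ∣        ≤⟨ +-monoʳ-≤ ∣ Q ─ reserved ∣ (≤-trans (∣p∩q∣≤∣q∣ Q reserved) ∣reserved∣) ⟩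
      ∣ Q ─ reserved ∣ + (∣ P ∣ ∸ ∣ P′ ∣)        ∎
      where open ≤-Reasoning

    -- With more than c elements `P′` is all of `P`; then nothing has to escape in `closed-∪`, and
    -- every set between `P` and `F` is closed.
    star : ∣ P ∣ ≤ suc c → c < ∣ P′ ∣ → ∣ P ∣ ≡ suc c × (∀ {E} → P ⊆ E → E ⊆ F → Extendable E)
    star ∣P∣≤ c<P′ = ≤-antisym ∣P∣≤ (≤-trans c<P′ (∣⊆∣ P′ P P′⊆P)) , λ {E} P⊆E E⊆F →
        subst Extendable (eq E P⊆E E⊆F) (closed⇒extendable F∈ (R∪P′⊆F {E ∩ Q} (∩ʳ E Q)) (closed-∪ {E ∩ Q} (∩ʳ E Q)
          (λ {y} y∈P y∉P′ → contradiction (subst (y ∈_) (sym P′≡P) y∈P) y∉P′)))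
      where
      P′≡P : P′ ≡ P
      P′≡P = ⊆∧∣∣⇒≡ P′⊆P (≤-trans ∣P∣≤ c<P′)
      eq : ∀ E → P ⊆ E → E ⊆ F → (E ∩ Q) ∪ P′ ≡ E
      eq E P⊆E E⊆F = ⊆-antisym (∪-⊆ (∩ˡ E Q) (P⊆E ∘ P′⊆P)) λ {x} x∈E → case x ∈? Q of λ where
        (yes x∈Q) → ∪ˡ (∩⁺ x∈E x∈Q)
        (no x∉Q) → ∪ʳ (subst (x ∈_) (sym P′≡P) (─⁺ (E⊆F x∈E) x∉Q))

    module Pair (c≡1 : c ≡ 1) (k≡4 : k ≡ 4) (∣Q∣≡2 : ∣ Q ∣ ≡ 2) (∣P′∣≡0 : ∣ P′ ∣ ≡ 0)
      {x x′ : Fin n} (x∈Q : x ∈ Q) (x′∈Q : x′ ∈ Q) (x≢x′ : x ≢ x′) where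

      pair≡Q : ⁅ x ⁆ ∪ ⁅ x′ ⁆ ≡ Q
      pair≡Q = ⊆∧∣∣⇒≡
        (∪-⊆ (λ p → subst (_∈ Q) (sym (x∈⁅y⁆⇒x≡y x p)) x∈Q) (λ p → subst (_∈ Q) (sym (x∈⁅y⁆⇒x≡y x′ p)) x′∈Q))
        (≤-reflexive (trans ∣Q∣≡2 (sym (trans
          (∣∪∣-disj ⁅ x ⁆ ⁅ x′ ⁆ λ z p q → x≢x′ (trans (sym (x∈⁅y⁆⇒x≡y x p)) (x∈⁅y⁆⇒x≡y x′ q)))
          (cong₂ _+_ (∣⁅x⁆∣≡1 x) (∣⁅x⁆∣≡1 x′))))))

      only : ∀ {y} → y ∈ Q → y ≡ x ⊎ y ≡ x′
      only {y} y∈Q = ∪-elim ⁅ x ⁆ ⁅ x′ ⁆ (subst (y ∈_) (sym pair≡Q) y∈Q) (inj₁ ∘ x∈⁅y⁆⇒x≡y x) (inj₂ ∘ x∈⁅y⁆⇒x≡y x′)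

      x∉Jx : ∀ {z} → z ∈ Q → z ∉ J z
      x∉Jx z∈Q = proj₂ (proj₂ (proj₂ (J-facts z∈Q)))

      Q-⊆J : ∀ {z y} → z ∈ Q → y ∈ Q → y ≢ z → y ∈ J z
      Q-⊆J z∈Q y∈Q ne = proj₁ (proj₂ (proj₂ (J-facts z∈Q))) (x∈p∧x≢y⇒x∈p-y y∈Q ne)

      J⊆F : ∀ {z} → z ∈ Q → J z ⊆ F
      J⊆F z∈Q = proj₁ (proj₂ (J-facts z∈Q))

      P′-empty : ∀ {y} → y ∉ P′
      P′-empty y∈ = contradiction (≤-trans (x∈p⇒∣p-x∣<∣p∣ y∈) (≤-reflexive ∣P′∣≡0)) λ ()

      disjoint : Disj (J x) (J x′)
      disjoint y p q = split (y ∈? Q)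
        where
        both : ∀ {z} → z ≡ x ⊎ z ≡ x′ → y ∈ J z
        both (inj₁ e) = subst (λ z → y ∈ J z) (sym e) p
        both (inj₂ e) = subst (λ z → y ∈ J z) (sym e) q
        split : Dec (y ∈ Q) → ⊥
        split (yes y∈Q) = x∉Jx y∈Q (both (only y∈Q))
        split (no y∉Q) = P′-empty (∈⟪⟫⁺ common? (─⁺ (J⊆F x∈Q p) y∉Q , λ z z∈Q → both (only z∈Q)))

      ext : ∀ {z} → z ∈ Q → Extendable (J z)
      ext z∈Q = closed⇒extendable F∈ (J⊆F z∈Q) (proj₁ (J-facts z∈Q))

      ≥2 : ∀ {z y} → z ∈ Q → y ∈ J z → 2 ≤ ∣ J z ∣
      ≥2 {z} z∈Q y∈J = ≤∧≢⇒< (≤-trans (s≤s z≤n) (x∈p⇒∣p-x∣<∣p∣ y∈J)) λ e → ¬extendable (trans (sym e) (sym c≡1)) (ext z∈Q)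

      ≥x : 2 ≤ ∣ J x ∣
      ≥x = ≥2 x∈Q (Q-⊆J x∈Q x′∈Q (x≢x′ ∘ sym))

      ≥x′ : 2 ≤ ∣ J x′ ∣
      ≥x′ = ≥2 x′∈Q (Q-⊆J x′∈Q x∈Q x≢x′)

      J∪J⊆F : J x ∪ J x′ ⊆ F
      J∪J⊆F = ∪-⊆ (J⊆F x∈Q) (J⊆F x′∈Q)

      total : ∣ J x ∣ + ∣ J x′ ∣ ≤ 4
      total = ≤-trans (≤-reflexive (sym (∣∪∣-disj (J x) (J x′) disjoint)))
        (≤-trans (∣⊆∣ (J x ∪ J x′) F J∪J⊆F) (≤-reflexive (trans (uniform F∈) k≡4)))

      =x : ∣ J x ∣ ≡ 2
      =x = ≤-antisym (+-cancelʳ-≤ 2 _ _ (≤-trans (+-monoʳ-≤ ∣ J x ∣ ≥x′) total)) ≥x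

      =x′ : ∣ J x′ ∣ ≡ 2
      =x′ = ≤-antisym (+-cancelˡ-≤ 2 _ _ (≤-trans (+-monoˡ-≤ ∣ J x′ ∣ ≥x) total)) ≥x′

      -- `J x` and `J x′` are disjoint, since `P′` is empty and neither contains its own index. Each
      -- contains the other generator, and a single element would be an extendable c-set. So both
      -- have two elements and together fill the four of `F`.
      splitting : ∃[ A ] ∃[ A′ ] Extendable A × Extendable A′ × ∣ A ∣ ≡ 2 × ∣ A′ ∣ ≡ 2 × Disj A A′ × A ∪ A′ ≡ F
      splitting = J x , J x′ , ext x∈Q , ext x′∈Q , =x , =x′ , disjoint ,
        ⊆∧∣∣⇒≡ J∪J⊆F (≤-reflexive (trans (uniform F∈) (trans k≡4 (sym (trans (∣∪∣-disj (J x) (J x′) disjoint) (cong₂ _+_ =x =x′))))))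

    -- For c = 1, `noRoom` leaves `P′` empty and all of `Q` reserved, so |Q| ≤ |P| ≤ 2; as |P| + |Q|
    -- = 4, both are 2.
    split : c ≡ 1 → k ≡ 4 → ∣ P ∣ ≤ 2 → ∣ P′ ∣ ≤ 1 →
            ∃[ A ] ∃[ A′ ] Extendable A × Extendable A′ × ∣ A ∣ ≡ 2 × ∣ A′ ∣ ≡ 2 × Disj A A′ × A ∪ A′ ≡ F
    split c≡1 k≡4 ∣P∣≤2 ∣P′∣≤1 =
      let x , x∈Q = element Q (≤-trans (s≤s z≤n) (≤-reflexive (sym ∣Q∣≡2)))
          x′ , x′∈ = element (Q - x) (≤-reflexive (sym (∣─∣≡ {X = Q} {⁅ x ⁆}
                       (λ p → subst (_∈ Q) (sym (x∈⁅y⁆⇒x≡y x p)) x∈Q) ∣Q∣≡2 (∣⁅x⁆∣≡1 x))))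
      in Pair.splitting c≡1 k≡4 ∣Q∣≡2 (proj₂ full-reserve) x∈Q (─ˡ Q ⁅ x ⁆ x′∈)
           (λ e → ─ʳ Q ⁅ x ⁆ x′∈ (subst (_∈ ⁅ x ⁆) e (x∈⁅x⁆ x)))
      where
      full-reserve : ∣ Q ─ reserved ∣ ≡ 0 × ∣ P′ ∣ ≡ 0
      full-reserve = zeros (subst (λ z → ∣ Q ─ reserved ∣ < z ∸ ∣ P′ ∣) c≡1 (noRoom (≤-trans ∣P′∣≤1 (≤-reflexive (sym c≡1)))))
        where
        zeros : ∀ {q p} → q < 1 ∸ p → q ≡ 0 × p ≡ 0
        zeros {zero} {zero} _ = refl , refl
        zeros {suc _} {zero} (s≤s ())
        zeros {_} {suc zero} ()
        zeros {_} {suc (suc _)} ()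
      ∣Q∣≤∣P∣ : ∣ Q ∣ ≤ ∣ P ∣
      ∣Q∣≤∣P∣ = ≤-trans ∣Q∣≤ (≤-trans (≤-reflexive (cong (_+ (∣ P ∣ ∸ ∣ P′ ∣)) (proj₁ full-reserve))) (m∸n≤m ∣ P ∣ ∣ P′ ∣))
      ∣Q∣≡2 : ∣ Q ∣ ≡ 2
      ∣Q∣≡2 = ≤-antisym (≤-trans ∣Q∣≤∣P∣ ∣P∣≤2)
        (+-cancelˡ-≤ 2 2 ∣ Q ∣ (≤-trans (≤-reflexive (trans (sym k≡4) (sym ∣P∣+∣Q∣))) (+-monoˡ-≤ ∣ Q ∣ ∣P∣≤2)))
      element : ∀ (A : Subset n) → 1 ≤ ∣ A ∣ → ∃[ x ] x ∈ A
      element A l with nonempty? A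
      ... | yes ne = ne
      ... | no ¬ne = contradiction (≤-trans l (≤-reflexive (trans (cong ∣_∣ (Empty-unique ¬ne)) (∣⊥∣≡0 n)))) λ ()

  Star : Subset n → Set
  Star F = ∃[ P ] ∣ P ∣ ≡ suc c × P ⊆ F × (∀ {E} → P ⊆ E → E ⊆ F → Extendable E)

  Split : Subset n → Set
  Split F = ∃[ A ] ∃[ A′ ] Extendable A × Extendable A′ × ∣ A ∣ ≡ 2 × ∣ A′ ∣ ≡ 2 × Disj A A′ × A ∪ A′ ≡ F

  -- With |P| ≤ t and |P′| ≤ c, `noRoom` gives k < c + 2t, and is absurd outright for c = 0. Either
  -- alternative leaves only stars among the members without small generating sets.
  Roomy : Set
  Roomy = c ≡ 0 ⊎ c + (suc c + suc c) ≤ k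

  classify : Roomy ⊎ (c ≡ 1 × k ≡ 4) → ∀ {F} → F ∈ᶠ 𝓕 →
             F ∈ₗ generated (k ∸ suc c) ⊎ Star F ⊎ (Split F × c ≡ 1 × k ≡ 4)
  classify roomy {F} F∈ = let Q , Q⊆F , gen , proper = minimalGenerating F in
    analyse Q⊆F gen proper (∣ Q ∣ <? k ∸ suc c) roomy
    where
    analyse : ∀ {Q} → Q ⊆ F → Generates F Q → (∀ {x} → x ∈ Q → ∃[ J ] Proper F (Q - x) J) →
              Dec (∣ Q ∣ < k ∸ suc c) → Roomy ⊎ (c ≡ 1 × k ≡ 4) →
              F ∈ₗ generated (k ∸ suc c) ⊎ Star F ⊎ (Split F × c ≡ 1 × k ≡ 4)
    analyse Q⊆F gen proper (yes l) _ = inj₁ (∈-generated F∈ Q⊆F gen l (m∸n≤m k (suc c)))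
    analyse {Q} Q⊆F gen proper (no nl) roomy = inj₂ (decide (suc c ≤? ∣ P′ ∣) roomy)
      where
      open Structure F∈ Q⊆F gen proper
      ∣P∣≤ : ∣ P ∣ ≤ suc c
      ∣P∣≤ = +-cancelʳ-≤ ∣ Q ∣ _ _ (≤-trans (≤-reflexive ∣P∣+∣Q∣) (≤-trans (m≤n+m∸n k (suc c)) (+-monoʳ-≤ (suc c) (≮⇒≥ nl))))
      decide : Dec (suc c ≤ ∣ P′ ∣) → Roomy ⊎ (c ≡ 1 × k ≡ 4) → Star F ⊎ (Split F × c ≡ 1 × k ≡ 4)
      decide (yes l) _ = let e , ext = star ∣P∣≤ l in inj₁ (P , e , ─ˡ F Q , ext)
      decide (no nl) (inj₂ (c≡1 , k≡4)) = inj₂ (split c≡1 k≡4 (≤-trans ∣P∣≤ (≤-reflexive (cong suc c≡1)))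
        (≤-trans (s≤s⁻¹ (≰⇒> nl)) (≤-reflexive c≡1)) , c≡1 , k≡4)
      decide (no nl) (inj₁ (inj₁ c≡0)) = contradiction
        (≤-trans (noRoom (s≤s⁻¹ (≰⇒> nl))) (≤-trans (m∸n≤m c ∣ P′ ∣) (≤-reflexive c≡0))) λ ()
      decide (no nl) (inj₁ (inj₂ big)) = ⊥-elim $ <⇒≱ (noRoom (s≤s⁻¹ (≰⇒> nl))) (≤-trans (m∸n≤m c ∣ P′ ∣)
        (+-cancelʳ-≤ (suc c + suc c) _ _ (begin
          c + (suc c + suc c)                                 ≤⟨ big ⟩
          k                                                   ≡⟨ ∣P∣+∣Q∣ ⟨
          ∣ P ∣ + ∣ Q ∣                                       ≤⟨ +-monoʳ-≤ ∣ P ∣ ∣Q∣≤ ⟩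
          ∣ P ∣ + (∣ Q ─ reserved ∣ + (∣ P ∣ ∸ ∣ P′ ∣))       ≤⟨ +-mono-≤ ∣P∣≤ (+-monoʳ-≤ ∣ Q ─ reserved ∣ (≤-trans (m∸n≤m ∣ P ∣ ∣ P′ ∣) ∣P∣≤)) ⟩
          suc c + (∣ Q ─ reserved ∣ + suc c)                  ≡⟨ solve 2 (λ x y → x :+ (y :+ x) := y :+ (x :+ x)) refl (suc c) ∣ Q ─ reserved ∣ ⟩
          ∣ Q ─ reserved ∣ + (suc c + suc c)                  ∎)))
        where open ≤-Reasoning

-- The exceptional parameters s = t = 2, k = 4

length≤1 : ∀ {A : Set} {xs : List A} → Unique xs → (∀ {x y} → x ∈ₗ xs → y ∈ₗ xs → x ≡ y) → length xs ≤ 1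
length≤1 {xs = []} _ _ = z≤n
length≤1 {xs = x ∷ []} _ _ = s≤s z≤n
length≤1 {xs = x ∷ y ∷ xs} ((ne ∷ _) ∷ _) h = contradiction (h (here refl) (there (here refl))) ne

-- For these parameters 𝓕 may also contain unions of two disjoint extendable
-- pairs.  The extendable pairs form a matching, so two of the pairs crossing
-- such a union are lost as complements of roots, and no two unions lose the
-- same pair; hence there are O(n) of them.
module Exceptional {k n : ℕ} (S : Setting 2 k 1 n) (k≡4 : k ≡ 4) where

  open Setting S

  open Roots S
  open Rooted S ∅

  meetInOne : ∀ {E E′} → Extendable E → Extendable E′ → ∣ E ∩ E′ ∣ ≢ 1
  meetInOne {E} {E′} ex ex′ e = noKernel {E ∩ E′} {pair} (sub , meet) ext e
    where
    pair : Fin 2 → Subset n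
    pair zero = E
    pair (suc _) = E′
    sub : ∀ i → E ∩ E′ ⊆ pair i
    sub zero = ∩ˡ E E′
    sub (suc _) = ∩ʳ E E′
    meet : ∀ {i j} → i ≢ j → ∀ {x} → x ∈ pair i → x ∈ pair j → x ∈ E ∩ E′
    meet {zero} {zero} ne = contradiction refl ne
    meet {zero} {suc _} _ p q = ∩⁺ p q
    meet {suc _} {zero} _ p q = ∩⁺ q p
    meet {suc zero} {suc zero} ne = contradiction refl ne
    ext : ∀ i → Extendable (pair i)
    ext zero = ex
    ext (suc _) = ex′

  absorb : ∀ {A E x} → Extendable A → ∣ A ∣ ≡ 2 → Extendable E → x ∈ A → x ∈ E → A ⊆ E
  absorb {A} {E} {x} exA ∣A∣ exE x∈A x∈E = decidable-stable (A ⊆? E) λ ns → meetInOne exA exE (≤-antisym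
      (s≤s⁻¹ (≤-trans (≤∧≢⇒< (≤-trans (∣p∩q∣≤∣p∣ A E) (≤-reflexive ∣A∣)) (λ e → ns λ p →
        ∩ʳ A E (subst (_ ∈_) (sym (⊆∧∣∣⇒≡ (∩ˡ A E) (≤-reflexive (trans ∣A∣ (sym e))))) p))) ≤-refl))
      (≤-trans (s≤s z≤n) (x∈p⇒∣p-x∣<∣p∣ (∩⁺ x∈A x∈E))))

  pairs : List (Subset n)
  pairs = sized n 2

  related : Subset n → List (Subset n)
  related H = filter (λ G → root? G H) pairs

  ∈-related⁻ : ∀ {G H} → G ∈ₗ related H → ∣ G ∣ ≡ 2 × Root G H
  ∈-related⁻ {G} {H} i = let j , ρ = ∈-filter⁻ (λ G → root? G H) {xs = pairs} i in ∈-sized⁻ j , ρ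

  -- Two distinct roots of `H` share at most one point. Adding, if they are disjoint, the same point
  -- of `H` to both gives extendable sets that meet in exactly one element.
  related-unique : ∀ {G G′ H} → ∣ H ∣ ≡ 2 → G ∈ₗ related H → G′ ∈ₗ related H → G ≡ G′
  related-unique {G} {G′} {H} ∣H∣ i j = decidable-stable (G ≟ˢ G′) λ ne →
    let ∣G∣ , disj , _ , _ , all = ∈-related⁻ i
        ∣G′∣ , disj′ , _ , _ , all′ = ∈-related⁻ j
        K = G ∩ G′
        ∣K∣≤1 : ∣ K ∣ ≤ 1
        ∣K∣≤1 = s≤s⁻¹ (≤∧≢⇒< (≤-trans (∣p∩q∣≤∣p∣ G G′) (≤-reflexive ∣G∣)) λ e →
          ne (trans (sym (⊆∧∣∣⇒≡ {A = K} (∩ˡ G G′) (≤-reflexive (trans ∣G∣ (sym e)))))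
                    (⊆∧∣∣⇒≡ {A = K} (∩ʳ G G′) (≤-reflexive (trans ∣G′∣ (sym e))))))
        D , D⊆H , ∣D∣ = subsetOfSize H (≤-trans (m∸n≤m 1 ∣ K ∣) (≤-trans (s≤s z≤n) (≤-reflexive (sym ∣H∣))))
        ∣D∣≤1 = ≤-trans (≤-reflexive ∣D∣) (m∸n≤m 1 ∣ K ∣)
        meet : (G ∪ D) ∩ (G′ ∪ D) ≡ K ∪ D
        meet = ⊆-antisym
          (λ p → ∪-elim G D (∩ˡ (G ∪ D) (G′ ∪ D) p)
            (λ q → ∪-elim G′ D (∩ʳ (G ∪ D) (G′ ∪ D) p) (λ q′ → ∪ˡ (∩⁺ q q′)) ∪ʳ) ∪ʳ)
          (∪-⊆ (λ p → ∩⁺ (∪ˡ (∩ˡ G G′ p)) (∪ˡ (∩ʳ G G′ p))) (λ p → ∩⁺ (∪ʳ p) (∪ʳ p)))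
    in meetInOne (¬blocked⇒extendable (All.lookup all (∈-subsets⁺ D⊆H) ∣D∣≤1))
                 (¬blocked⇒extendable (All.lookup all′ (∈-subsets⁺ D⊆H) ∣D∣≤1))
                 (trans (cong ∣_∣ meet) (trans (∣∪∣-disj K D λ x p q → disj x (∩ˡ G G′ p) (D⊆H q))
                   (trans (cong (∣ K ∣ +_) ∣D∣) (m+[n∸m]≡n ∣K∣≤1))))

  Clean : Subset n → Set
  Clean F = Any (λ G → (G ⊆ F) × Root G (F ─ G)) pairs

  clean? : Decidable Clean
  clean? F = Any.any? (λ G → (G ⊆? F) ×-dec root? G (F ─ G)) pairs

  star⇒clean : ∀ {F} → F ∈ᶠ 𝓕 → Star F → Clean F
  star⇒clean {F} F∈ (P , ∣P∣ , P⊆F , ext) = lose (∈-sized⁺ ∣P∣) ((λ {x} → P⊆F {x}) ,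
    (λ x p q → ─ʳ F P q p) , (λ x _ p → ∉⊥ p) , subst (_∈ᶠ 𝓕) (sym (∪─ P⊆F)) F∈ ,
    All.tabulate λ {D} i _ → extendable⇒¬blocked (ext ∪ˡ (∪-⊆ P⊆F (─ˡ F P ∘ ∈-subsets⁻ i))))

  unsplit? : Decidable (λ F → ¬ Clean F × F ∉ₗ generated (k ∸ 2))
  unsplit? F = ¬? (clean? F) ×-dec ¬? (F ∈ₗ? generated (k ∸ 2))

  splits : List (Subset n)
  splits = filter unsplit? (members 𝓕)

  ∈-splits⁻ : ∀ {F} → F ∈ₗ splits → F ∈ᶠ 𝓕 × Split F
  ∈-splits⁻ {F} i = let F∈ , nc , ng = ∈-filter⁻ unsplit? {xs = members 𝓕} i in F∈ , excluded F∈ nc ng (classify (inj₂ (refl , k≡4)) F∈)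
    where
    excluded : F ∈ᶠ 𝓕 → ¬ Clean F → F ∉ₗ generated (k ∸ 2) → F ∈ₗ generated (k ∸ 2) ⊎ Star F ⊎ (Split F × 1 ≡ 1 × k ≡ 4) → Split F
    excluded F∈ nc ng (inj₁ g) = contradiction g ng
    excluded F∈ nc ng (inj₂ (inj₁ st)) = contradiction (star⇒clean F∈ st) nc
    excluded F∈ nc ng (inj₂ (inj₂ (sp , _))) = sp

  lost? : Decidable (λ H → Blocked H × Any (λ F → H ⊆ F) splits)
  lost? H = Blocked? H ×-dec Any.any? (λ F → H ⊆? F) splits

  lost : List (Subset n)
  lost = filter lost? pairs

  crossing : ∀ {H A A′} → ∣ H ∣ ≡ 2 → Blocked H → H ⊆ A ∪ A′ → Extendable A′ → ∣ A′ ∣ ≡ 2 → ∃[ x ] x ∈ H × x ∈ A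
  crossing {H} {A} {A′} ∣H∣ bl H⊆ exA′ ∣A′∣ = ¬Disj⇒common H A λ disj →
    extendable⇒¬blocked exA′ (subst Blocked (⊆∧∣∣⇒≡ (λ {x} p → ∪-elim A A′ (H⊆ p) (λ q → ⊥-elim (disj x p q)) id)
      (≤-reflexive (trans ∣A′∣ (sym ∣H∣)))) bl)

  crosses : ∀ {H F} → ∣ H ∣ ≡ 2 → Blocked H → H ⊆ F → (sp : Split F) →
            (∃[ x ] x ∈ H × x ∈ proj₁ sp) × (∃[ x ] x ∈ H × x ∈ proj₁ (proj₂ sp))
  crosses {H} {F} ∣H∣ bl H⊆F (A , A′ , exA , exA′ , ∣A∣ , ∣A′∣ , disj , eq) =
    crossing ∣H∣ bl (λ {x} p → subst (x ∈_) (sym eq) (H⊆F p)) exA′ ∣A′∣ ,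
    crossing ∣H∣ bl (λ {x} p → ∪-elim A A′ (subst (x ∈_) (sym eq) (H⊆F p)) ∪ʳ ∪ˡ) exA ∣A∣

  -- A blocked pair in a split member contains a point of each half. A member containing the pair
  -- absorbs both extendable halves, hence equals their union.
  determined : ∀ {H F F′} → ∣ H ∣ ≡ 2 → Blocked H → H ⊆ F → F ∈ᶠ 𝓕 → Split F → H ⊆ F′ → F′ ∈ᶠ 𝓕 → F ≡ F′
  determined {H} {F} {F′} ∣H∣ bl H⊆F F∈ sp@(A , A′ , exA , exA′ , ∣A∣ , ∣A′∣ , disj , eq) H⊆F′ F′∈ =
    let (x , x∈H , x∈A) , (y , y∈H , y∈A′) = crosses ∣H∣ bl (λ {z} → H⊆F {z}) sp
        ex = member⇒extendable F′∈
    in ⊆∧∣∣⇒≡ (λ {z} z∈F → ∪-elim A A′ (subst (z ∈_) (sym eq) z∈F)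
                 (absorb exA ∣A∣ ex x∈A (H⊆F′ x∈H)) (absorb exA′ ∣A′∣ ex y∈A′ (H⊆F′ y∈H)))
               (≤-reflexive (trans (uniform F′∈) (sym (uniform F∈))))

  module Crossing {F A A′ : Subset n} (F∈splits : F ∈ₗ splits) (F∈ : F ∈ᶠ 𝓕) (exA : Extendable A) (∣A∣ : ∣ A ∣ ≡ 2)
    (disj : Disj A A′) (eq : A ∪ A′ ≡ F) {x y : Fin n} (x∈A : x ∈ A) (y∈A′ : y ∈ A′) where

    A⊆F : A ⊆ F
    A⊆F {z} p = subst (z ∈_) eq (∪ˡ p)
    A′⊆F : A′ ⊆ F
    A′⊆F {z} p = subst (z ∈_) eq (∪ʳ p)
    H₁ = ⁅ x ⁆ ∪ ⁅ y ⁆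
    H₂ = F ─ H₁
    single : ∀ {u z : Fin n} {B : Subset n} → z ∈ B → u ∈ ⁅ z ⁆ → u ∈ B
    single {u} {z} {B} z∈ p = subst (_∈ B) (sym (x∈⁅y⁆⇒x≡y z p)) z∈
    H₁⊆F : H₁ ⊆ F
    H₁⊆F = ∪-⊆ (single (A⊆F x∈A)) (single (A′⊆F y∈A′))
    ∣H₁∣ : ∣ H₁ ∣ ≡ 2
    ∣H₁∣ = trans (∣∪∣-disj ⁅ x ⁆ ⁅ y ⁆ λ z p q → disj z (single x∈A p) (single y∈A′ q)) (cong₂ _+_ (∣⁅x⁆∣≡1 x) (∣⁅x⁆∣≡1 y))
    ∣H₂∣ : ∣ H₂ ∣ ≡ 2
    ∣H₂∣ = ∣─∣≡ H₁⊆F (trans (uniform F∈) k≡4) ∣H₁∣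
    H₁≢H₂ : H₁ ≢ H₂
    H₁≢H₂ e = ─ʳ F H₁ (subst (x ∈_) e x∈H₁) x∈H₁
      where
      x∈H₁ : x ∈ H₁
      x∈H₁ = ∪ˡ (x∈⁅x⁆ x)
    H₁∩A : ∣ A ∩ H₁ ∣ ≡ 1
    H₁∩A = trans (cong ∣_∣ (⊆-antisym {i = A ∩ H₁} {⁅ x ⁆}
      (λ {z} p → ∪-elim ⁅ x ⁆ ⁅ y ⁆ (∩ʳ A H₁ p) id (λ q → ⊥-elim (disj z (∩ˡ A H₁ p) (single y∈A′ q))))
      (λ p → ∩⁺ (single x∈A p) (∪ˡ p)))) (∣⁅x⁆∣≡1 x)
    H₂∩A : ∣ A ∩ H₂ ∣ ≡ 1
    H₂∩A = trans (cong ∣_∣ (⊆-antisym {i = A ∩ H₂} {A ─ (A ∩ H₁)}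
      (λ p → ─⁺ (∩ˡ A H₂ p) (λ q → ─ʳ F H₁ (∩ʳ A H₂ p) (∩ʳ A H₁ q)))
      (λ p → ∩⁺ (─ˡ A (A ∩ H₁) p) (─⁺ (A⊆F (─ˡ A (A ∩ H₁) p)) (λ q → ─ʳ A (A ∩ H₁) p (∩⁺ (─ˡ A (A ∩ H₁) p) q))))))
      (∣─∣≡ (∩ˡ A H₁) ∣A∣ H₁∩A)
    isLost : ∀ {H} → H ⊆ F → ∣ H ∣ ≡ 2 → ∣ A ∩ H ∣ ≡ 1 → H ∈ₗ filter (λ H → H ⊆? F) lost
    isLost {H} H⊆F ∣H∣ e = ∈-filter⁺ (λ H → H ⊆? F) (∈-filter⁺ lost? (∈-sized⁺ ∣H∣)
      (decidable-stable (Blocked? H) (λ nb → meetInOne exA (¬blocked⇒extendable nb) e) , lose F∈splits (λ {z} → H⊆F {z}))) (λ {z} → H⊆F {z})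

    -- `H₁` joins a point of `A` to one of `A′`, and `H₂` is its complement in `F`. Each meets the
    -- extendable pair `A` in exactly one point, so neither is extendable.
    twoLost : 2 ≤ length (filter (λ H → H ⊆? F) lost)
    twoLost = Unique-⊆⇒length≤ {xs = H₁ ∷ H₂ ∷ []} ((H₁≢H₂ ∷ []) ∷ [] ∷ []) λ where
        (here refl) → isLost H₁⊆F ∣H₁∣ H₁∩A
        (there (here refl)) → isLost (─ˡ F H₁) ∣H₂∣ H₂∩A

  splits≤lost : length splits * 2 ≤ length lost * 1 * 1
  splits≤lost = doubleCounting (λ F H → H ⊆? F) splits lost 1 (λ i → ≤-trans (twoLostIn i) (≤-reflexive (sym (*-identityʳ _))))
    λ {H} i → let H∈ , bl , _ = ∈-filter⁻ lost? {xs = pairs} i in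
      length≤1 (Unique.filter⁺ (λ F → H ⊆? F) (Unique.filter⁺ unsplit? (unique 𝓕))) λ j j′ →
        let F∈ , H⊆F = ∈-filter⁻ (λ F → H ⊆? F) {xs = splits} j
            F′∈ , H⊆F′ = ∈-filter⁻ (λ F → H ⊆? F) {xs = splits} j′
        in determined (∈-sized⁻ H∈) bl H⊆F (proj₁ (∈-splits⁻ F∈)) (proj₂ (∈-splits⁻ F∈)) H⊆F′ (proj₁ (∈-splits⁻ F′∈))
    where
    nonempty : ∀ (A : Subset n) → ∣ A ∣ ≡ 2 → ∃[ x ] x ∈ A
    nonempty A e = decide (nonempty? A)
      where
      decide : Dec (Nonempty A) → ∃[ x ] x ∈ A
      decide (yes ne) = ne
      decide (no ¬ne) = contradiction (trans (sym e) (trans (cong ∣_∣ (Empty-unique ¬ne)) (∣⊥∣≡0 n))) λ ()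
    twoLostIn : ∀ {F} → F ∈ₗ splits → 2 ≤ length (filter (λ H → H ⊆? F) lost)
    twoLostIn i = let F∈ , A , A′ , exA , exA′ , ∣A∣ , ∣A′∣ , disj , eq = ∈-splits⁻ i in
      Crossing.twoLost i F∈ exA ∣A∣ disj eq (proj₂ (nonempty A ∣A∣)) (proj₂ (nonempty A′ ∣A′∣))

  cleanMembers : List (Subset n)
  cleanMembers = filter clean? (members 𝓕)

  extendableRoot : ∀ {G H} → Root G H → Extendable G
  extendableRoot {G} {H} (_ , _ , _ , all) = subst Extendable (⊆-antisym (∪-⊆ id (λ p → ⊥-elim (∉⊥ p))) ∪ˡ)
    (¬blocked⇒extendable (All.lookup all (∈-subsets⁺ (⊆-min H)) (∣∅∣≤ n)))

  -- By `determined` the split member is `F` itself. `F ─ G` contains a point of `A`, so the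
  -- extendable `G`, which would absorb `A`, contains no point of it. Thus `G` is `A′`, but `F ─ G`
  -- contains a point of `A′` as well.
  clean-complement′ : ∀ {F G F′} → F ∈ᶠ 𝓕 → ∣ G ∣ ≡ 2 → G ⊆ F → Root G (F ─ G) →
                      ∣ F ─ G ∣ ≡ 2 → Blocked (F ─ G) → F′ ∈ᶠ 𝓕 → Split F′ → F ─ G ⊆ F′ → ⊥
  clean-complement′ {F} {G} {F′} F∈ ∣G∣ G⊆F ρ ∣H∣ bl F′∈ sp@(A , A′ , exA , exA′ , ∣A∣ , ∣A′∣ , dAA′ , eq) H⊆F′ =
      clash (crosses ∣H∣ bl (λ {z} → H⊆F′ {z}) sp)
    where
    F′≡F : F′ ≡ F
    F′≡F = determined ∣H∣ bl H⊆F′ F′∈ sp (─ˡ F G) F∈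
    clash : (∃[ x ] x ∈ F ─ G × x ∈ A) × (∃[ x ] x ∈ F ─ G × x ∈ A′) → ⊥
    clash ((x , x∈H , x∈A) , (y , y∈H , y∈A′)) =
        ─ʳ F G y∈H (subst (y ∈_) (sym (⊆∧∣∣⇒≡ G⊆A′ (≤-reflexive (trans ∣A′∣ (sym ∣G∣))))) y∈A′)
      where
      G⊆A′ : G ⊆ A′
      G⊆A′ {z} z∈G = ∪-elim A A′ (subst (z ∈_) (sym (trans eq F′≡F)) (G⊆F z∈G))
        (λ z∈A → contradiction (absorb exA ∣A∣ (extendableRoot ρ) z∈A z∈G x∈A) (─ʳ F G x∈H)) id

  Lost : Subset n → Set
  Lost H = Blocked H × Any (λ F → H ⊆ F) splits

  clean-complement : ∀ {F G} → F ∈ᶠ 𝓕 → ∣ G ∣ ≡ 2 → ∣ F ─ G ∣ ≡ 2 → G ⊆ F → Root G (F ─ G) → ¬ Lost (F ─ G)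
  clean-complement {F} {G} F∈ ∣G∣ ∣H∣ G⊆F ρ (bl , sup) = step (find sup)
    where
    step : (∃[ F′ ] F′ ∈ₗ splits × F ─ G ⊆ F′) → ⊥
    step (F′ , F′∈ , H⊆F′) = clean-complement′ F∈ ∣G∣ G⊆F ρ ∣H∣ bl (proj₁ (∈-splits⁻ F′∈)) (proj₂ (∈-splits⁻ F′∈)) H⊆F′

  unlost : List (Subset n)
  unlost = filter (¬? ∘ lost?) pairs

  headOr∅ : List (Subset n) → Subset n
  headOr∅ [] = ∅
  headOr∅ (G ∷ _) = G

  headOr∅≡ : ∀ xs {G} → G ∈ₗ xs → (∀ {G G′} → G ∈ₗ xs → G′ ∈ₗ xs → G ≡ G′) → headOr∅ xs ≡ G
  headOr∅≡ (G′ ∷ xs) i h = h (here refl) i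

  rootedAt : Subset n → Subset n
  rootedAt H = headOr∅ (related H) ∪ H

  clean⇒unlost : ∀ {F} → F ∈ₗ cleanMembers → ∃[ H ] H ∈ₗ unlost × F ≡ rootedAt H
  clean⇒unlost {F} i = step (∈-filter⁻ clean? {xs = members 𝓕} i)
    where
    step₂ : F ∈ᶠ 𝓕 → (∃[ G ] G ∈ₗ pairs × (G ⊆ F) × Root G (F ─ G)) → ∃[ H ] H ∈ₗ unlost × F ≡ rootedAt H
    step₂ F∈ (G , G∈ , G⊆F , ρ) = F ─ G ,
        ∈-filter⁺ (¬? ∘ lost?) (∈-sized⁺ ∣H∣) (clean-complement F∈ (∈-sized⁻ G∈) ∣H∣ G⊆F ρ) ,
        trans (sym (∪─ G⊆F)) (cong (_∪ (F ─ G)) (sym (headOr∅≡ (related (F ─ G))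
          (∈-filter⁺ (λ G′ → root? G′ (F ─ G)) G∈ ρ) (related-unique ∣H∣))))
      where
      ∣H∣ : ∣ F ─ G ∣ ≡ 2
      ∣H∣ = ∣─∣≡ G⊆F (trans (uniform F∈) k≡4) (∈-sized⁻ G∈)
    step : F ∈ᶠ 𝓕 × Clean F → ∃[ H ] H ∈ₗ unlost × F ≡ rootedAt H
    step (F∈ , cl) = step₂ F∈ (find cl)

  clean+lost : length cleanMembers + length lost ≤ n C 2
  clean+lost = ≤-trans (+-monoˡ-≤ (length lost)
    (length≤-code rootedAt unlost (Unique.filter⁺ clean? (unique 𝓕)) clean⇒unlost))
    (≤-reflexive (trans (length-partition lost? pairs) (length-sized n 2)))

  𝓕≥ : 2 ≤ n → (n ∸ 2) C (k ∸ 2) ≤ size 𝓕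
  𝓕≥ 2≤n = let G , _ , ∣G∣ = subsetOfSize (full {n}) (≤-trans 2≤n (≤-reflexive (sym (∣⊤∣≡n n)))) in begin
    (n ∸ 2) C (k ∸ 2)               ≡⟨ cong₂ _C_ (trans (cong (n ∸_) (sym ∣G∣)) (sym (∣∁p∣≡n∸∣p∣ G))) (cong (k ∸_) (sym ∣G∣)) ⟩
    ∣ ∁ G ∣ C (k ∸ ∣ G ∣)           ≡⟨ length-slice G G k id (≤-trans (≤-reflexive ∣G∣) (≤-trans (s≤s (s≤s z≤n)) (≤-reflexive (sym k≡4)))) ⟨
    length (slice G G k)            ≤⟨ maximal (family (slice G G k) (slice-unique G G k)) (λ i → proj₁ (∈-slice⁻ G G id i))
                                        (traces-sunflowerFree S {_≡ G} G (avoid ∣G∣) {family (slice G G k) (slice-unique G G k)} (λ i → proj₂ (∈-slice⁻ G G id i))) ⟩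
    size 𝓕                          ∎
    where
    open ≤-Reasoning
    avoid : ∀ {G} → ∣ G ∣ ≡ 2 → Avoids 2 1 (_≡ G)
    avoid {G} ∣G∣ A K ker eq l = 1+n≰n (≤-trans (≤-reflexive (sym ∣G∣)) (≤-trans
      (∣⊆∣ G K λ {x} p → proj₂ ker {zero} {suc zero} (λ ()) (subst (x ∈_) (sym (eq zero)) p) (subst (x ∈_) (sym (eq (suc zero))) p)) l))

  unclean : List (Subset n)
  unclean = filter (¬? ∘ clean?) (members 𝓕)

  κᵤ : ℕ
  κᵤ = branching ^ k + (branching ^ k + 2)

  unclean-small : 2 ≤ n → length unclean * n ≤ κᵤ * n ^ (k ∸ 2)
  unclean-small 2≤n = begin
    length unclean * n
      ≤⟨ *-monoˡ-≤ n unclean≤ ⟩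
    (length gen + length splits) * n
      ≡⟨ *-distribʳ-+ n (length gen) _ ⟩
    length gen * n + length splits * n
      ≤⟨ +-mono-≤ gen-small splits-small ⟩
    β * n ^ r + (β + 2) * n ^ r
      ≡⟨ *-distribʳ-+ (n ^ r) β _ ⟨
    κᵤ * n ^ r ∎
    where
    open ≤-Reasoning
    r = k ∸ 2
    β = branching ^ k
    gen : List (Subset n)
    gen = generated r
    gen-small : length gen * n ≤ β * n ^ r
    gen-small = length-generated (m∸n≤m k 2)
    unclean≤ : length unclean ≤ length gen + length splits
    unclean≤ = ≤-trans (Unique-⊆⇒length≤ (Unique.filter⁺ (¬? ∘ clean?) (unique 𝓕)) divide) (≤-reflexive (List.length-++ gen))
      where
      divide : ∀ {F} → F ∈ₗ unclean → F ∈ₗ gen ++ splits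
      divide {F} i = let F∈ , nc = ∈-filter⁻ (¬? ∘ clean?) {xs = members 𝓕} i in choose F∈ nc (F ∈ₗ? gen)
        where
        choose : F ∈ᶠ 𝓕 → ¬ Clean F → Dec (F ∈ₗ gen) → F ∈ₗ gen ++ splits
        choose F∈ nc (yes g) = ∈-++⁺ˡ g
        choose F∈ nc (no ng) = ∈-++⁺ʳ gen (∈-filter⁺ unsplit? F∈ (nc , ng))
    total : size 𝓕 ≤ length cleanMembers + length unclean
    total = ≤-reflexive (trans (sym (length-partition clean? (members 𝓕))) (+-comm (length unclean) _))
    -- A split member adds one to |𝓕| but withdraws at least two pairs from the possible complements
    -- of roots, while |𝓕| is at least C(n - 2, 2), the number of k-sets through a fixed pair.
    splits-few : (n ∸ 2) C r + length splits ≤ length gen + n C r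
    splits-few = +-cancelʳ-≤ (length splits) _ _ (begin
      (n ∸ 2) C r + length splits + length splits
        ≤⟨ +-monoˡ-≤ (length splits) (+-monoˡ-≤ (length splits) (≤-trans (𝓕≥ 2≤n) (≤-trans total (+-monoʳ-≤ (length cleanMembers) unclean≤)))) ⟩
      length cleanMembers + (length gen + length splits) + length splits + length splits
        ≡⟨ solve 3 (λ x y z → x :+ (y :+ z) :+ z :+ z := y :+ (x :+ z :* con 2) :+ z) refl (length cleanMembers) (length gen) (length splits) ⟩
      length gen + (length cleanMembers + length splits * 2) + length splits
        ≤⟨ +-monoˡ-≤ (length splits) (+-monoʳ-≤ (length gen) (≤-trans (+-monoʳ-≤ (length cleanMembers)
             (≤-trans splits≤lost (≤-reflexive (trans (*-identityʳ _) (*-identityʳ _))))) clean+lost)) ⟩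
      length gen + n C 2 + length splits
        ≡⟨ cong (λ z → length gen + n C z + length splits) (cong (_∸ 2) k≡4) ⟨
      length gen + n C r + length splits ∎)
    splits-small : length splits * n ≤ (β + 2) * n ^ r
    splits-small = +-cancelˡ-≤ (((n ∸ 2) C r) * n) _ _ (begin
      ((n ∸ 2) C r) * n + length splits * n      ≡⟨ *-distribʳ-+ n ((n ∸ 2) C r) _ ⟨
      ((n ∸ 2) C r + length splits) * n          ≤⟨ *-monoˡ-≤ n splits-few ⟩
      (length gen + n C r) * n                   ≡⟨ *-distribʳ-+ n (length gen) _ ⟩
      length gen * n + (n C r) * n               ≤⟨ +-mono-≤ gen-small (C-diff n r 2 2≤n) ⟩
      β * n ^ r + (((n ∸ 2) C r) * n + 2 * n ^ r) ≡⟨ solve 3 (λ x y z → x :* y :+ (z :+ con 2 :* y) := z :+ (x :+ con 2) :* y) refl β (n ^ r) (((n ∸ 2) C r) * n) ⟩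
      ((n ∸ 2) C r) * n + (β + 2) * n ^ r        ∎)

-- Stages of the induction on the trace size

cleanupConst : ℕ → ℕ → ℕ → ℕ → ℕ → ℕ
cleanupConst k c a B κ = suc c * (κ₀ * (2 ^ B + suc a * (2 ^ B * suc (κ * κ₀) ^ suc a)))
  where
  κ₀ : ℕ
  κ₀ = 2 ^ k * chooseConst k

concentrationConst : ℕ → ℕ → ℕ → ℕ
concentrationConst c r κ = c + chooseConst r * (2 ^ r * κ)

-- The summands serve, in this order, the conversion of powers into binomial coefficients, the
-- concentration in `Rich`, and the final comparison in `Cleanup`.
threshold : (s k c a B b κ : ℕ) → ℕ
threshold s k c a B b κ =
  2 * (B + (s * k + c) + k) + (suc (chooseConst (k ∸ a) * κ′) + suc (cleanupConst k c a B (b * (κ + b * B + κ′))))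
  where
  κ′ : ℕ
  κ′ = concentrationConst c (k ∸ a) (κ + b * B)

record Stage {s k c n : ℕ} (S : Setting s k c n) (a B : ℕ) : Set where
  open Setting S
  field
    Y : Subset n
    ∣Y∣≤B : ∣ Y ∣ ≤ B
    𝒮 : List (Subset n)
    𝒮-unique : Unique 𝒮
    bounds : ∀ {A} → A ∈ₗ 𝒮 → A ⊆ Y × c < ∣ A ∣ × ∣ A ∣ ≤ a
    avoids : Avoids s c (_∈ₗ 𝒮)
    covered : ∀ {x} → x ∈ Y → ∃[ G ] G ∈ₗ 𝒮 × ∣ G ∣ ≡ suc c × x ∈ G
    traces : ∀ {F} → F ∈ᶠ 𝓕 → ∣ F ∩ Y ∣ ≤ a → F ∩ Y ∈ₗ 𝒮
    saturated : ∀ {X} → ∣ X ∣ ≡ k → X ∩ Y ∈ₗ 𝒮 → X ∈ᶠ 𝓕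

-- A core with t elements would equal every petal, so distinct t-sets have a core of size at most c.
-- This is how φ(s, t), which forbids all cores, bounds the traces of size t.
avoids⇒sunflowerFree : ∀ {s c n} {𝓐 : Family n} → 2 ≤ s → Uniform (suc c) 𝓐 → Avoids s c (_∈ᶠ 𝓐) →
                       ¬ ContainsSunflower s U 𝓐
avoids⇒sunflowerFree {s} {c} 2≤s uni av (F , sf , mem , _) =
  av F K ker mem (s≤s⁻¹ (≤∧≢⇒< ∣K∣≤ λ e → proj₂ (two 2≤s i) (proj₁ sf (trans (sym (K≡ e i)) (K≡ e (proj₁ (two 2≤s i)))))))
  where
  ker = sunflower⇒kernel sf
  K = core F
  i : Fin s
  i = fromℕ< {0} (≤-trans (s≤s z≤n) 2≤s)
  ∣K∣≤ : ∣ K ∣ ≤ suc c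
  ∣K∣≤ = ≤-trans (∣⊆∣ K (F i) (proj₁ ker i)) (≤-reflexive (uni (mem i)))
  K≡ : ∣ K ∣ ≡ suc c → ∀ i → K ≡ F i
  K≡ e i = ⊆∧∣∣⇒≡ (proj₁ ker i) (≤-reflexive (trans (uni (mem i)) (sym e)))

module FirstStage {s k c n : ℕ} (S : Setting s k c n) (B φ κ : ℕ)
  (φt≤B : φ * suc c ≤ B) (t+c≤k : suc c + c ≤ k) (2c≤r : c + c ≤ k ∸ suc c)
  (room : ∀ {m} → m ≤ suc c → c * (2 + suc c ∸ m) + m ≤ k)
  (φ-bound : ∀ (𝓐 : Family n) → Uniform (suc c) 𝓐 → ¬ ContainsSunflower s U 𝓐 → size 𝓐 ≤ φ)
  (unclean : List (Subset n)) (unclean-small : length unclean * n ≤ κ * n ^ (k ∸ suc c))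
  (clean : ∀ {F} → F ∈ᶠ Setting.𝓕 S → F ∈ₗ unclean ⊎ ∃[ G ] ∣ G ∣ ≡ suc c × G ⊆ F × Rooted.Root S ∅ G (F ─ G))
  (large : threshold s k c (suc c) B B κ ≤ n) where

  open Setting S

  φ≤B : φ ≤ B
  φ≤B = ≤-trans (≤-trans (m≤m+n φ (c * φ)) (≤-reflexive (*-comm (suc c) φ))) φt≤B

  nothing-avoids : Avoids {n} s c (_∈ₗ [])
  nothing-avoids A K ker mem _ with mem (someIndex S)
  ... | ()

  module L = OneLevel S (suc c) B B κ (n<1+n c) t+c≤k 2c≤r ∅ [] (λ ()) (λ ()) nothing-avoids
    (sized n (suc c)) (slice-unique {n} ∅ ∅ (suc c)) (∈-sized⁻ {n})

  bounded : ∀ {xs} → L.Admissible xs → length xs ≤ φ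
  bounded {xs} (u , sub , av) = φ-bound (family xs u) (∈-sized⁻ ∘ sub)
    (avoids⇒sunflowerFree {𝓐 = family xs u} 2≤s (∈-sized⁻ ∘ sub) av)

  supported : ∀ {xs} → L.Admissible xs → ∣ ⋃ xs ∣ ≤ B
  supported {xs} adm = ≤-trans (∣⋃∣≤ xs {suc c} (λ i → ≤-reflexive (∈-sized⁻ (proj₁ (proj₂ adm) i))))
    (≤-trans (*-monoˡ-≤ (suc c) (bounded adm)) φt≤B)

  private
    N₁ N₂ N₃ : ℕ
    N₁ = 2 * (B + (s * k + c) + k)
    N₂ = chooseConst (k ∸ suc c) * (c + chooseConst (k ∸ suc c) * (2 ^ (k ∸ suc c) * (κ + B * B)))
    N₃ = cleanupConst k c (suc c) B L.κ₃

    large₁ : N₁ ≤ n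
    large₁ = ≤-trans (m≤m+n N₁ (suc N₂ + suc N₃)) large

    large₂ : N₂ < n
    large₂ = ≤-trans (≤-trans (m≤m+n (suc N₂) (suc N₃)) (m≤n+m (suc N₂ + suc N₃) N₁)) large

    large₃ : N₃ < n
    large₃ = ≤-trans (≤-trans (m≤n+m (suc N₃) (suc N₂)) (m≤n+m (suc N₂ + suc N₃) N₁)) large

  module Construct (𝒞 : List (Subset n)) (adm : L.Admissible 𝒞) (max : ∀ {xs} → L.Admissible xs → length xs ≤ length 𝒞) where

    b≤ : length 𝒞 ≤ B
    b≤ = ≤-trans (bounded adm) φ≤B

    -- `⋃ 𝒞` is a base only for the competitor; the stage itself gets base `⋃ 𝒢`. No traces have
    -- been found yet, so `keep` is void.
    module R = L.Rich (length 𝒞) max 𝒞 adm refl b≤ (⋃ 𝒞) (supported adm) (λ i p → ∈⋃⁺ i p) (λ _ ())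
      unclean unclean-small (λ F∈ _ → [ inj₁ , (λ (G , ∣G∣ , r) → inj₂ (G , ∈-sized⁺ ∣G∣ , r)) ]′ (clean F∈))
      (≤-trans (*-monoʳ-≤ 2 (+-monoˡ-≤ k (m≤m+n B (s * k + c)))) large₁) large₂

    stage : R.Core → Stage S (suc c) B
    stage (𝒢 , adm𝒢 , len , exceptions , few , typical) = record
      { Y = ⋃ 𝒢
      ; ∣Y∣≤B = supported adm𝒢
      ; 𝒮 = 𝒢
      ; 𝒮-unique = proj₁ adm𝒢
      ; bounds = Final.𝒮-bounds
      ; avoids = proj₂ (proj₂ adm𝒢)
      ; covered = λ p → let G , G∈ , x∈ = ∈⋃⁻ 𝒢 p in G , G∈ , ∈-sized⁻ (proj₁ (proj₂ adm𝒢) G∈) , x∈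
      ; traces = Final.traces∈𝒮 Final.missing-small Final.low large₁ large₃
      ; saturated = Final.𝒮-saturated Final.missing-small Final.low large₁ large₃
      }
      where
      enlarge : ∀ {F} → F ∈ᶠ 𝓕 → ∣ F ∩ ⋃ 𝒢 ∣ ≤ suc c → F ∩ ⋃ 𝒢 ∉ₗ [] →
                c * (2 + suc c ∸ ∣ F ∩ ⋃ 𝒢 ∣) + ∣ F ∩ ⋃ 𝒢 ∣ ≤ k × ∃[ A ] A ∈ₗ sized n (suc c) × A ⊆ F × F ∩ ⋃ 𝒢 ⊆ A
      enlarge {F} F∈ l _ = room l ,
        (let A , sub , A⊆F , e = between (F ∩ ⋃ 𝒢) F (∩ˡ F (⋃ 𝒢)) l (≤-trans (m≤m+n (suc c) c) (≤-trans t+c≤k (≤-reflexive (sym (uniform F∈)))))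
         in A , ∈-sized⁺ e , A⊆F , λ {x} → sub {x})
      module Final = L.Finish (length 𝒞) max b≤ 𝒢 adm𝒢 len exceptions few typical (⋃ 𝒢) (supported adm𝒢)
        (λ i p → ∈⋃⁺ i p) (λ _ ()) enlarge

  firstStage : ¬ ¬ Stage S (suc c) B
  firstStage none = ¬¬-longest L.Admissible {φ} {[]} ([] , (λ ()) , nothing-avoids) bounded
    λ (𝒞 , adm , max) → none (Construct.stage 𝒞 adm max (Construct.R.rich 𝒞 adm max))

nextConst : ℕ → ℕ → ℕ → ℕ → ℕ
nextConst s k c B = 2 ^ B + 2 ^ B * (suc c * (s * k))

module NextStage {s k c n : ℕ} (S : Setting s k c n) (a B : ℕ) (stage : Stage S a B)
  (c≤a : c ≤ a) (a+c≤k : suc a + c ≤ k) (2c≤r : c + c ≤ k ∸ suc a)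
  (large : threshold s k c (suc a) B (2 ^ B) (nextConst s k c B) ≤ n) where

  open Setting S

  open Stage stage

  private
    b κ N₁ N₂ N₃ : ℕ
    b = 2 ^ B
    κ = nextConst s k c B
    N₁ = 2 * (B + (s * k + c) + k)
    N₂ = chooseConst (k ∸ suc a) * (c + chooseConst (k ∸ suc a) * (2 ^ (k ∸ suc a) * (κ + b * B)))
    N₃ = cleanupConst k c (suc a) B (b * (κ + b * B + (c + chooseConst (k ∸ suc a) * (2 ^ (k ∸ suc a) * (κ + b * B)))))

    large₁ : N₁ ≤ n
    large₁ = ≤-trans (m≤m+n N₁ (suc N₂ + suc N₃)) large

    large₂ : N₂ < n
    large₂ = ≤-trans (≤-trans (m≤m+n (suc N₂) (suc N₃)) (m≤n+m (suc N₂ + suc N₃) N₁)) large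

    large₃ : N₃ < n
    large₃ = ≤-trans (≤-trans (m≤n+m (suc N₃) (suc N₂)) (m≤n+m (suc N₂ + suc N₃) N₁)) large

    large₀ : B + s * k + k ≤ n
    large₀ = ≤-trans (≤-trans (+-monoˡ-≤ k (+-monoʳ-≤ B (m≤m+n (s * k) c))) (m≤m+n (B + (s * k + c) + k) _)) large₁

    r : ℕ
    r = k ∸ suc a

    size? : Decidable (λ (G : Subset n) → ∣ G ∣ ≡ suc a)
    size? G = ∣ G ∣ ≟ suc a

    cands : List (Subset n)
    cands = filter size? (subsets Y)

    cands⁻ : ∀ {G} → G ∈ₗ cands → G ⊆ Y × ∣ G ∣ ≡ suc a
    cands⁻ i = let j , e = ∈-filter⁻ size? {xs = subsets Y} i in ∈-subsets⁻ j , e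

    cands⁺ : ∀ {G} → G ⊆ Y → ∣ G ∣ ≡ suc a → G ∈ₗ cands
    cands⁺ s e = ∈-filter⁺ size? (∈-subsets⁺ s) e

    ∣subsetsY∣ : length (subsets Y) ≤ b
    ∣subsetsY∣ = ≤-trans (≤-reflexive (length-subsets Y)) (^-monoʳ-≤ 2 ∣Y∣≤B)

    extendable : ∀ {A D} → A ∈ₗ 𝒮 → ∣ D ∣ ≤ c → Disj D Y → Extendable (A ∪ D)
    extendable {A} {D} i l d = saturated⇒extendable S ∣Y∣≤B (proj₁ (bounds i)) d
      (≤-trans (∣∪∣≤ A D) (≤-trans (+-mono-≤ (proj₂ (proj₂ (bounds i))) l) (≤-trans (n≤1+n (a + c)) a+c≤k)))
      large₀ λ e eq → saturated e (subst (_∈ₗ 𝒮) (sym eq) i)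

    below : ∀ {A} → A ∈ₗ 𝒮 → A ⊆ Y × c < ∣ A ∣ × ∣ A ∣ < suc a
    below i = let A⊆Y , c<A , A≤a = bounds i in A⊆Y , c<A , s≤s A≤a

  module L = OneLevel S (suc a) B b κ (s≤s c≤a) a+c≤k 2c≤r Y 𝒮
    below extendable avoids
    cands (Unique.filter⁺ size? (subsets-unique Y)) (proj₂ ∘ cands⁻)

  bounded : ∀ {xs} → L.Admissible xs → length xs ≤ b
  bounded (u , sub , _) = ≤-trans (Unique-⊆⇒length≤ u λ i → ∈-subsets⁺ (proj₁ (cands⁻ (sub i)))) ∣subsetsY∣

  private
    hit : ∀ {G D} → Dec (Disj G D) → Dec (Blocked (G ∪ D)) → List (Subset n)
    hit {G} {D} (yes _) (yes _) = filter (λ F → (G ∪ D) ⊆? F) (members 𝓕)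
    hit _ _ = []

    hitsOfSize : Subset n → ℕ → List (Subset n)
    hitsOfSize G d = concatMap (λ D → hit {G} {D} (Disj? G D) (Blocked? (G ∪ D))) (sized n d)

    hitsOf : Subset n → List (Subset n)
    hitsOf G = concatMap (hitsOfSize G) (upTo (suc c))

    -- With the base fixed there are at most 2 ^ B candidates, so counting replaces the closure
    -- argument. Traces with more than a + 1 points leave fewer free elements; and a member whose
    -- trace `G` is not a root contains a blocked `G ∪ D`, so it meets a bounded cover, which costs
    -- a factor n.
    higher unrooted unclean : List (Subset n)
    higher = concatMap (λ A → map (A ∪_) (sizedBelow n r)) (subsets Y)
    unrooted = concatMap hitsOf cands
    unclean = higher ++ unrooted

    higher-small : length higher * n ≤ b * n ^ r
    higher-small = begin
      length higher * n                             ≤⟨ *-monoˡ-≤ n (length-concatMap≤ _ (subsets Y) λ {A} _ → ≤-reflexive (List.length-map (A ∪_) (sizedBelow n r))) ⟩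
      length (subsets Y) * length (sizedBelow n r) * n ≡⟨ *-assoc (length (subsets Y)) _ n ⟩
      length (subsets Y) * (length (sizedBelow n r) * n) ≤⟨ *-mono-≤ ∣subsetsY∣ (length-sizedBelow n r) ⟩
      b * n ^ r                                     ∎
      where open ≤-Reasoning

    hit-small : ∀ {G D d} → ∣ G ∣ ≡ suc a → ∣ D ∣ ≡ d → (x : Dec (Disj G D)) (y : Dec (Blocked (G ∪ D))) →
                length (hit {G} {D} x y) * n ≤ s * k * n ^ (k ∸ (suc a + d))
    hit-small ∣G∣ ∣D∣ (no _) _ = z≤n
    hit-small ∣G∣ ∣D∣ (yes _) (no _) = z≤n
    hit-small {G} {D} ∣G∣ ∣D∣ (yes disj) (yes (V , ∣V∣≤ , disjV , cover)) = ≤-trans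
      (hitting≤ (G ∪ D) V k (Unique.filter⁺ (λ F → (G ∪ D) ⊆? F) (unique 𝓕)) λ {F} i →
        let F∈ , sub = ∈-filter⁻ (λ F → (G ∪ D) ⊆? F) {xs = members 𝓕} i
            x , x∈F , x∈V = ¬Disj⇒common F V (All.lookup cover F∈ sub)
        in uniform F∈ , (λ {z} → sub {z}) , x , x∈V , x∈F , disjV x x∈V)
      (*-mono-≤ ∣V∣≤ (≤-reflexive (cong (λ z → n ^ (k ∸ z)) (trans (∣∪∣-disj G D disj) (cong₂ _+_ ∣G∣ ∣D∣)))))

    unrooted-small : length unrooted * n ≤ b * (suc c * (s * k)) * n ^ r
    unrooted-small = begin
      length unrooted * n
        ≡⟨ trans (cong (_* n) (length-concatMap hitsOf cands)) (sym (∑-* cands (length ∘ hitsOf) n)) ⟩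
      ∑ cands (λ G → length (hitsOf G) * n)
        ≤⟨ ∑-≤ cands (λ {G} i → atG (proj₂ (cands⁻ i))) ⟩
      length cands * (suc c * (s * k * n ^ r))
        ≤⟨ *-monoˡ-≤ _ (≤-trans (List.length-filter size? (subsets Y)) ∣subsetsY∣) ⟩
      b * (suc c * (s * k * n ^ r))
        ≡⟨ solve 4 (λ x y z u → x :* (y :* (z :* u)) := x :* (y :* z) :* u) refl b (suc c) (s * k) (n ^ r) ⟩
      b * (suc c * (s * k)) * n ^ r ∎
      where
      open ≤-Reasoning
      atD : ∀ {G d} → ∣ G ∣ ≡ suc a → d ≤ c →
            length (hitsOfSize G d) * n ≤ s * k * n ^ r
      atD {G} {d} ∣G∣ d≤c = begin
        length (hitsOfSize G d) * n
          ≡⟨ trans (cong (_* n) (length-concatMap hitsAt (sized n d))) (sym (∑-* (sized n d) (length ∘ hitsAt) n)) ⟩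
        ∑ (sized n d) (λ D → length (hit {G} {D} (Disj? G D) (Blocked? (G ∪ D))) * n)
          ≤⟨ ∑-≤ (sized n d) (λ {D} i → hit-small {G} {D} ∣G∣ (∈-sized⁻ i) (Disj? G D) (Blocked? (G ∪ D))) ⟩
        length (sized n d) * (s * k * n ^ (k ∸ (suc a + d)))
          ≤⟨ *-monoˡ-≤ _ (length-sized≤ n d) ⟩
        n ^ d * (s * k * n ^ (k ∸ (suc a + d)))
          ≡⟨ solve 3 (λ x y z → x :* (y :* z) := y :* (x :* z)) refl (n ^ d) (s * k) _ ⟩
        s * k * (n ^ d * n ^ (k ∸ (suc a + d)))
          ≡⟨ cong (s * k *_) (trans (sym (^-distribˡ-+-* n d _)) (cong (n ^_) (trans (cong (d +_) (sym (∸-+-assoc k (suc a) d)))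
               (m+[n∸m]≡n (≤-trans d≤c (≤-trans (m≤m+n c c) 2c≤r)))))) ⟩
        s * k * n ^ r ∎
        where
        hitsAt : Subset n → List (Subset n)
        hitsAt D = hit {G} {D} (Disj? G D) (Blocked? (G ∪ D))
      atG : ∀ {G} → ∣ G ∣ ≡ suc a →
            length (hitsOf G) * n ≤ suc c * (s * k * n ^ r)
      atG {G} ∣G∣ = begin
        length (hitsOf G) * n
          ≡⟨ trans (cong (_* n) (length-concatMap (hitsOfSize G) (upTo (suc c)))) (sym (∑-* (upTo (suc c)) (length ∘ hitsOfSize G) n)) ⟩
        ∑ (upTo (suc c)) (λ d → length (hitsOfSize G d) * n)
          ≤⟨ ∑-≤ (upTo (suc c)) (λ i → atD ∣G∣ (s≤s⁻¹ (∈-upTo⁻ i))) ⟩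
        length (upTo (suc c)) * (s * k * n ^ r)
          ≡⟨ cong (_* (s * k * n ^ r)) (List.length-upTo (suc c)) ⟩
        suc c * (s * k * n ^ r) ∎

    unclean-small : length unclean * n ≤ κ * n ^ r
    unclean-small = begin
      length unclean * n                          ≡⟨ cong (_* n) (List.length-++ higher) ⟩
      (length higher + length unrooted) * n       ≡⟨ *-distribʳ-+ n (length higher) _ ⟩
      length higher * n + length unrooted * n     ≤⟨ +-mono-≤ higher-small unrooted-small ⟩
      b * n ^ r + b * (suc c * (s * k)) * n ^ r   ≡⟨ *-distribʳ-+ (n ^ r) b _ ⟨
      κ * n ^ r                                   ∎
      where open ≤-Reasoning

    ∈-higher : ∀ {F} → F ∈ᶠ 𝓕 → suc a < ∣ F ∩ Y ∣ → F ∈ₗ higher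
    ∈-higher {F} F∈ l = let A , A⊆ , e = subsetOfSize (F ∩ Y) l
                            A⊆F = λ {x} p → ∩ˡ F Y {x} (A⊆ p)
                        in ∈-concatMap⁺ (∈-subsets⁺ (∩ʳ F Y ∘ A⊆))
      (subst (_∈ₗ map (A ∪_) (sizedBelow n r)) (∪─ A⊆F) (∈-map⁺ (A ∪_) (∈-sizedBelow (rest A A⊆F e))))
      where
      rest : ∀ A → A ⊆ F → ∣ A ∣ ≡ suc (suc a) → suc ∣ F ─ A ∣ ≡ r
      rest A A⊆F e = trans (sym (m+n∸m≡n (suc a) _)) (cong (_∸ suc a) (trans (+-suc (suc a) _)
        (trans (cong (_+ ∣ F ─ A ∣) (sym e)) (trans (∣─∣-⊆ F A A⊆F) (uniform F∈)))))

    ∈-unrooted : ∀ {F G D} → F ∈ᶠ 𝓕 → G ∈ₗ cands → G ⊆ F → D ⊆ F ─ G → ∣ D ∣ ≤ c → Blocked (G ∪ D) → F ∈ₗ unrooted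
    ∈-unrooted {F} {G} {D} F∈ G∈ G⊆F D⊆ l bl = ∈-concatMap⁺ G∈ (∈-concatMap⁺ (∈-upTo⁺ (s≤s l)) (∈-concatMap⁺ {xs = sized n ∣ D ∣} (∈-sized⁺ refl)
        (hits (Disj? G D) (Blocked? (G ∪ D)))))
      where
      hits : ∀ x y → F ∈ₗ hit {G} {D} x y
      hits (no nd) _ = contradiction (λ x p q → ─ʳ F G (D⊆ q) p) nd
      hits (yes _) (no nb) = contradiction bl nb
      hits (yes _) (yes _) = ∈-filter⁺ (λ F → (G ∪ D) ⊆? F) F∈ (∪-⊆ G⊆F (─ˡ F G ∘ D⊆))

    clean : ∀ {F} → F ∈ᶠ 𝓕 → F ∩ Y ∉ₗ 𝒮 → F ∈ₗ unclean ⊎ ∃[ G ] G ∈ₗ cands × G ⊆ F × L.Root G (F ─ G)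
    clean {F} F∈ ni = bySize (suc a <? ∣ F ∩ Y ∣)
      where
      G = F ∩ Y
      a<G : a < ∣ G ∣
      a<G = ≰⇒> λ l → ni (traces F∈ l)
      G⊆F : G ⊆ F
      G⊆F = ∩ˡ F Y
      byBlocked : ∣ G ∣ ≡ suc a → Dec (Any (λ D → ∣ D ∣ ≤ c × Blocked (G ∪ D)) (subsets (F ─ G))) →
                  F ∈ₗ unclean ⊎ ∃[ G ] G ∈ₗ cands × G ⊆ F × L.Root G (F ─ G)
      byBlocked e (yes some) = let D , D∈ , l , bl = find some in
        inj₁ (∈-++⁺ʳ higher (∈-unrooted F∈ (cands⁺ (∩ʳ F Y) e) G⊆F (∈-subsets⁻ D∈) l bl))
      byBlocked e (no none) = inj₂ (G , cands⁺ (∩ʳ F Y) e , (λ {x} → G⊆F {x}) ,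
        (λ x p q → ─ʳ F G q p) , (λ x p q → ─ʳ F G p (∩⁺ (─ˡ F G p) q)) , subst (_∈ᶠ 𝓕) (sym (∪─ G⊆F)) F∈ ,
        All.tabulate λ i l bl → none (lose i (l , bl)))
      bySize : Dec (suc a < ∣ G ∣) → F ∈ₗ unclean ⊎ ∃[ G ] G ∈ₗ cands × G ⊆ F × L.Root G (F ─ G)
      bySize (yes l) = inj₁ (∈-++⁺ˡ (∈-higher F∈ l))
      bySize (no nl) = byBlocked (≤-antisym (≮⇒≥ nl) a<G)
        (Any.any? (λ D → (∣ D ∣ ≤? c) ×-dec Blocked? (G ∪ D)) (subsets (F ─ G)))

    inY : ∀ {xs} → L.Admissible xs → ∀ {A} → A ∈ₗ 𝒮 ++ xs → A ⊆ Y
    inY adm i = [ (λ j → proj₁ (bounds j)) , (λ j → proj₁ (cands⁻ (proj₁ (proj₂ adm) j))) ]′ (∈-++⁻ 𝒮 i)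

  module Construct (𝒞 : List (Subset n)) (adm : L.Admissible 𝒞) (max : ∀ {xs} → L.Admissible xs → length xs ≤ length 𝒞) where

    module R = L.Rich (length 𝒞) max 𝒞 adm refl (bounded adm) Y ∣Y∣≤B (inY adm) (λ _ i → i) unclean unclean-small clean
      (≤-trans (*-monoʳ-≤ 2 (+-monoˡ-≤ k (m≤m+n B (s * k + c)))) large₁) large₂

    advance : R.Core → Stage S (suc a) B
    advance (𝒢 , adm𝒢 , len , exceptions , few , typical) = record
      { Y = Y
      ; ∣Y∣≤B = ∣Y∣≤B
      ; 𝒮 = 𝒮 ++ 𝒢
      ; 𝒮-unique = Unique.++⁺ 𝒮-unique (proj₁ adm𝒢) λ (i , j) →
          1+n≰n (≤-trans (≤-reflexive (sym (proj₂ (cands⁻ (proj₁ (proj₂ adm𝒢) j))))) (proj₂ (proj₂ (bounds i))))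
      ; bounds = Final.𝒮-bounds
      ; avoids = proj₂ (proj₂ adm𝒢)
      ; covered = λ p → let G , G∈ , e , x∈ = covered p in G , ∈-++⁺ˡ G∈ , e , x∈
      ; traces = Final.traces∈𝒮 Final.missing-small Final.low large₁ large₃
      ; saturated = Final.𝒮-saturated Final.missing-small Final.low large₁ large₃
      }
      where
      enlarge : ∀ {F} → F ∈ᶠ 𝓕 → ∣ F ∩ Y ∣ ≤ suc a → F ∩ Y ∉ₗ 𝒮 →
                c * (2 + suc a ∸ ∣ F ∩ Y ∣) + ∣ F ∩ Y ∣ ≤ k × ∃[ A ] A ∈ₗ cands × A ⊆ F × F ∩ Y ⊆ A
      enlarge {F} F∈ l ni = numeric , F ∩ Y , cands⁺ (∩ʳ F Y) e , ∩ˡ F Y , id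
        where
        -- Smaller traces are already in 𝒮, so here the trace is its own candidate; at the first
        -- stage it had to be enlarged outside the base.
        e : ∣ F ∩ Y ∣ ≡ suc a
        e = ≤-antisym l (≰⇒> λ l′ → ni (traces F∈ l′))
        numeric : c * (2 + suc a ∸ ∣ F ∩ Y ∣) + ∣ F ∩ Y ∣ ≤ k
        numeric = begin
          c * (2 + suc a ∸ ∣ F ∩ Y ∣) + ∣ F ∩ Y ∣   ≡⟨ cong (λ z → c * (2 + suc a ∸ z) + z) e ⟩
          c * (2 + suc a ∸ suc a) + suc a           ≡⟨ cong (λ z → c * z + suc a) (m+n∸n≡m 2 (suc a)) ⟩
          c * 2 + suc a                             ≡⟨ cong (_+ suc a) (solve 1 (λ x → x :* con 2 := x :+ x) refl c) ⟩
          c + c + suc a                             ≤⟨ +-monoˡ-≤ (suc a) 2c≤r ⟩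
          k ∸ suc a + suc a                         ≡⟨ m∸n+n≡m (≤-trans (m≤m+n (suc a) c) a+c≤k) ⟩
          k                                         ∎
          where open ≤-Reasoning
      module Final = L.Finish (length 𝒞) max (bounded adm) 𝒢 adm𝒢 len exceptions few typical Y ∣Y∣≤B (inY adm𝒢) saturated enlarge

  nextStage : ¬ ¬ Stage S (suc a) B
  nextStage none = ¬¬-longest L.Admissible {b} {[]}
    ([] , (λ ()) , λ A K ker mem → avoids A K ker (λ i → subst (A i ∈ₗ_) (List.++-identityʳ 𝒮) (mem i))) bounded
    λ (𝒞 , adm , max) → none (Construct.advance 𝒞 adm max (Construct.R.rich 𝒞 adm max))

-- Lexicographic comparison of the vectors φ̃

∑-upTo-∷ : ∀ m (f : ℕ → ℕ) → ∑ (upTo (suc m)) f ≡ f 0 + ∑ (upTo m) (f ∘ suc)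
∑-upTo-∷ m f = cong (λ xs → f 0 + sum xs) (trans (List.map-applyUpTo suc f m) (sym (List.map-applyUpTo id (f ∘ suc) m)))

∑-upTo-∷ʳ : ∀ m (f : ℕ → ℕ) → ∑ (upTo (suc m)) f ≡ ∑ (upTo m) f + f m
∑-upTo-∷ʳ m f = trans (cong (λ xs → ∑ xs f) (sym (List.upTo-∷ʳ m)))
  (trans (∑-++ (upTo m) [ m ] f) (cong (∑ (upTo m) f +_) (+-identityʳ (f m))))

∑-*ˡ : ∀ {A : Set} (xs : List A) m (f : A → ℕ) → ∑ xs (λ x → m * f x) ≡ m * ∑ xs f
∑-*ˡ xs m f = trans (∑-cong xs λ {x} _ → *-comm m (f x)) (trans (∑-* xs f m) (*-comm (∑ xs f) m))

∑-triangle : ∀ m (g : ℕ → ℕ → ℕ) →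
             ∑ (upTo m) (λ j → ∑ (upTo (m ∸ j)) (g j)) ≡ ∑ (upTo m) (λ i → ∑ (upTo (suc i)) (λ j → g j (i ∸ j)))
∑-triangle zero g = refl
∑-triangle (suc m) g = begin
  ∑ (upTo (suc m)) (λ j → ∑ (upTo (suc m ∸ j)) (g j))
    ≡⟨ ∑-cong (upTo (suc m)) (λ {j} i → trans (cong (λ z → ∑ (upTo z) (g j)) (+-∸-assoc 1 (s≤s⁻¹ (∈-upTo⁻ i)))) (∑-upTo-∷ʳ (m ∸ j) (g j))) ⟩
  ∑ (upTo (suc m)) (λ j → ∑ (upTo (m ∸ j)) (g j) + g j (m ∸ j))
    ≡⟨ ∑-+ (upTo (suc m)) (λ j → ∑ (upTo (m ∸ j)) (g j)) (λ j → g j (m ∸ j)) ⟩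
  ∑ (upTo (suc m)) (λ j → ∑ (upTo (m ∸ j)) (g j)) + diagonal
    ≡⟨ cong (_+ diagonal) (trans (∑-upTo-∷ʳ m (λ j → ∑ (upTo (m ∸ j)) (g j)))
         (trans (cong (λ z → ∑ (upTo m) (λ j → ∑ (upTo (m ∸ j)) (g j)) + ∑ (upTo z) (g m)) (n∸n≡0 m)) (+-identityʳ _))) ⟩
  ∑ (upTo m) (λ j → ∑ (upTo (m ∸ j)) (g j)) + diagonal
    ≡⟨ cong (_+ diagonal) (∑-triangle m g) ⟩
  ∑ (upTo m) (λ i → ∑ (upTo (suc i)) (λ j → g j (i ∸ j))) + diagonal
    ≡⟨ ∑-upTo-∷ʳ m (λ i → ∑ (upTo (suc i)) (λ j → g j (i ∸ j))) ⟨
  ∑ (upTo (suc m)) (λ i → ∑ (upTo (suc i)) (λ j → g j (i ∸ j))) ∎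
  where
  open ≡-Reasoning
  diagonal = ∑ (upTo (suc m)) (λ j → g j (m ∸ j))

-- The sum may stop at any L ≥ q, since C(q, l) vanishes beyond q; `L ≤ m` keeps `m ∸ l` exact.
vandermonde : ∀ q p L m → q ≤ L → L ≤ m → (q + p) C m ≡ ∑ (upTo (suc L)) (λ l → (q C l) * (p C (m ∸ l)))
vandermonde zero p L m _ _ = sym (trans (∑-upTo-∷ L (λ l → (0 C l) * (p C (m ∸ l))))
  (trans (cong₂ _+_ (*-identityˡ (p C m)) (trans (∑-cong (upTo L) λ {l} _ → cong (_* (p C (m ∸ suc l))) (0C1+k l)) (∑-0 (upTo L))))
    (+-identityʳ _)))
vandermonde (suc q) p (suc L) (suc m) (s≤s q≤L) (s≤s L≤m) = begin
  suc (q + p) C suc m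
    ≡⟨ pascal (q + p) m ⟩
  (q + p) C m + (q + p) C suc m
    ≡⟨ cong₂ _+_ (vandermonde q p L m q≤L L≤m) (vandermonde q p (suc L) (suc m) (m≤n⇒m≤1+n q≤L) (s≤s L≤m)) ⟩
  ∑ (upTo (suc L)) f + ∑ (upTo (2 + L)) g
    ≡⟨ cong (∑ (upTo (suc L)) f +_) (∑-upTo-∷ (suc L) g) ⟩
  ∑ (upTo (suc L)) f + (g 0 + ∑ (upTo (suc L)) (g ∘ suc))
    ≡⟨ solve 3 (λ x y z → x :+ (y :+ z) := y :+ (x :+ z)) refl (∑ (upTo (suc L)) f) (g 0) (∑ (upTo (suc L)) (g ∘ suc)) ⟩
  g 0 + (∑ (upTo (suc L)) f + ∑ (upTo (suc L)) (g ∘ suc))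
    ≡⟨ cong (g 0 +_) (∑-+ (upTo (suc L)) f (g ∘ suc)) ⟨
  g 0 + ∑ (upTo (suc L)) (λ l → f l + g (suc l))
    ≡⟨ cong₂ _+_ (cong (_* (p C suc m)) (trans (nC0≡1 q) (sym (nC0≡1 (suc q)))))
         (∑-cong (upTo (suc L)) λ {l} _ → trans (sym (*-distribʳ-+ (p C (m ∸ l)) (q C l) _)) (cong (_* (p C (m ∸ l))) (sym (pascal q l)))) ⟩
  h 0 + ∑ (upTo (suc L)) (h ∘ suc)
    ≡⟨ ∑-upTo-∷ (suc L) h ⟨
  ∑ (upTo (2 + L)) h ∎
  where
  open ≡-Reasoning
  f g h : ℕ → ℕ
  f l = (q C l) * (p C (m ∸ l))
  g l = (q C l) * (p C (suc m ∸ l))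
  h l = (suc q C l) * (p C (suc m ∸ l))

-- C(p, m + 1) / C(p, m) = (p - m) / (m + 1), with the division removed by `absorption`.
C-ratio : ∀ K p m → suc m * suc K ≤ suc p → K * (p C m) ≤ p C suc m
C-ratio K p m h = *-cancelˡ-≤ (suc m) (+-cancelˡ-≤ (suc m * (p C m)) _ _ (begin
  suc m * (p C m) + suc m * (K * (p C m))     ≡⟨ solve 3 (λ x y z → x :* y :+ x :* (z :* y) := x :* (con 1 :+ z) :* y) refl (suc m) (p C m) K ⟩
  suc m * suc K * (p C m)                     ≤⟨ *-monoˡ-≤ (p C m) h ⟩
  suc p * (p C m)                             ≡⟨ absorption p m ⟨
  suc m * (suc p C suc m)                     ≡⟨ cong (suc m *_) (pascal p m) ⟩
  suc m * (p C m + p C suc m)                 ≡⟨ *-distribˡ-+ (suc m) (p C m) _ ⟩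
  suc m * (p C m) + suc m * (p C suc m)       ∎))
  where open ≤-Reasoning

C-positive : ∀ p m → m ≤ p → 1 ≤ p C m
C-positive p zero _ = ≤-reflexive (sym (nC0≡1 p))
C-positive (suc p) (suc m) (s≤s l) = ≤-trans (C-positive p m l) (≤-trans (m≤m+n _ _) (≤-reflexive (sym (pascal p m))))

-- The weights decay so fast that the tail of `v` weighs less than one unit of the leading entry.
-- Hence u 0 > v 0 would reverse the inequality of the sums, whatever the tail of `u`.
weights⇒lex : ∀ m M (u v w : ℕ → ℕ) → (∀ {i} → i < m → v i ≤ M) → (∀ {i} → i < m → 1 ≤ w i) →
              (∀ {i} → suc i < m → suc (m * M) * w (suc i) ≤ w i) →
              ∑ (upTo m) (λ i → u i * w i) ≤ ∑ (upTo m) (λ i → v i * w i) →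
              Vec.tabulate {n = m} (u ∘ toℕ) ≤ₗₑₓ Vec.tabulate {n = m} (v ∘ toℕ)
weights⇒lex zero M u v w v≤M w≥1 decay le = base tt
weights⇒lex (suc m) M u v w v≤M w≥1 decay le = compare (<-cmp (u 0) (v 0))
  where
  open ≤-Reasoning
  Σu Σv : ℕ
  Σu = ∑ (upTo m) (λ i → u (suc i) * w (suc i))
  Σv = ∑ (upTo m) (λ i → v (suc i) * w (suc i))
  le′ : u 0 * w 0 + Σu ≤ v 0 * w 0 + Σv
  le′ = ≤-trans (≤-reflexive (sym (∑-upTo-∷ m (λ i → u i * w i)))) (≤-trans le (≤-reflexive (∑-upTo-∷ m (λ i → v i * w i))))
  w-decreasing : ∀ {i} → suc i < suc m → w (suc i) ≤ w i
  w-decreasing l = ≤-trans (m≤m+n _ _) (decay l)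
  w≤w1 : ∀ i → i < m → w (suc i) ≤ w 1
  w≤w1 zero l = ≤-refl
  w≤w1 (suc i) l = ≤-trans (w-decreasing (s≤s l)) (w≤w1 i (≤-trans (n≤1+n (suc i)) l))
  Σv<w0 : Σv < w 0
  Σv<w0 = bound m refl
    where
    bound : ∀ m′ → m′ ≡ m → Σv < w 0
    -- With an empty tail there is no second weight to compare with; positivity of the first
    -- suffices.
    bound zero refl = w≥1 (s≤s z≤n)
    bound (suc _) refl = begin-strict
      Σv                            ≤⟨ ∑-≤ (upTo m) (λ {i} j → *-mono-≤ (v≤M (s≤s (∈-upTo⁻ j))) (w≤w1 i (∈-upTo⁻ j))) ⟩
      length (upTo m) * (M * w 1)  ≡⟨ trans (cong (_* (M * w 1)) (List.length-upTo m)) (sym (*-assoc m M (w 1))) ⟩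
      m * M * w 1                  ≤⟨ *-monoˡ-≤ (w 1) (*-monoˡ-≤ M (n≤1+n m)) ⟩
      suc m * M * w 1              <⟨ m<n+m (suc m * M * w 1) (w≥1 (s≤s (s≤s z≤n))) ⟩
      suc (suc m * M) * w 1        ≤⟨ decay (s≤s (s≤s z≤n)) ⟩
      w 0                          ∎
  compare : _ → Vec.tabulate {n = suc m} (u ∘ toℕ) ≤ₗₑₓ Vec.tabulate {n = suc m} (v ∘ toℕ)
  compare (tri< u<v _ _) = this u<v refl
  compare (tri≈ _ u≡v _) = next u≡v (weights⇒lex m M (u ∘ suc) (v ∘ suc) (w ∘ suc) (v≤M ∘ s≤s) (w≥1 ∘ s≤s)
    (λ l → ≤-trans (*-monoˡ-≤ _ (s≤s (*-monoˡ-≤ M (n≤1+n m)))) (decay (s≤s l)))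
    (+-cancelˡ-≤ (v 0 * w 0) _ _ (subst (λ z → z * w 0 + Σu ≤ v 0 * w 0 + Σv) u≡v le′)))
  compare (tri> _ _ v<u) = ⊥-elim $ <⇒≱ (begin-strict
    v 0 * w 0 + Σv       <⟨ +-monoʳ-< (v 0 * w 0) Σv<w0 ⟩
    v 0 * w 0 + w 0     ≡⟨ +-comm (v 0 * w 0) (w 0) ⟩
    suc (v 0) * w 0     ≤⟨ *-monoˡ-≤ (w 0) v<u ⟩
    u 0 * w 0           ≤⟨ m≤m+n _ Σu ⟩
    u 0 * w 0 + Σu       ∎) le′

pointwise⇒lex : ∀ m (u v : ℕ → ℕ) → (∀ i → u i ≤ v i) →
                Vec.tabulate {n = m} (u ∘ toℕ) ≤ₗₑₓ Vec.tabulate {n = m} (v ∘ toℕ)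
pointwise⇒lex zero u v h = base tt
pointwise⇒lex (suc m) u v h with m≤n⇒m<n∨m≡n (h 0)
... | inj₁ lt = this lt refl
... | inj₂ eq = next eq (pointwise⇒lex m (u ∘ suc) (v ∘ suc) (h ∘ suc))

∑-bySize : ∀ (xs : List (Subset n)) t D (f : ℕ → ℕ) → (∀ {A} → A ∈ₗ xs → t ≤ ∣ A ∣ × ∣ A ∣ ≤ t + D) →
           ∑ xs (λ A → f ∣ A ∣) ≡ ∑ (upTo (suc D)) (λ j → length (filter (λ A → ∣ A ∣ ≟ t + j) xs) * f (t + j))
∑-bySize xs t D f h = sym (begin
  ∑ (upTo (suc D)) (λ j → length (filter (λ A → ∣ A ∣ ≟ t + j) xs) * f (t + j))
    ≡⟨ ∑-cong (upTo (suc D)) (λ {j} _ → trans (cong (_* f (t + j)) (length-filter≡∑ (λ A → ∣ A ∣ ≟ t + j) xs)) (sym (∑-* xs _ (f (t + j))))) ⟩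
  ∑ (upTo (suc D)) (λ j → ∑ xs (λ A → indicator (∣ A ∣ ≟ t + j) * f (t + j)))
    ≡⟨ ∑-swap (upTo (suc D)) xs (λ j A → indicator (∣ A ∣ ≟ t + j) * f (t + j)) ⟩
  ∑ xs (λ A → ∑ (upTo (suc D)) (λ j → indicator (∣ A ∣ ≟ t + j) * f (t + j)))
    ≡⟨ ∑-cong xs (λ {A} i → let d , eq = ≤⇒∃ (proj₁ (h i)) in
         subst (λ z → ∑ (upTo (suc D)) (λ j → indicator (z ≟ t + j) * f (t + j)) ≡ f z) eq
           (pick D d (+-cancelˡ-≤ t d D (≤-trans (≤-reflexive eq) (proj₂ (h i)))))) ⟩
  ∑ xs (λ A → f ∣ A ∣) ∎)
  where
  open ≡-Reasoning
  ≤⇒∃ : ∀ {a b} → a ≤ b → ∃[ d ] a + d ≡ b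
  ≤⇒∃ {a} {b} l = b ∸ a , m+[n∸m]≡n l
  term : ℕ → ℕ → ℕ
  term d j = indicator (t + d ≟ t + j) * f (t + j)
  term-≡ : ∀ d → term d d ≡ f (t + d)
  term-≡ d with t + d ≟ t + d
  ... | yes _ = +-identityʳ _
  ... | no ne = contradiction refl ne
  term-≢ : ∀ {d j} → d ≢ j → term d j ≡ 0
  term-≢ {d} {j} ne with t + d ≟ t + j
  ... | yes e = contradiction (+-cancelˡ-≡ t d j e) ne
  ... | no _ = refl
  pick : ∀ D d → d ≤ D → ∑ (upTo (suc D)) (term d) ≡ f (t + d)
  pick D d l with m≤n⇒m<n∨m≡n l
  pick (suc D) d l | inj₁ (s≤s d≤D) = trans (∑-upTo-∷ʳ (suc D) (term d))
    (trans (cong₂ _+_ (pick D d d≤D) (term-≢ (<⇒≢ (s≤s d≤D)))) (+-identityʳ _))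
  pick D d l | inj₂ refl = trans (∑-upTo-∷ʳ d (term d)) (trans (cong (_+ term d d)
    (trans (∑-cong (upTo d) λ i → term-≢ (λ e → <⇒≢ (∈-upTo⁻ i) (sym e))) (∑-0 (upTo d)))) (term-≡ d))

module _ {n t T k : ℕ} (𝓣 : Family n) (t≤T : t ≤ T) (T≤k : T ≤ k) (T≤n : T ≤ n)
  (base≤T : ∣ supp (𝓣 ⟨ t ⟩) ∣ ≤ T)
  (sizes : ∀ {A} → A ∈ᶠ 𝓣 → t ≤ ∣ A ∣ × ∣ A ∣ ≤ ∣ supp (𝓣 ⟨ t ⟩) ∣) where

  private
    y q D p : ℕ
    y = ∣ supp (𝓣 ⟨ t ⟩) ∣
    q = T ∸ y
    D = T ∸ t
    p = n ∸ T

    N w : ℕ → ℕ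
    N j = size (𝓣 ⟨ t + j ⟩)
    w i = p C (k ∸ t ∸ i)

    N≡0⊎ : ∀ j → N j ≡ 0 ⊎ t + j ≤ y
    N≡0⊎ j = nonempty (members (𝓣 ⟨ t + j ⟩)) λ {A} i →
      let A∈ , e = ∈-filter⁻ (λ A → ∣ A ∣ ≟ t + j) {xs = members 𝓣} i in ≤-trans (≤-reflexive (sym e)) (proj₂ (sizes A∈))
      where
      nonempty : ∀ (xs : List (Subset n)) → (∀ {A} → A ∈ₗ xs → t + j ≤ y) → length xs ≡ 0 ⊎ t + j ≤ y
      nonempty [] _ = inj₁ refl
      nonempty (A ∷ _) h = inj₂ (h (here refl))

    expand : ∀ j → N j * ((n ∸ y) C (k ∸ (t + j))) ≡ ∑ (upTo (suc D ∸ j)) (λ l → N j * (q C l) * w (j + l))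
    expand j with N≡0⊎ j
    ... | inj₁ e = trans (cong (_* ((n ∸ y) C (k ∸ (t + j)))) e) (sym (trans
      (∑-cong (upTo (suc D ∸ j)) λ {l} _ → cong (λ z → z * (q C l) * w (j + l)) e) (∑-0 (upTo (suc D ∸ j)))))
    ... | inj₂ l = begin
      N j * ((n ∸ y) C (k ∸ (t + j)))
        ≡⟨ cong₂ (λ a b → N j * (a C b)) n∸y (sym (∸-+-assoc k t j)) ⟩
      N j * ((q + p) C (k ∸ t ∸ j))
        ≡⟨ cong (N j *_) (vandermonde q p (D ∸ j) (k ∸ t ∸ j) q≤ (∸-monoˡ-≤ j (∸-monoˡ-≤ t T≤k))) ⟩
      N j * ∑ (upTo (suc (D ∸ j))) (λ l → (q C l) * (p C (k ∸ t ∸ j ∸ l)))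
        ≡⟨ ∑-*ˡ (upTo (suc (D ∸ j))) (N j) _ ⟨
      ∑ (upTo (suc (D ∸ j))) (λ l → N j * ((q C l) * (p C (k ∸ t ∸ j ∸ l))))
        ≡⟨ ∑-cong (upTo (suc (D ∸ j))) (λ {l} _ → trans (sym (*-assoc (N j) (q C l) _)) (cong (λ z → N j * (q C l) * (p C z)) (∸-+-assoc (k ∸ t) j l))) ⟩
      ∑ (upTo (suc (D ∸ j))) (λ l → N j * (q C l) * w (j + l))
        ≡⟨ cong (λ z → ∑ (upTo z) (λ l → N j * (q C l) * w (j + l))) (sym (+-∸-assoc 1 j≤D)) ⟩
      ∑ (upTo (suc D ∸ j)) (λ l → N j * (q C l) * w (j + l)) ∎
      where
      open ≡-Reasoning
      j≤D : j ≤ D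
      j≤D = ≤-trans (≤-reflexive (sym (m+n∸m≡n t j))) (∸-monoˡ-≤ t (≤-trans l base≤T))
      q≤ : q ≤ D ∸ j
      q≤ = ≤-trans (∸-monoʳ-≤ T l) (≤-reflexive (sym (∸-+-assoc T t j)))
      n∸y : n ∸ y ≡ q + p
      n∸y = +-cancelˡ-≡ y _ _ (trans (m+[n∸m]≡n (≤-trans base≤T T≤n)) (sym (trans (sym (+-assoc y q p))
        (trans (cong (_+ p) (m+[n∸m]≡n base≤T)) (m+[n∸m]≡n T≤n)))))

  -- Vandermonde's identity splits off the T - y points missing in the base.
  -- Since members of 𝓣 have at most y elements, the sum may stop at i = T - t.
  weightedSize : ∑ (members 𝓣) (λ A → (n ∸ y) C (k ∸ ∣ A ∣)) ≡
                 ∑ (upTo (suc D)) (λ i → φ̃-component t T 𝓣 i * (p C (k ∸ t ∸ i)))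
  weightedSize = begin
    ∑ (members 𝓣) (λ A → (n ∸ y) C (k ∸ ∣ A ∣))
      ≡⟨ ∑-bySize (members 𝓣) t D (λ z → (n ∸ y) C (k ∸ z)) (λ i → proj₁ (sizes i) ,
           ≤-trans (proj₂ (sizes i)) (≤-trans base≤T (≤-reflexive (sym (m+[n∸m]≡n t≤T))))) ⟩
    ∑ (upTo (suc D)) (λ j → N j * ((n ∸ y) C (k ∸ (t + j))))
      ≡⟨ ∑-cong (upTo (suc D)) (λ {j} _ → expand j) ⟩
    ∑ (upTo (suc D)) (λ j → ∑ (upTo (suc D ∸ j)) (λ l → N j * (q C l) * w (j + l)))
      ≡⟨ ∑-triangle (suc D) (λ j l → N j * (q C l) * w (j + l)) ⟩
    ∑ (upTo (suc D)) (λ i → ∑ (upTo (suc i)) (λ j → N j * (q C (i ∸ j)) * w (j + (i ∸ j))))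
      ≡⟨ ∑-cong (upTo (suc D)) (λ {i} _ → component i) ⟩
    ∑ (upTo (suc D)) (λ i → φ̃-component t T 𝓣 i * w i) ∎
    where
    open ≡-Reasoning
    component : ∀ i → ∑ (upTo (suc i)) (λ j → N j * (q C (i ∸ j)) * w (j + (i ∸ j))) ≡ φ̃-component t T 𝓣 i * w i
    component i = begin
      ∑ (upTo (suc i)) (λ j → N j * (q C (i ∸ j)) * w (j + (i ∸ j)))
        ≡⟨ ∑-cong (upTo (suc i)) (λ {j} m → cong (λ z → N j * (q C (i ∸ j)) * w z) (m+[n∸m]≡n (s≤s⁻¹ (∈-upTo⁻ m)))) ⟩
      ∑ (upTo (suc i)) (λ j → N j * (q C (i ∸ j)) * w i)
        ≡⟨ ∑-* (upTo (suc i)) (λ j → N j * (q C (i ∸ j))) (w i) ⟩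
      ∑ (upTo (suc i)) (λ j → N j * (q C (i ∸ j))) * w i
        ≡⟨ cong (_* w i) (trans (∑-upTo-∷ʳ i (λ j → N j * (q C (i ∸ j)))) (trans (+-comm (∑ (upTo i) (λ j → N j * (q C (i ∸ j)))) _)
             (cong (_+ ∑ (upTo i) (λ j → N j * (q C (i ∸ j)))) (trans (cong (λ z → N i * (q C z)) (n∸n≡0 i)) (trans (cong (N i *_) (nC0≡1 q)) (*-identityʳ (N i))))))) ⟩
      φ̃-component t T 𝓣 i * w i ∎

componentBound : ℕ → ℕ → ℕ
componentBound T b = b + T * (b * suc T ^ T)

component≤ : ∀ (𝓣 : Family n) t T {b} i → i ≤ T → size 𝓣 ≤ b → φ̃-component t T 𝓣 i ≤ componentBound T b
component≤ 𝓣 t T {b} i i≤T l = +-mono-≤ (N≤ i) (≤-trans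
  (∑-≤ (upTo i) λ {j} _ → *-mono-≤ (N≤ j) (≤-trans (nCr≤n^r (T ∸ ∣ supp (𝓣 ⟨ t ⟩) ∣) (i ∸ j))
    (≤-trans (^-monoˡ-≤ (i ∸ j) (≤-trans (m∸n≤m T ∣ supp (𝓣 ⟨ t ⟩) ∣) (n≤1+n T))) (^-monoʳ-≤ (suc T) (≤-trans (m∸n≤m i j) i≤T)))))
  (*-monoˡ-≤ (b * suc T ^ T) (≤-trans (≤-reflexive (List.length-upTo i)) i≤T)))
  where
  N≤ : ∀ j → size (𝓣 ⟨ t + j ⟩) ≤ b
  N≤ j = ≤-trans (List.length-filter (λ A → ∣ A ∣ ≟ t + j) (members 𝓣)) l

-- The family of saturated traces

-- One point of `Y` is chosen in each petal. Since the core is empty, these singletons have pairwise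
-- empty intersections and form a kernel system over the empty set.
meeting-sunflowerFree : ∀ {s n} {P : Pred (Subset n) 0ℓ} (Y : Subset n) → Avoids s 0 P → (∀ {x} → x ∈ Y → P ⁅ x ⁆) →
                        {𝓖 : Family n} → (∀ {X} → X ∈ᶠ 𝓖 → Nonempty (X ∩ Y)) → ¬ ContainsSunflower s (_≡ 0) 𝓖
meeting-sunflowerFree {s} {n} Y av single h (F , sf , mem , e) = av (λ i → ⁅ y i ⁆) (core F)
    ((λ i p → ⊥-elim (empty p)) , λ {i} {j} ne {x} p q →
      proj₂ (sunflower⇒kernel sf) ne (subst (_∈ F i) (sym (x∈⁅y⁆⇒x≡y (y i) p)) (y∈F i)) (subst (_∈ F j) (sym (x∈⁅y⁆⇒x≡y (y j) q)) (y∈F j)))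
    (λ i → single (∩ʳ (F i) Y (proj₂ (h (mem i))))) (≤-reflexive e)
  where
  y : Fin s → Fin n
  y i = proj₁ (h (mem i))
  y∈F : ∀ i → y i ∈ F i
  y∈F i = ∩ˡ (F i) Y (proj₂ (h (mem i)))
  empty : ∀ {x} → x ∉ core F
  empty p = contradiction (≤-trans (x∈p⇒∣p-x∣<∣p∣ p) (≤-reflexive e)) λ ()

singleton : ∀ {n} {A : Subset n} {x} → ∣ A ∣ ≡ 1 → x ∈ A → A ≡ ⁅ x ⁆
singleton {A = A} {x} e p = sym (⊆∧∣∣⇒≡ (λ q → subst (_∈ A) (sym (x∈⁅y⁆⇒x≡y x q)) p) (≤-reflexive (trans e (sym (∣⁅x⁆∣≡1 x)))))

nonempty : ∀ {n} (A : Subset n) → 1 ≤ ∣ A ∣ → Nonempty A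
nonempty {n} A l = decidable-stable (nonempty? A) λ ne →
  contradiction (≤-trans l (≤-reflexive (trans (cong ∣_∣ (Empty-unique ne)) (∣⊥∣≡0 n)))) λ ()

-- T points for the base; the rest makes consecutive weights C(n - T, k - t - i) differ, by
-- `C-ratio`, at least by the factor (T - t + 1) M + 1, where M bounds the components of 𝓢.
lexThreshold : ℕ → ℕ → ℕ
lexThreshold k T = T + suc k * (2 + suc T * componentBound T (2 ^ T))

-- The family 𝒮(Y) consists of the traces A on the base Y for which 𝓕 contains
-- all k-sets with trace A; this holds vacuously if k < |A|, which may happen
-- only for t = 1.
module Base {s k c n : ℕ} (S : Setting s k c n) (T : ℕ) (Y : Subset n) where

  open Setting S

  Filled : Subset n → Set
  Filled A = All (_∈ᶠ 𝓕) (slice Y A k)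

  filled⁻ : ∀ {A X} → Filled A → ∣ X ∣ ≡ k → X ∩ Y ≡ A → X ∈ᶠ 𝓕
  filled⁻ {A} {X} f e eq = All.lookup f (subst (λ B → X ∈ₗ slice Y B k) eq (∈-slice⁺ Y e))

  filled⁺ : ∀ {A} → A ⊆ Y → (∀ {X} → ∣ X ∣ ≡ k → X ∩ Y ≡ A → X ∈ᶠ 𝓕) → Filled A
  filled⁺ {A} s h = All.tabulate λ i → let e , eq = ∈-slice⁻ Y A s i in h e eq

  Member : Subset n → Set
  Member A = (A ⊆ Y) × c < ∣ A ∣ × Filled A

  member? : Decidable Member
  member? A = (A ⊆? Y) ×-dec (c <? ∣ A ∣) ×-dec All.all? (_∈ₗ? members 𝓕) (slice Y A k)

  𝓢 : Family n
  𝓢 = familyOf member?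

  Good : Set
  Good = ∣ Y ∣ ≤ T × (Y ⊆ supp (𝓢 ⟨ suc c ⟩)) × All (λ F → c < ∣ F ∩ Y ∣ × Filled (F ∩ Y)) (members 𝓕)

  good? : Dec Good
  good? = (∣ Y ∣ ≤? T) ×-dec (Y ⊆? supp (𝓢 ⟨ suc c ⟩)) ×-dec
          All.all? (λ F → (c <? ∣ F ∩ Y ∣) ×-dec All.all? (_∈ₗ? members 𝓕) (slice Y (F ∩ Y) k)) (members 𝓕)

  𝓢⁻ : ∀ {A} → A ∈ᶠ 𝓢 → Member A
  𝓢⁻ = ∈-familyOf⁻ member?

  cover⁺ : ∀ {G x} → Member G → ∣ G ∣ ≡ suc c → x ∈ G → x ∈ supp (𝓢 ⟨ suc c ⟩)
  cover⁺ m e p = ∈⋃⁺ (∈-filter⁺ (λ A → ∣ A ∣ ≟ suc c) (∈-familyOf⁺ member? m) e) p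

  cover⁻ : ∀ {x} → x ∈ supp (𝓢 ⟨ suc c ⟩) → ∃[ G ] Member G × ∣ G ∣ ≡ suc c × x ∈ G
  cover⁻ p = let G , i , x∈ = ∈⋃⁻ (members (𝓢 ⟨ suc c ⟩)) p
                 G∈ , e = ∈-filter⁻ (λ A → ∣ A ∣ ≟ suc c) {xs = members 𝓢} i
             in G , 𝓢⁻ G∈ , e , x∈

  module Conclude (good : Good) (large : T + s * k + k ≤ n) where

    ∣Y∣≤T : ∣ Y ∣ ≤ T
    ∣Y∣≤T = proj₁ good

    supp≡Y : supp (𝓢 ⟨ suc c ⟩) ≡ Y
    supp≡Y = ⊆-antisym (λ p → let G , m , _ , x∈ = cover⁻ p in proj₁ m x∈) (proj₁ (proj₂ good))

    supported : SupportedOnBase (suc c) T 𝓢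
    supported {A} i = let s , c< , _ = 𝓢⁻ i in
      (λ p → proj₁ (proj₂ good) (s p)) , c< , ≤-trans (∣⊆∣ A Y s) ∣Y∣≤T

    membership : ∀ A → A ∈ᶠ 𝓕 ⇔ (∣ A ∣ ≡ k × A ∩ supp (𝓢 ⟨ suc c ⟩) ∈ᶠ 𝓢)
    membership A = mk⇔
      (λ i → uniform i , subst (λ Z → A ∩ Z ∈ᶠ 𝓢) (sym supp≡Y)
        (let c< , f = All.lookup (proj₂ (proj₂ good)) i in ∈-familyOf⁺ member? (∩ʳ A Y , c< , f)))
      (λ (e , i) → let _ , _ , f = 𝓢⁻ (subst (λ Z → A ∩ Z ∈ᶠ 𝓢) supp≡Y i) in filled⁻ f e refl)

    member-extendable : ∀ {A D} → Member A → Disj D Y → ∣ A ∪ D ∣ ≤ k → Extendable (A ∪ D)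
    member-extendable (A⊆Y , _ , f) disj l = saturated⇒extendable S ∣Y∣≤T A⊆Y disj l large (filled⁻ f)

    ∪∅ : ∀ (A : Subset n) → A ∪ ∅ ≡ A
    ∪∅ A = ⊆-antisym (∪-⊆ id (λ p → ⊥-elim (∉⊥ p))) ∪ˡ

    -- For t = 1 a member of 𝓢 may have more than k elements and need not be extendable. One point
    -- is taken from each petal instead; it lies in `Y`, which is covered by extendable singletons,
    -- and no two petals share a point.
    avoids₀ : c ≡ 0 → Avoids s c (_∈ᶠ 𝓢)
    avoids₀ c≡0 A K ker mem l = noKernel {∅} {λ i → ⁅ a i ⁆}
        ((λ i p → ⊥-elim (∉⊥ p)) , λ {i} {j} ne p q → ⊥-elim (emptyK (proj₂ ker ne
          (subst (_∈ A i) (sym (x∈⁅y⁆⇒x≡y (a i) p)) (proj₂ (pick i))) (subst (_∈ A j) (sym (x∈⁅y⁆⇒x≡y (a j) q)) (proj₂ (pick j))))))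
        extendable (trans (∣⊥∣≡0 n) (sym c≡0))
      where
      pick : ∀ i → Nonempty (A i)
      pick i = nonempty (A i) (≤-trans (s≤s z≤n) (proj₁ (proj₂ (𝓢⁻ (mem i)))))
      a : Fin s → Fin n
      a i = proj₁ (pick i)
      emptyK : ∀ {x} → x ∉ K
      emptyK p = contradiction (≤-trans (x∈p⇒∣p-x∣<∣p∣ p) (≤-trans l (≤-reflexive c≡0))) λ ()
      extendable : ∀ i → Extendable ⁅ a i ⁆
      extendable i =
        let G , m , e , p = cover⁻ (proj₁ (proj₂ good) (proj₁ (𝓢⁻ (mem i)) (proj₂ (pick i))))
        in subst Extendable (trans (∪∅ G) (singleton (trans e (cong suc c≡0)) p))
             (member-extendable m (λ _ q _ → ∉⊥ q) (≤-trans (≤-reflexive (trans (cong ∣_∣ (∪∅ G)) e)) c<k))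

    -- One set `D` outside `Y` enlarges the kernel to size c. There is room to join it to every
    -- petal, and the results are extendable because all traces in 𝓢 are filled.
    avoids₁ : T + c ≤ k → Avoids s c (_∈ᶠ 𝓢)
    avoids₁ T+c≤k A K ker mem l = noKernel (kernel-∪ S {K} {D} ker)
        (λ i → member-extendable (𝓢⁻ (mem i)) (λ x p q → x∈∁p⇒x∉p (D⊆ p) q) (≤-trans (∣∪∣≤ (A i) D)
          (≤-trans (+-mono-≤ (≤-trans (∣⊆∣ (A i) Y (proj₁ (𝓢⁻ (mem i)))) ∣Y∣≤T) (≤-trans (≤-reflexive ∣D∣) (m∸n≤m c ∣ K ∣))) T+c≤k)))
        (trans (∣∪∣-disj K D λ x p q → x∈∁p⇒x∉p (D⊆ q) (proj₁ (𝓢⁻ (mem (someIndex S))) (proj₁ ker (someIndex S) p)))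
          (trans (cong (∣ K ∣ +_) ∣D∣) (m+[n∸m]≡n l)))
      where
      room : c ∸ ∣ K ∣ ≤ ∣ ∁ Y ∣
      room = begin
        c ∸ ∣ K ∣               ≤⟨ m∸n≤m c ∣ K ∣ ⟩
        c                       ≤⟨ <⇒≤ c<k ⟩
        k                       ≤⟨ m≤n+m k (s * k) ⟩
        s * k + k               ≡⟨ trans (cong (_∸ T) (+-assoc T (s * k) k)) (m+n∸m≡n T _) ⟨
        T + s * k + k ∸ T       ≤⟨ ∸-mono large ∣Y∣≤T ⟩
        n ∸ ∣ Y ∣               ≡⟨ ∣∁p∣≡n∸∣p∣ Y ⟨
        ∣ ∁ Y ∣                 ∎
        where open ≤-Reasoning
      chosen : ∃[ D ] D ⊆ ∁ Y × ∣ D ∣ ≡ c ∸ ∣ K ∣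
      chosen = subsetOfSize (∁ Y) room
      D = proj₁ chosen
      D⊆ = proj₁ (proj₂ chosen)
      ∣D∣ = proj₂ (proj₂ chosen)

    module Lex (T+c≤k : T + c ≤ k) (t≤T : suc c ≤ T) (lexLarge : lexThreshold k T ≤ n)
      (bound : ∀ (𝓐 : Family n) → Uniform (suc c) 𝓐 → ¬ ContainsSunflower s U 𝓐 → suc c * size 𝓐 ≤ T) where

      T≤k : T ≤ k
      T≤k = ≤-trans (m≤m+n T c) T+c≤k

      T≤n : T ≤ n
      T≤n = ≤-trans (≤-trans (m≤m+n T (s * k)) (m≤m+n (T + s * k) k)) large

      M : ℕ
      M = componentBound T (2 ^ T)

      ratio : suc k * (2 + suc T * M) ≤ n ∸ T
      ratio = ≤-trans (≤-reflexive (sym (m+n∸m≡n T _))) (∸-monoˡ-≤ T lexLarge)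

      k≤n∸T : k ≤ n ∸ T
      k≤n∸T = ≤-trans (n≤1+n k) (≤-trans (≤-trans (≤-reflexive (sym (*-identityʳ (suc k)))) (*-monoʳ-≤ (suc k) (s≤s z≤n))) ratio)

      total≤ : ∑ (members 𝓢) (λ A → (n ∸ ∣ supp (𝓢 ⟨ suc c ⟩) ∣) C (k ∸ ∣ A ∣)) ≡ length (slices Y k (members 𝓢))
      total≤ = trans (cong (λ Z → ∑ (members 𝓢) (λ A → (n ∸ ∣ Z ∣) C (k ∸ ∣ A ∣))) supp≡Y)
        (sym (length-slices Y k (members 𝓢) λ {A} i → let s , _ = 𝓢⁻ i in s , ≤-trans (∣⊆∣ A Y s) (≤-trans ∣Y∣≤T T≤k)))

      size≤ : size 𝓕 ≤ length (slices Y k (members 𝓢))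
      size≤ = Unique-⊆⇒length≤ (unique 𝓕) λ i → ∈-slices⁺ Y (uniform i)
        (let c< , f = All.lookup (proj₂ (proj₂ good)) i in ∈-familyOf⁺ member? (∩ʳ _ Y , c< , f))

      size𝓢 : size 𝓢 ≤ 2 ^ T
      size𝓢 = ≤-trans (Unique-⊆⇒length≤ (unique 𝓢) (λ i → ∈-subsets⁺ (proj₁ (𝓢⁻ i))))
        (≤-trans (≤-reflexive (length-subsets Y)) (^-monoʳ-≤ 2 ∣Y∣≤T))

      suc-∸ : ∀ i → suc i < suc (T ∸ suc c) → k ∸ suc c ∸ i ≡ suc (k ∸ suc c ∸ suc i)
      suc-∸ i (s≤s l) = sym (trans (sym (+-∸-assoc 1 {k ∸ suc c} {suc i} (≤-trans l (∸-monoˡ-≤ (suc c) T≤k)))) refl)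

      decay : ∀ {i} → suc i < suc (T ∸ suc c) →
              suc (suc (T ∸ suc c) * M) * ((n ∸ T) C (k ∸ suc c ∸ suc i)) ≤ (n ∸ T) C (k ∸ suc c ∸ i)
      decay {i} l = ≤-trans (C-ratio (suc (suc (T ∸ suc c) * M)) (n ∸ T) (k ∸ suc c ∸ suc i) (begin
          suc (k ∸ suc c ∸ suc i) * (2 + suc (T ∸ suc c) * M)  ≤⟨ *-mono-≤ (s≤s (≤-trans (m∸n≤m (k ∸ suc c) (suc i)) (m∸n≤m k (suc c)))) (s≤s (s≤s (*-monoˡ-≤ M (s≤s (m∸n≤m T (suc c)))))) ⟩
          suc k * (2 + suc T * M)                              ≤⟨ ratio ⟩
          n ∸ T                                                ≤⟨ n≤1+n (n ∸ T) ⟩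
          suc (n ∸ T)                                          ∎))
        (≤-reflexive (cong ((n ∸ T) C_) (sym (suc-∸ i l))))
        where open ≤-Reasoning

      lexMaximal : IsLexMaximal s (suc c) T 𝓢
      lexMaximal 𝓣 none sup = weights⇒lex (suc (T ∸ suc c)) M (φ̃-component (suc c) T 𝓣) (φ̃-component (suc c) T 𝓢)
          (λ i → (n ∸ T) C (k ∸ suc c ∸ i))
          (λ {i} l → component≤ 𝓢 (suc c) T i (≤-trans (s≤s⁻¹ l) (m∸n≤m T (suc c))) size𝓢)
          (λ {i} _ → C-positive (n ∸ T) (k ∸ suc c ∸ i) (≤-trans (≤-trans (m∸n≤m (k ∸ suc c) i) (m∸n≤m k (suc c))) k≤n∸T))
          decay (begin
            ∑ (upTo (suc (T ∸ suc c))) (λ i → φ̃-component (suc c) T 𝓣 i * ((n ∸ T) C (k ∸ suc c ∸ i)))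
              ≡⟨ weightedSize 𝓣 t≤T T≤k T≤n base≤T (λ {A} i → proj₁ (proj₂ (sup i)) , ∣⊆∣ A Y′ (proj₁ (sup i))) ⟨
            ∑ (members 𝓣) (λ A → (n ∸ ∣ Y′ ∣) C (k ∸ ∣ A ∣))
              ≡⟨ length-slices Y′ k (members 𝓣) (λ i → proj₁ (sup i) , ≤-trans (proj₂ (proj₂ (sup i))) T≤k) ⟨
            size new
              ≤⟨ maximal new (λ i → proj₁ (in-new i)) (traces-sunflowerFree S {_∈ᶠ 𝓣} Y′ av {new} (λ i → proj₂ (in-new i))) ⟩
            size 𝓕
              ≤⟨ size≤ ⟩
            length (slices Y k (members 𝓢))
              ≡⟨ total≤ ⟨
            ∑ (members 𝓢) (λ A → (n ∸ ∣ supp (𝓢 ⟨ suc c ⟩) ∣) C (k ∸ ∣ A ∣))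
              ≡⟨ weightedSize 𝓢 t≤T T≤k T≤n (≤-trans (≤-reflexive (cong ∣_∣ supp≡Y)) ∣Y∣≤T)
                   (λ {A} i → proj₁ (proj₂ (𝓢⁻ i)) , ∣⊆∣ A (supp (𝓢 ⟨ suc c ⟩)) (proj₁ (supported i))) ⟩
            ∑ (upTo (suc (T ∸ suc c))) (λ i → φ̃-component (suc c) T 𝓢 i * ((n ∸ T) C (k ∸ suc c ∸ i))) ∎)
        where
        open ≤-Reasoning
        Y′ : Subset n
        Y′ = supp (𝓣 ⟨ suc c ⟩)
        av : Avoids s c (_∈ᶠ 𝓣)
        av = ¬contains⇒avoids {𝓢 = 𝓣} 2≤s (λ i → proj₁ (proj₂ (sup i))) none
        level : ∀ {A} → A ∈ᶠ 𝓣 ⟨ suc c ⟩ → A ∈ᶠ 𝓣 × ∣ A ∣ ≡ suc c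
        level i = ∈-filter⁻ (λ A → ∣ A ∣ ≟ suc c) {xs = members 𝓣} i
        base≤T : ∣ Y′ ∣ ≤ T
        base≤T = ≤-trans (∣⋃∣≤ (members (𝓣 ⟨ suc c ⟩)) (λ i → ≤-reflexive (proj₂ (level i))))
          (≤-trans (≤-reflexive (*-comm (size (𝓣 ⟨ suc c ⟩)) (suc c))) (bound (𝓣 ⟨ suc c ⟩) (proj₂ ∘ level)
            (avoids⇒sunflowerFree {𝓐 = 𝓣 ⟨ suc c ⟩} 2≤s (proj₂ ∘ level) λ A K ker mem → av A K ker (proj₁ ∘ level ∘ mem))))
        new : Family n
        new = family (slices Y′ k (members 𝓣)) (slices-unique Y′ k (unique 𝓣) (λ i → proj₁ (sup i)))
        in-new : ∀ {X} → X ∈ᶠ new → ∣ X ∣ ≡ k × X ∩ Y′ ∈ᶠ 𝓣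
        in-new = ∈-slices⁻ Y′ (λ i → proj₁ (sup i))

C-strict : ∀ {m m′ k} → m < m′ → 1 ≤ k → k ≤ m′ → m C k < m′ C k
C-strict {m} {suc m′} {suc k} (s≤s m≤m′) _ (s≤s k≤m′) = begin-strict
  m C suc k                ≤⟨ C-monoˡ-≤ (suc k) m≤m′ ⟩
  m′ C suc k               <⟨ m<n+m (m′ C suc k) (C-positive m′ k k≤m′) ⟩
  m′ C k + m′ C suc k      ≡⟨ pascal m′ k ⟨
  suc m′ C suc k           ∎
  where open ≤-Reasoning

-- The case t = 1

module Matching {s k n : ℕ} (S : Setting s k 0 n) where

  open Setting S

  meets? : ∀ (Y : Subset n) → Decidable (λ X → ∣ X ∣ ≡ k × Nonempty (X ∩ Y))
  meets? Y X = (∣ X ∣ ≟ k) ×-dec nonempty? (X ∩ Y)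

  meetingFamily : Subset n → Family n
  meetingFamily Y = familyOf (meets? Y)

  module _ (Y : Subset n) (P : Pred (Subset n) 0ℓ) (av : Avoids s 0 P) (single : ∀ {x} → x ∈ Y → P ⁅ x ⁆) where

    meetingFamily≤ : size (meetingFamily Y) ≤ size 𝓕
    meetingFamily≤ = maximal (meetingFamily Y) (λ i → proj₁ (∈-familyOf⁻ (meets? Y) i))
      (meeting-sunflowerFree {P = P} Y av single {meetingFamily Y} (λ i → proj₂ (∈-familyOf⁻ (meets? Y) i)))

    meeting⇒member : (∀ {F} → F ∈ᶠ 𝓕 → Nonempty (F ∩ Y)) → ∀ {X} → ∣ X ∣ ≡ k → Nonempty (X ∩ Y) → X ∈ᶠ 𝓕
    meeting⇒member h {X} e ne = decidable-stable (X ∈ₗ? members 𝓕) λ ni → 1+n≰n (≤-trans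
      (Unique-⊆⇒length≤ {xs = X ∷ members 𝓕} (All.tabulate (λ i eq → ni (subst (_∈ᶠ 𝓕) (sym eq) i)) ∷ unique 𝓕) λ where
        (here refl) → ∈-familyOf⁺ (meets? Y) (e , ne)
        (there i) → ∈-familyOf⁺ (meets? Y) (uniform i , h i))
      meetingFamily≤)

    count≥ : n C k ≤ size 𝓕 + (n ∸ ∣ Y ∣) C k
    count≥ = begin
      n C k                                             ≡⟨ length-sized n k ⟨
      length (sized n k)                                ≤⟨ Unique-⊆⇒length≤ (slice-unique ∅ ∅ k) split ⟩
      length (members (meetingFamily Y) ++ slice Y ∅ k) ≡⟨ List.length-++ (members (meetingFamily Y)) ⟩
      size (meetingFamily Y) + length (slice Y ∅ k)     ≤⟨ +-mono-≤ meetingFamily≤ (≤-reflexive (length-missing Y)) ⟩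
      size 𝓕 + (n ∸ ∣ Y ∣) C k                          ∎
      where
      open ≤-Reasoning
      length-missing : ∀ (Y : Subset n) → length (slice Y ∅ k) ≡ (n ∸ ∣ Y ∣) C k
      length-missing Y = trans (length-slice Y ∅ k (⊆-min Y) (∣∅∣≤ n))
        (cong₂ _C_ (∣∁p∣≡n∸∣p∣ Y) (cong (k ∸_) (∣⊥∣≡0 n)))
      split : ∀ {X} → X ∈ₗ sized n k → X ∈ₗ members (meetingFamily Y) ++ slice Y ∅ k
      split {X} i = decide (nonempty? (X ∩ Y))
        where
        decide : Dec (Nonempty (X ∩ Y)) → X ∈ₗ members (meetingFamily Y) ++ slice Y ∅ k
        decide (yes ne) = ∈-++⁺ˡ (∈-familyOf⁺ (meets? Y) (∈-sized⁻ i , ne))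
        decide (no ne) = ∈-++⁺ʳ (members (meetingFamily Y))
          (subst (λ A → X ∈ₗ slice Y A k) (Empty-unique ne) (∈-slice⁺ Y (∈-sized⁻ i)))

  count≤ : ∀ (Y : Subset n) → (∀ {F} → F ∈ᶠ 𝓕 → Nonempty (F ∩ Y)) → size 𝓕 + (n ∸ ∣ Y ∣) C k ≤ n C k
  count≤ Y h = begin
    size 𝓕 + (n ∸ ∣ Y ∣) C k            ≡⟨ cong (size 𝓕 +_) (trans (length-slice Y ∅ k (⊆-min Y) (∣∅∣≤ n))
                                            (cong₂ _C_ (∣∁p∣≡n∸∣p∣ Y) (cong (k ∸_) (∣⊥∣≡0 n)))) ⟨
    size 𝓕 + length (slice Y ∅ k)       ≡⟨ List.length-++ (members 𝓕) ⟨
    length (members 𝓕 ++ slice Y ∅ k)   ≤⟨ Unique-⊆⇒length≤ (Unique.++⁺ (unique 𝓕) (slice-unique Y ∅ k) disj)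
                                            (λ i → [ (λ j → ∈-sized⁺ (uniform j)) , (λ j → ∈-sized⁺ (proj₁ (∈-slice⁻ Y ∅ (⊆-min Y) j))) ]′ (∈-++⁻ (members 𝓕) i)) ⟩
    length (sized n k)                  ≡⟨ length-sized n k ⟩
    n C k                               ∎
    where
    open ≤-Reasoning
    disj : ∀ {X} → X ∈ₗ members 𝓕 × X ∈ₗ slice Y ∅ k → ⊥
    disj (i , j) = let x , p = h i in ∉⊥ (subst (x ∈_) (proj₂ (∈-slice⁻ Y ∅ (⊆-min Y) j)) p)

  1≤k : 1 ≤ k
  1≤k = c<k

  subsetsOfSize : ∀ (Y : Subset n) h → length (slice (∁ Y) ∅ h) ≡ ∣ Y ∣ C h
  subsetsOfSize Y h = trans (length-slice (∁ Y) ∅ h (⊆-min (∁ Y)) (∣∅∣≤ n))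
    (cong₂ _C_ (trans (∣∁p∣≡n∸∣p∣ (∁ Y)) (trans (cong (n ∸_) (∣∁p∣≡n∸∣p∣ Y)) (m∸[m∸n]≡n (∣p∣≤n Y)))) (cong (h ∸_) (∣⊥∣≡0 n)))

  ⊆⇒∩∁≡∅ : ∀ {A Y : Subset n} → A ⊆ Y → A ∩ ∁ Y ≡ ∅
  ⊆⇒∩∁≡∅ s = Disj⇒∩≡∅ λ x p q → x∈∁p⇒x∉p q (s p)

  ∩∁≡∅⇒⊆ : ∀ {A Y : Subset n} → A ∩ ∁ Y ≡ ∅ → A ⊆ Y
  ∩∁≡∅⇒⊆ eq p = x∉∁p⇒x∈p λ q → ∉⊥ (subst (_ ∈_) eq (∩⁺ p q))

  module _ (T : ℕ) (Y : Subset n) (good : Base.Good S T Y) (large : T + s * k + k ≤ n) where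

    open Base S T Y
    open Conclude good large

    private
      meetsY : ∀ {F} → F ∈ᶠ 𝓕 → Nonempty (F ∩ Y)
      meetsY {F} i = nonempty (F ∩ Y) (proj₁ (All.lookup (proj₂ (proj₂ good)) i))

      single : ∀ {x} → x ∈ Y → ⁅ x ⁆ ∈ᶠ 𝓢
      single p = let G , m , e , q = cover⁻ (proj₁ (proj₂ good) p) in
        subst (_∈ᶠ 𝓢) (singleton e q) (∈-familyOf⁺ member? m)

      everything : ∀ {X} → ∣ X ∣ ≡ k → Nonempty (X ∩ Y) → X ∈ᶠ 𝓕
      everything = meeting⇒member Y (_∈ᶠ 𝓢) (avoids₀ refl) single meetsY

      levels≥ : ∀ h → ∣ Y ∣ C suc h ≤ size (𝓢 ⟨ suc h ⟩)
      levels≥ h = ≤-trans (≤-reflexive (sym (subsetsOfSize Y (suc h))))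
        (Unique-⊆⇒length≤ (slice-unique (∁ Y) ∅ (suc h)) λ {A} i →
          let e , eq = ∈-slice⁻ (∁ Y) ∅ (⊆-min (∁ Y)) i
              A⊆Y = ∩∁≡∅⇒⊆ eq
              0<A = ≤-trans (s≤s z≤n) (≤-reflexive (sym e))
          in ∈-filter⁺ (λ A → ∣ A ∣ ≟ suc h) (∈-familyOf⁺ member? ((λ {x} → A⊆Y {x}) , 0<A ,
               filled⁺ A⊆Y λ eX eq′ → everything eX (subst Nonempty (sym eq′) (nonempty A 0<A)))) e)

    -- Traces with more than k elements leave no mark on |𝓕|, so its size cannot control all
    -- components. Counting the k-sets that meet the bases gives y′ ≤ y, and 𝓢 contains every
    -- nonempty subset of `Y`; it therefore dominates level by level.
    lexMaximal₁ : IsLexMaximal s 1 T 𝓢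
    lexMaximal₁ 𝓣 none sup = compare (m≤n⇒m<n∨m≡n y′≤y)
      where
      Y′ : Subset n
      Y′ = supp (𝓣 ⟨ 1 ⟩)
      y y′ : ℕ
      y = ∣ Y ∣
      y′ = ∣ Y′ ∣
      av : Avoids s 0 (_∈ᶠ 𝓣)
      av = ¬contains⇒avoids {𝓢 = 𝓣} 2≤s (λ i → proj₁ (proj₂ (sup i))) none
      single′ : ∀ {x} → x ∈ Y′ → ⁅ x ⁆ ∈ᶠ 𝓣
      single′ p = let G , i , q = ∈⋃⁻ (members (𝓣 ⟨ 1 ⟩)) p
                      G∈ , e = ∈-filter⁻ (λ A → ∣ A ∣ ≟ 1) {xs = members 𝓣} i
                  in subst (_∈ᶠ 𝓣) (singleton e q) G∈
      y′≤y : y′ ≤ y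
      y′≤y = ≮⇒≥ λ y<y′ → <⇒≱
        (C-strict (∸-monoʳ-< y<y′ (∣p∣≤n Y′)) 1≤k (≤-trans (≤-trans (m≤n+m k (s * k)) (≤-reflexive
          (sym (trans (cong (_∸ T) (+-assoc T (s * k) k)) (m+n∸m≡n T _))))) (∸-mono large ∣Y∣≤T)))
        (+-cancelˡ-≤ (size 𝓕) _ _ (≤-trans (count≤ Y meetsY) (count≥ Y′ (_∈ᶠ 𝓣) av single′)))
      levels≤ : ∀ h → size (𝓣 ⟨ h ⟩) ≤ y′ C h
      levels≤ h = ≤-trans (Unique-⊆⇒length≤ (unique (𝓣 ⟨ h ⟩)) λ {A} i →
          let A∈ , e = ∈-filter⁻ (λ A → ∣ A ∣ ≟ h) {xs = members 𝓣} i in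
          subst (λ Z → A ∈ₗ slice (∁ Y′) Z h) (⊆⇒∩∁≡∅ (proj₁ (sup A∈))) (∈-slice⁺ (∁ Y′) e))
        (≤-reflexive (subsetsOfSize Y′ h))
      compare : y′ < y ⊎ y′ ≡ y → φ̃ 1 T 𝓣 ≤ₗₑₓ φ̃ 1 T 𝓢
      compare (inj₁ y′<y) = this (+-monoˡ-< 0 (≤-trans (s≤s (levels≤ 1))
        (≤-trans (C-strict y′<y (s≤s z≤n) (≤-trans (s≤s z≤n) y′<y)) (levels≥ 0)))) refl
      compare (inj₂ y′≡y) = pointwise⇒lex (suc (T ∸ 1)) (φ̃-component 1 T 𝓣) (φ̃-component 1 T 𝓢) λ i →
        +-mono-≤ (level i) (∑-mono (upTo i) λ {j} _ → *-mono-≤ (level j)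
          (≤-reflexive (cong (λ z → (T ∸ z) C (i ∸ j)) (trans y′≡y (cong ∣_∣ (sym supp≡Y))))))
        where
        level : ∀ i → size (𝓣 ⟨ suc i ⟩) ≤ size (𝓢 ⟨ suc i ⟩)
        level i = ≤-trans (levels≤ (suc i)) (≤-trans (C-monoˡ-≤ (suc i) y′≤y) (levels≥ i))

  -- Traces of size at most 1 lie in 𝒮 and are nonempty, so every member meets `Y`. By
  -- `meeting⇒member` 𝓕 then contains all k-sets meeting `Y`, which fills every nonempty trace.
  stage⇒good₁ : ∀ {T} (st : Stage S 1 T) → Base.Good S T (Stage.Y st)
  stage⇒good₁ {T} st = ∣Y∣≤B , (λ p → let G , G∈ , e , q = covered p in cover⁺ (proj₁ (bounds G∈) , proj₁ (proj₂ (bounds G∈)) ,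
      filled⁺ (proj₁ (bounds G∈)) (λ eX eq → everything eX (_ , subst (_ ∈_) (sym eq) q))) e q) ,
      All.tabulate λ {F} F∈ → let x , p = meets F∈ in
        ≤-trans (s≤s z≤n) (x∈p⇒∣p-x∣<∣p∣ p) , filled⁺ (∩ʳ F Y) λ eX eq → everything eX (x , subst (x ∈_) (sym eq) p)
    where
    open Stage st
    open Base S T Y
    meets : ∀ {F} → F ∈ᶠ 𝓕 → Nonempty (F ∩ Y)
    meets {F} F∈ = decidable-stable (nonempty? (F ∩ Y)) λ ne →
      let ∣∅∣ = trans (cong ∣_∣ (Empty-unique ne)) (∣⊥∣≡0 n) in
      contradiction (≤-trans (proj₁ (proj₂ (bounds (traces F∈ (≤-trans (≤-reflexive ∣∅∣) z≤n))))) (≤-reflexive ∣∅∣)) λ ()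
    single : ∀ {x} → x ∈ Y → ⁅ x ⁆ ∈ₗ 𝒮
    single p = let G , G∈ , e , q = covered p in subst (_∈ₗ 𝒮) (singleton e q) G∈
    everything : ∀ {X} → ∣ X ∣ ≡ k → Nonempty (X ∩ Y) → X ∈ᶠ 𝓕
    everything = meeting⇒member Y (_∈ₗ 𝒮) avoids single meets

-- As |Y| ≤ T, no trace exceeds level T, so 𝒮 contains the traces of all members.
stage⇒good : ∀ {s k c n T} {S : Setting s k c n} (st : Stage S T T) → Base.Good S T (Stage.Y st)
stage⇒good {k = k} {T = T} {S} st = ∣Y∣≤B ,
    (λ p → let G , G∈ , e , q = covered p in cover⁺ (proj₁ (bounds G∈) , proj₁ (proj₂ (bounds G∈)) , filled G∈) e q) ,
    All.tabulate λ {F} F∈ → let i = traces F∈ (≤-trans (∣p∩q∣≤∣q∣ F Y) ∣Y∣≤B) in proj₁ (proj₂ (bounds i)) , filled i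
  where
  open Setting S
  open Stage st
  open Base S T Y
  filled : ∀ {A} → A ∈ₗ 𝒮 → Filled A
  filled {A} i = filled⁺ (proj₁ (bounds i)) λ e eq → saturated e (subst (_∈ₗ 𝒮) (sym eq) i)

-- Thresholds and parameters

-- `β` is the number of sets reachable from one generating set; the second summand accounts for the
-- split members of the exceptional parameters.
firstConst : ℕ → ℕ → ℕ
firstConst s k = β + (β + 2)
  where
  β : ℕ
  β = suc (2 ^ (k + k) * (s * k)) ^ k

laterThreshold : ℕ → ℕ → ℕ → ℕ → ℕ → ℕ
laterThreshold s k c T a = threshold s k c (suc a) T (2 ^ T) (nextConst s k c T)

localThreshold : ℕ → ℕ → ℕ → ℕ → ℕ
localThreshold s k c T =
  threshold s k c (suc c) T T (firstConst s k) + (∑ (upTo k) (laterThreshold s k c T) + lexThreshold k T)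

-- The threshold must not depend on t, so it sums over all c < k and all T ≤ s + k.
globalThreshold : ℕ → ℕ → ℕ
globalThreshold s k = ∑ (upTo k) λ c → ∑ (upTo (suc (s + k))) (localThreshold s k c)

local≤global : ∀ s k {c T} → c < k → T ≤ s + k → localThreshold s k c T ≤ globalThreshold s k
local≤global s k {c} c<k T≤ = ≤-trans (∑-member (upTo (suc (s + k))) (localThreshold s k c) (∈-upTo⁺ (s≤s T≤)))
  (∑-member (upTo k) (λ c → ∑ (upTo (suc (s + k))) (localThreshold s k c)) (∈-upTo⁺ c<k))

distinctElements : ∀ {A : Set} m {xs : List A} → Unique xs → m ≤ length xs →
                   Σ[ f ∈ (Fin m → A) ] (∀ {i j} → f i ≡ f j → i ≡ j) × (∀ i → f i ∈ₗ xs)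
distinctElements zero _ _ = (λ ()) , (λ { {()} }) , λ ()
distinctElements {A} (suc m) {x ∷ xs} (x∉ ∷ u) (s≤s l) with distinctElements m u l
... | f , inj , mem = g , g-inj , g-mem
  where
  g : Fin (suc m) → A
  g zero = x
  g (suc i) = f i
  g-inj : ∀ {i j} → g i ≡ g j → i ≡ j
  g-inj {zero} {zero} _ = refl
  g-inj {zero} {suc j} e = contradiction e (All.lookup x∉ (mem j))
  g-inj {suc i} {zero} e = contradiction (sym e) (All.lookup x∉ (mem i))
  g-inj {suc i} {suc j} e = cong suc (inj e)
  g-mem : ∀ i → g i ∈ₗ x ∷ xs
  g-mem zero = here refl
  g-mem (suc i) = there (mem i)

-- Any s distinct singletons form a sunflower with empty core. For t = 1, where the hypothesis on k
-- says nothing about T, this bounds T by s.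
singletons-bounded : ∀ {s n} (𝓐 : Family n) → 2 ≤ s → Uniform 1 𝓐 → ¬ ContainsSunflower s U 𝓐 → size 𝓐 ≤ s
singletons-bounded {s} {n} 𝓐 2≤s uni free = <⇒≤ (≰⇒> λ l → large (distinctElements s (unique 𝓐) l))
  where
  large : Σ[ f ∈ (Fin s → Subset n) ] (∀ {i j} → f i ≡ f j → i ≡ j) × (∀ i → f i ∈ᶠ 𝓐) → ⊥
  large (f , inj , mem) = free (f , kernel⇒sunflower 2≤s {f} {∅}
      ((λ i p → ⊥-elim (∉⊥ p)) , λ {i} {j} ne p q →
        contradiction (inj (trans (singleton (uni (mem i)) p) (sym (singleton (uni (mem j)) q)))) ne)
      (λ i → ≤-trans (s≤s (≤-reflexive (∣⊥∣≡0 n))) (≤-reflexive (sym (uni (mem i))))) , mem , _)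

fewMembers : ∀ {s n} (𝓐 : Family n) → size 𝓐 < s → ¬ ContainsSunflower s U 𝓐
fewMembers {s} 𝓐 l (F , (inj , _) , mem , _) = <⇒≱ l (≤-trans (≤-reflexive (sym (List.length-tabulate F)))
  (Unique-⊆⇒length≤ (Unique.tabulate⁺ inj) λ i → case ∈-tabulate⁻ i of λ { (j , refl) → mem j }))

module Parameters {s k c φ n : ℕ} (2≤s : 2 ≤ s) (1≤c : 1 ≤ c) (h : (suc c + suc c * φ) * c ≤ k) (k≤n : k ≤ n)
  (φ-bound : ∀ (𝓐 : Family n) → Uniform (suc c) 𝓐 → ¬ ContainsSunflower s U 𝓐 → size 𝓐 ≤ φ) where

  open ≤-Reasoning

  t T : ℕ
  t = suc c
  T = t * φ

  2≤t : 2 ≤ t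
  2≤t = s≤s 1≤c

  ≤*c : ∀ x → x ≤ x * c
  ≤*c x = ≤-trans (≤-reflexive (sym (*-identityʳ x))) (*-monoʳ-≤ x 1≤c)

  t+T≤k : t + T ≤ k
  t+T≤k = ≤-trans (≤*c (t + T)) h

  t≤n : t ≤ n
  t≤n = ≤-trans (≤-trans (m≤m+n t T) t+T≤k) k≤n

  1≤φ : 1 ≤ φ
  1≤φ = let A , _ , e = subsetOfSize (full {n}) (≤-trans t≤n (≤-reflexive (sym (∣⊤∣≡n n)))) in
    φ-bound (family (A ∷ []) ([] ∷ [])) (λ { (here refl) → e }) (fewMembers (family (A ∷ []) ([] ∷ [])) 2≤s)

  t≤T : t ≤ T
  t≤T = ≤-trans (≤-reflexive (sym (*-identityʳ t))) (*-monoʳ-≤ t 1≤φ)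

  T≤k : T ≤ k
  T≤k = ≤-trans (m≤n+m T t) t+T≤k

  T+c≤k : T + c ≤ k
  T+c≤k = ≤-trans (≤-trans (+-monoʳ-≤ T (n≤1+n c)) (≤-reflexive (+-comm T t))) t+T≤k

  2c+T≤k : c + c + T ≤ k
  2c+T≤k = begin
    c + c + T           ≡⟨ cong (_+ T) (solve 1 (λ x → x :+ x := con 2 :* x) refl c) ⟩
    2 * c + T           ≤⟨ +-mono-≤ (*-monoˡ-≤ c 2≤t) (≤*c T) ⟩
    t * c + T * c       ≡⟨ *-distribʳ-+ c t T ⟨
    (t + T) * c         ≤⟨ h ⟩
    k                   ∎

  2c≤k∸ : ∀ {a} → a ≤ T → c + c ≤ k ∸ a
  2c≤k∸ {a} l = ≤-trans (≤-reflexive (sym (m+n∸n≡m (c + c) T))) (∸-mono 2c+T≤k l)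

  -- As c ≥ 1, the left side is at most c (t + 2), and T ≥ t ≥ 2.
  room : ∀ {m} → m ≤ suc c → c * (2 + suc c ∸ m) + m ≤ k
  room {m} l = begin
    c * (2 + t ∸ m) + m         ≤⟨ +-monoʳ-≤ _ (≤-trans (≤*c m) (≤-reflexive (*-comm m c))) ⟩
    c * (2 + t ∸ m) + c * m     ≡⟨ *-distribˡ-+ c (2 + t ∸ m) m ⟨
    c * (2 + t ∸ m + m)         ≡⟨ cong (c *_) (m∸n+n≡m (≤-trans l (m≤n+m t 2))) ⟩
    c * (2 + t)                 ≤⟨ *-monoʳ-≤ c (≤-trans (+-monoˡ-≤ t (≤-trans 2≤t t≤T)) (≤-reflexive (+-comm T t))) ⟩
    c * (t + T)                 ≡⟨ *-comm c (t + T) ⟩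
    (t + T) * c                 ≤⟨ h ⟩
    k                           ∎

  twoSets : 3 ≤ s → 3 ≤ n → c ≡ 1 → 2 ≤ φ
  twoSets 3≤s 3≤n c≡1 =
    let A , _ , e = subsetOfSize (full {n}) (≤-trans t≤n (≤-reflexive (sym (∣⊤∣≡n n))))
        x , x∈ = nonempty A (≤-trans (s≤s z≤n) (≤-reflexive (sym e)))
        y , y∈ = nonempty (∁ A) (≤-trans (≤-trans (≤-reflexive (sym (trans (cong (3 ∸_) (cong suc c≡1)) refl)))
                   (≤-trans (∸-monoˡ-≤ t 3≤n) (≤-reflexive (cong (n ∸_) (sym e))))) (≤-reflexive (sym (∣∁p∣≡n∸∣p∣ A))))
        A′ = (A - x) ∪ ⁅ y ⁆
        e′ : ∣ A′ ∣ ≡ suc c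
        e′ = trans (∣∪∣-disj (A - x) ⁅ y ⁆ λ z p q → x∈∁p⇒x∉p y∈ (subst (_∈ A) (x∈⁅y⁆⇒x≡y y q) (─ˡ A ⁅ x ⁆ p)))
               (trans (cong₂ _+_ (∣─∣≡ {X = A} {⁅ x ⁆} (λ p → subst (_∈ A) (sym (x∈⁅y⁆⇒x≡y x p)) x∈) e (∣⁅x⁆∣≡1 x)) (∣⁅x⁆∣≡1 y)) (+-comm c 1))
        A≢A′ : A ≢ A′
        A≢A′ eq = x∈∁p⇒x∉p y∈ (subst (y ∈_) (sym eq) (∪ʳ (x∈⁅x⁆ y)))
        𝓐 = family (A ∷ A′ ∷ []) ((A≢A′ ∷ []) ∷ [] ∷ [])
    in φ-bound 𝓐 (λ { (here refl) → e ; (there (here refl)) → e′ }) (fewMembers 𝓐 3≤s)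

  -- For c ≥ 2 already (t + T) c ≥ 4t. For c = 1 only k = 4 falls short of 3c + 2; then T = 2 φ ≤ 2,
  -- so φ = 1, which `twoSets` rules out unless s = 2.
  roomy : (c ≡ 0 ⊎ c + (suc c + suc c) ≤ k) ⊎ (s ≡ 2 × c ≡ 1 × k ≡ 4)
  roomy = byC (m≤n⇒m<n∨m≡n 1≤c)
    where
    4≤k : 4 ≤ k
    4≤k = ≤-trans (+-mono-≤ 2≤t (≤-trans 2≤t t≤T)) t+T≤k
    byK : c ≡ 1 → s ≡ 2 ⊎ 2 ≤ φ → 5 ≤ k ⊎ k ≡ 4 → (c ≡ 0 ⊎ c + (suc c + suc c) ≤ k) ⊎ (s ≡ 2 × c ≡ 1 × k ≡ 4)
    byK c≡1 _ (inj₁ l) = inj₁ (inj₂ (≤-trans (≤-reflexive (cong (λ z → z + (suc z + suc z)) c≡1)) l))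
    byK c≡1 (inj₁ s≡2) (inj₂ k≡4) = inj₂ (s≡2 , c≡1 , k≡4)
    byK c≡1 (inj₂ 2≤φ) (inj₂ k≡4) = contradiction (≤-trans (+-mono-≤ 2≤t (*-mono-≤ 2≤t 2≤φ)) (≤-trans t+T≤k (≤-reflexive k≡4)))
      λ { (s≤s (s≤s (s≤s (s≤s ())))) }
    orEqual : ∀ {a b} → a ≤ b → suc a ≤ b ⊎ b ≡ a
    orEqual l = [ inj₁ , (λ e → inj₂ (sym e)) ]′ (m≤n⇒m<n∨m≡n l)
    byC : 1 < c ⊎ 1 ≡ c → (c ≡ 0 ⊎ c + (suc c + suc c) ≤ k) ⊎ (s ≡ 2 × c ≡ 1 × k ≡ 4)
    byC (inj₂ 1≡c) = byK (sym 1≡c)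
      ([ (λ 3≤s → inj₂ (twoSets 3≤s (≤-trans (≤-trans (n≤1+n 3) 4≤k) k≤n) (sym 1≡c))) , inj₁ ]′ (orEqual 2≤s)) (orEqual 4≤k)
    byC (inj₁ 2≤c) = inj₁ (inj₂ (begin
      c + (t + t)               ≤⟨ +-monoˡ-≤ (t + t) (≤-trans (n≤1+n c) (m≤m+n t t)) ⟩
      (t + t) + (t + t)         ≡⟨ solve 1 (λ x → x :+ x := x :* con 2) refl (t + t) ⟩
      (t + t) * 2               ≤⟨ *-mono-≤ (+-monoʳ-≤ t t≤T) 2≤c ⟩
      (t + T) * c               ≤⟨ h ⟩
      k                         ∎))

module FirstUnclean {s k c n : ℕ} (S : Setting s k c n) where

  open Setting S

  open Roots S
  open Rooted S ∅

  Unclean : Set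
  Unclean = ∃[ unclean ] length unclean * n ≤ firstConst s k * n ^ (k ∸ suc c) ×
              (∀ {F} → F ∈ᶠ 𝓕 → F ∈ₗ unclean ⊎ ∃[ G ] ∣ G ∣ ≡ suc c × G ⊆ F × Root G (F ─ G))

  star⇒root : ∀ {F} → F ∈ᶠ 𝓕 → Star F → ∃[ G ] ∣ G ∣ ≡ suc c × G ⊆ F × Root G (F ─ G)
  star⇒root {F} F∈ (P , ∣P∣ , P⊆F , ext) = P , ∣P∣ , (λ {x} → P⊆F {x}) ,
    (λ x p q → ─ʳ F P q p) , (λ x _ p → ∉⊥ p) , subst (_∈ᶠ 𝓕) (sym (∪─ P⊆F)) F∈ ,
    All.tabulate λ {D} i _ → extendable⇒¬blocked (ext ∪ˡ (∪-⊆ P⊆F (─ˡ F P ∘ ∈-subsets⁻ i)))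

  roomy⇒unclean : Roomy → Unclean
  roomy⇒unclean rm = generated (k ∸ suc c) ,
      ≤-trans (length-generated (m∸n≤m k (suc c))) (*-monoˡ-≤ (n ^ (k ∸ suc c)) (m≤m+n (branching ^ k) (branching ^ k + 2))) ,
      λ F∈ → outcome F∈ (classify (inj₁ rm) F∈)
    where
    impossible : ∀ {F} → Roomy → Split F × c ≡ 1 × k ≡ 4 → ⊥
    impossible (inj₁ c≡0) (_ , c≡1 , _) = contradiction (trans (sym c≡0) c≡1) λ ()
    impossible (inj₂ l) (_ , c≡1 , k≡4) = contradiction
      (≤-trans (≤-reflexive (cong (λ z → z + (suc z + suc z)) (sym c≡1))) (≤-trans l (≤-reflexive k≡4)))
      λ { (s≤s (s≤s (s≤s (s≤s ())))) }
    outcome : ∀ {F} → F ∈ᶠ 𝓕 → F ∈ₗ generated (k ∸ suc c) ⊎ Star F ⊎ (Split F × c ≡ 1 × k ≡ 4) →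
              F ∈ₗ generated (k ∸ suc c) ⊎ ∃[ G ] ∣ G ∣ ≡ suc c × G ⊆ F × Root G (F ─ G)
    outcome F∈ (inj₁ g) = inj₁ g
    outcome F∈ (inj₂ (inj₁ st)) = inj₂ (star⇒root F∈ st)
    outcome F∈ (inj₂ (inj₂ sp)) = ⊥-elim (impossible rm sp)

exceptional⇒unclean : ∀ {s k c n} (S : Setting s k c n) → s ≡ 2 → c ≡ 1 → k ≡ 4 → 2 ≤ n → FirstUnclean.Unclean S
exceptional⇒unclean {k = k} S refl refl k≡4 2≤n = E.unclean , E.unclean-small 2≤n , λ {F} F∈ → decide F F∈ (E.clean? F)
  where
  open Setting S
  module E = Exceptional S k≡4
  open Rooted S ∅
  decide : ∀ F → F ∈ᶠ 𝓕 → Dec (E.Clean F) → F ∈ₗ E.unclean ⊎ ∃[ G ] ∣ G ∣ ≡ 2 × G ⊆ F × Root G (F ─ G)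
  decide F F∈ (yes cl) = let G , G∈ , G⊆F , ρ = find cl in inj₂ (G , ∈-sized⁻ G∈ , (λ {x} → G⊆F {x}) , ρ)
  decide F F∈ (no nc) = inj₁ (∈-filter⁺ (¬? ∘ E.clean?) F∈ nc)

module Stages {s k c n φ : ℕ} (S : Setting s k c n) (large : localThreshold s k c (suc c * φ) ≤ n)
  (φ-bound : ∀ (𝓐 : Family n) → Uniform (suc c) 𝓐 → ¬ ContainsSunflower s U 𝓐 → size 𝓐 ≤ φ) where

  private
    T = suc c * φ
    N₁ = threshold s k c (suc c) T T (firstConst s k)
    N₂ = ∑ (upTo k) (laterThreshold s k c T)
    N₃ = lexThreshold k T

  first≤n : N₁ ≤ n
  first≤n = ≤-trans (m≤m+n N₁ (N₂ + N₃)) large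

  later≤n : ∀ {a} → a < k → laterThreshold s k c T a ≤ n
  later≤n l = ≤-trans (∑-member (upTo k) (laterThreshold s k c T) (∈-upTo⁺ l))
    (≤-trans (≤-trans (m≤m+n N₂ N₃) (m≤n+m (N₂ + N₃) N₁)) large)

  lex≤n : N₃ ≤ n
  lex≤n = ≤-trans (≤-trans (m≤n+m N₃ N₂) (m≤n+m (N₂ + N₃) N₁)) large

  base≤n : T + s * k + k ≤ n
  base≤n = ≤-trans (≤-trans (+-monoˡ-≤ k (+-monoʳ-≤ T (m≤m+n (s * k) c))) (m≤m+n (T + (s * k + c) + k) _))
    (≤-trans (m≤m+n (2 * (T + (s * k + c) + k)) _) first≤n)

  firstStage : suc c + c ≤ k → c + c ≤ k ∸ suc c → (∀ {m} → m ≤ suc c → c * (2 + suc c ∸ m) + m ≤ k) →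
               FirstUnclean.Unclean S → ¬ ¬ Stage S (suc c) T
  firstStage t+c≤k 2c≤ room (unclean , small , clean) = FirstStage.firstStage S T φ (firstConst s k)
    (≤-reflexive (*-comm φ (suc c))) t+c≤k 2c≤ room φ-bound unclean small clean first≤n

  module Many (1≤c : 1 ≤ c) (h : (suc c + suc c * φ) * c ≤ k) where

    k≤n : k ≤ n
    k≤n = ≤-trans (m≤n+m k (T + s * k)) base≤n

    open Parameters (Setting.2≤s S) 1≤c h k≤n φ-bound public hiding (T)

    stages : ∀ d → suc c + d ≤ T → FirstUnclean.Unclean S → ¬ ¬ Stage S (suc c + d) T
    stages zero l un = subst (λ a → ¬ ¬ Stage S a T) (sym (+-identityʳ (suc c)))
      (firstStage (≤-trans (+-monoˡ-≤ c t≤T) T+c≤k) (2c≤k∸ t≤T) room un)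
    stages (suc d) l un none = stages d (≤-trans (n≤1+n (suc c + d)) l′) un λ st →
        NextStage.nextStage S (suc c + d) T st (≤-trans (n≤1+n c) (m≤m+n (suc c) d))
          (≤-trans (+-monoˡ-≤ c l′) T+c≤k) (2c≤k∸ l′) (later≤n (≤-trans l′ T≤k))
          (λ st′ → none (subst (λ a → Stage S a T) (sym (+-suc (suc c) d)) st′))
      where
      l′ : suc (suc c + d) ≤ T
      l′ = ≤-trans (≤-reflexive (sym (+-suc (suc c) d))) l

    unclean : FirstUnclean.Unclean S
    unclean = [ FirstUnclean.roomy⇒unclean S , (λ (s≡2 , c≡1 , k≡4) → exceptional⇒unclean S s≡2 c≡1 k≡4 (≤-trans 2≤t t≤n)) ]′ roomy

    good : ¬ ¬ (∃[ Y ] Base.Good S T Y)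
    good none = subst (λ a → ¬ ¬ Stage S a T) (m+[n∸m]≡n t≤T)
      (stages (T ∸ suc c) (≤-reflexive (m+[n∸m]≡n t≤T)) unclean) λ st → none (Stage.Y st , stage⇒good {S = S} st)

-- Assembly: the base, the family of traces and the uniform threshold

Conclusion : ∀ {s k c n} → Setting s k c n → ℕ → Set
Conclusion {s} {k} {c} {n} S T = Σ[ 𝓢 ∈ Family n ]
  NoSmallCoreSunflower s (suc c) 𝓢 × SupportedOnBase (suc c) T 𝓢 × IsLexMaximal s (suc c) T 𝓢 ×
  (∀ A → A ∈ᶠ Setting.𝓕 S ⇔ (∣ A ∣ ≡ k × A ∩ supp (𝓢 ⟨ suc c ⟩) ∈ᶠ 𝓢))

-- Maximal collections of traces exist only under a double negation, but being
-- Good is decidable, so that the base can be found by search.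
findGood : ∀ {s k c n} (S : Setting s k c n) T → ¬ ¬ (∃[ Y ] Base.Good S T Y) → ∃[ Y ] Base.Good S T Y
findGood S T = decidable-stable (anySubset? (Base.good? S T))

-- For c = 0, T may exceed k, so the stages cannot be run up to level T; the first one already gives
-- a good base. For c ≥ 1 all levels up to T fit below k.
conclude : ∀ {s k n} c φ (S : Setting s k c n) → (suc c + suc c * φ) * c ≤ k → localThreshold s k c (suc c * φ) ≤ n →
           (∀ (𝓐 : Family n) → Uniform (suc c) 𝓐 → ¬ ContainsSunflower s U 𝓐 → size 𝓐 ≤ φ) → Conclusion S (suc c * φ)
conclude {s} {k} {n} zero φ S h large φ-bound = result (findGood S T λ none →
    firstStage (Setting.c<k S) z≤n (λ l → ≤-trans l (Setting.c<k S)) (FirstUnclean.roomy⇒unclean S (inj₁ refl)) λ st →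
      none (Stage.Y st , Matching.stage⇒good₁ S st))
  where
  T = 1 * φ
  open Stages {φ = φ} S large φ-bound
  result : ∃[ Y ] Base.Good S T Y → Conclusion S T
  result (Y , good) = Base.𝓢 S T Y , avoids⇒¬contains {𝓢 = Base.𝓢 S T Y} (avoids₀ refl) , supported ,
      Matching.lexMaximal₁ S T Y good base≤n , membership
    where open Base.Conclude S T Y good base≤n
conclude {s} {k} {n} (suc c′) φ S h large φ-bound = result (findGood S T good)
  where
  c = suc c′
  T = suc c * φ
  open Stages {φ = φ} S large φ-bound
  open Many (s≤s z≤n) h
  result : ∃[ Y ] Base.Good S T Y → Conclusion S T
  result (Y , good) = Base.𝓢 S T Y , avoids⇒¬contains {𝓢 = Base.𝓢 S T Y} (avoids₁ T+c≤k) , supported ,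
      Lex.lexMaximal T+c≤k t≤T lex≤n (λ 𝓐 uni free → *-monoʳ-≤ (suc c) (φ-bound 𝓐 uni free)) , membership
    where open Base.Conclude S T Y good base≤n

theorem2p1 : (s k : ℕ) → 2 ≤ s → 1 ≤ k →
    ∃[ n₀ ] ((t φ : ℕ) → 1 ≤ t → IsSunflowerNumber s t φ →
    let T = t * φ in
    (t + T) * (t ∸ 1) ≤ k →
    (n : ℕ) → n₀ ≤ n →
    (𝓕 : Family n) → IsExtremal s (t ∸ 1) k 𝓕 →
    Σ[ 𝓢 ∈ Family n ]
    NoSmallCoreSunflower s t 𝓢 ×
    SupportedOnBase t T 𝓢 ×
    IsLexMaximal s t T 𝓢 ×
    (∀ A → A ∈ᶠ 𝓕 ⇔ (∣ A ∣ ≡ k × A ∩ supp (𝓢 ⟨ t ⟩) ∈ᶠ 𝓢)))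
theorem2p1 s k 2≤s 1≤k = globalThreshold s k , λ where
    (suc c) φ _ isφ h n N≤n 𝓕 ((uniform , free) , maximal) → conclude c φ
      (record { 2≤s = 2≤s ; c<k = c<k c φ h ; 𝓕 = 𝓕 ; uniform = uniform ; sunflowerFree = free
              ; maximal = λ 𝓖 uni fr → maximal 𝓖 (uni , fr) })
      h (≤-trans (local≤global s k (c<k c φ h) (T≤ c φ isφ h)) N≤n) (λ 𝓐 uni fr → proj₂ isφ 𝓐 (uni , fr))
  where
  c<k : ∀ c φ → (suc c + suc c * φ) * c ≤ k → c < k
  c<k zero φ h = 1≤k
  c<k (suc c) φ h = ≤-trans (≤-trans (m≤m*n (suc (suc c)) (suc c)) (*-monoˡ-≤ (suc c) (m≤m+n (suc (suc c)) _))) h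
  T≤ : ∀ c φ → IsSunflowerNumber s (suc c) φ → (suc c + suc c * φ) * c ≤ k → suc c * φ ≤ s + k
  T≤ zero φ ((N , 𝓐 , (uni , free) , e) , _) h = ≤-trans (≤-reflexive (trans (+-identityʳ φ) (sym e)))
    (≤-trans (singletons-bounded 𝓐 2≤s uni free) (m≤m+n s k))
  T≤ (suc c) φ _ h = ≤-trans (≤-trans (m≤m*n (suc (suc c) * φ) (suc c)) (*-monoˡ-≤ (suc c) (m≤n+m (suc (suc c) * φ) (suc (suc c)))))
    (≤-trans h (m≤n+m k s))
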